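{- Let $q$ be an odd prime power, $d\ge3$, $Q$ a nondegenerate quadratic form on $\mathbb F_q^d$, and let $v,w,R,X_R,N_R,Z,t,c_z,A_z,\mathcal S_z,P,\mathcal S$ be as in the block construction described in the context. Then the following hold. (1) $|P|=tN_R$ and $|\mathcal S|=tq$. (2) For $b,z\in Z$, $$\sigma(A_b,\mathcal S_z)=\begin{cases}(q-1)N_R,&b=z,\\0,&b\ne z,\end{cases}$$ and consequently $$\sigma(P,\mathcal S)=t(q-1)N_R=\sum_{z\in Z}\sigma(A_z,\mathcal S_z).$$ The exact parameter $K_*$ defined by $\sigma(P,\mathcal S)=K_*q^{(d-1)/2}\sqrt{|P||\mathcal S|}$ is $$K_*=(1-q^{ -1})\frac{\sqrt{N_R}}{q^{(d-2)/2}}.$$ Thus $K_*\to1$ as $q\to\infty$ for each fixed $d\ge4$, while for $d=3$ one may choose $R$ so that $K_*=(1-q^{ -1})\sqrt2$. (3) Every point $x\in P$ has degree $d_{\mathcal S}(x)=q+t-1$. (4) If $z\in Z$ and $u\ne u'$ in $\mathbb F_q$, then $$S_Q(c_z+uv,R)\cap S_Q(c_z+u'v,R)=A_z.$$ All these pairs have center-difference direction $[v]$ (the center difference is a nonzero multiple of $v$), and their radical hyperplane is $$H_z=\{x\in\mathbb F_q^d:\langle x,v\rangle_Q=z\}.$$ (5) If $d\ge4$ and $H$ is an affine hyperplane, then $$|P\cap H|\le\max\{N_R,\,2tq^{d-3}\}.$$ In particular, for each $d\ge4$ there is a constant $B_d>0$ such that, for all sufficiently large $q$, $$\max_H\frac{|P\cap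 H|}{|P|}\le B_d\max\left\{\frac1t,\frac1q\right\},$$ the maximum being over affine hyperplanes $H\subseteq\mathbb F_q^d$.
   Context: Put $\langle x,y\rangle_Q=\frac{Q(x+y)-Q(x)-Q(y)}2$, $v^{\perp_Q}=\{x:\langle x,v\rangle_Q=0\}$, and $S_Q(c,r)=\{x\in\mathbb F_q^d:Q(x-c)=r\}$; spheres are parametrized by pairs $(c,r)$. $\sigma(A,\mathcal T)=|\{(p,S)\in A\times\mathcal T:p\in S\}|-|A||\mathcal T|/q$ and $d_{\mathcal S}(x)=|\{S\in\mathcal S:x\in S\}|$. For nonconcentric $S=S_Q(c,r)$, $S'=S_Q(c',r')$ the radical hyperplane is $\{x:2\langle c'-c,x\rangle_Q=(r-r')-Q(c)+Q(c')\}$. Block construction. Choose $v\ne0$ with $Q(v)=0$ (possible since $d\ge3$) and $w\in\mathbb F_q^d$ with $\langle w,v\rangle_Q=1$. Choose $R\in\mathbb F_q^\times$ represented by $Q$ on $v^{\perp_Q}$ (equivalently by the nondegenerate form induced by $Q$ on $v^{\perp_Q}/\mathbb F_qv$), and put $$X_R=\{y\in v^{\perp_Q}:Q(y)=R\},\qquad N_R=|X_R|>0.$$ Let $Z\subseteq\mathbb F_q$ be nonempty, $t=|Z|$. For $z\in Z$ put $$c_z=zw,\qquad A_z=c_z+X_R,\qquad\mathcal S_z=\{S_Q(c_z+uv,R):u\in\mathbb F_q\},$$ and $P=\bigsqcup_{z\in Z}A_z$, $\mathcal S=\bigsqcup_{z\in Z}\mathcal S_z$ (these unions are disjoint). -}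

module Defs where

open import Level using (0ℓ)
open import Algebra.Apartness.Structures using (IsHeytingField)
open import Data.Nat.Base as ℕ using (ℕ; zero; NonZero)
import Data.Nat.Properties as ℕ
open import Data.Nat.Solver renaming (module +-*-Solver to ℕ+-*-Solver)
open import Data.Nat.Primality using (Prime)
open import Data.Integer.Base as ℤ using (+_)
import Data.Integer.Properties as ℤ
open import Data.Rational.Base as ℚ using (ℚ; 0ℚ; 1ℚ; ½)
import Data.Rational.Properties as ℚ
import Data.Rational.Unnormalised.Base as ℚᵘ
import Data.Rational.Unnormalised.Properties as ℚᵘ
open import Data.Rational.Solver using (module +-*-Solver)
open import Data.Fin.Base using (Fin)
import Data.Fin.Properties as Fin
open import Data.List.Base as List using (List; []; _∷_)
open import Data.List.Membership.Propositional using () renaming (_∈_ to _∈ˡ_)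
open import Data.List.Membership.Propositional.Properties
  using (∈-map⁺; ∈-allFin; ∈-filter⁺; ∈-length; ∈-cartesianProductWith⁺)
open import Data.List.Relation.Unary.Any as Any using (Any; here)
open import Data.List.Relation.Unary.All using ([])
open import Data.List.Relation.Unary.AllPairs using ([]; _∷_)
open import Data.List.Relation.Unary.Unique.Propositional using (Unique)
import Data.List.Relation.Unary.Unique.Propositional.Properties as Unique
open import Relation.Binary.Bundles using (DecTotalOrder)
open import Data.List.Extrema (DecTotalOrder.totalOrder ℚ.≤-decTotalOrder) using (max)
open import Data.Vec.Base as Vec using (Vec; []; _∷_)
import Data.Vec.Properties as Vec
open import Data.Product.Base using (∃; ∃₂; _×_; _,_; proj₁; proj₂)
import Data.Product.Properties as Product
open import Data.Sum.Base using (inj₁; inj₂)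
open import Function.Base using (_$_)
open import Function.Bundles as Bundles using (_↔_)
import Function.Properties.Inverse as Inverse
open import Relation.Binary.Definitions using (DecidableEquality)
open import Relation.Binary.PropositionalEquality
open import Relation.Nullary.Decidable using (Dec; yes; no; map′; ¬?; _×-dec_)
open import Relation.Nullary.Negation using (contradiction)
open import Relation.Unary as U using (Pred)

-- Cauchy sequences of rationals, compared by `_≈_`; the operations act
-- pointwise.
record ℝ : Set where
  field
    seq    : ℕ → ℚ
    cauchy : ∀ ε → 0ℚ ℚ.< ε → ∃ λ N → ∀ m n → N ℕ.≤ m → N ℕ.≤ n →
             ℚ.∣ seq m ℚ.- seq n ∣ ℚ.≤ ε

open ℝ public using (seq; cauchy)

module RealLemmas where

  half⁺ : ∀ {ε} → 0ℚ ℚ.< ε → 0ℚ ℚ.< ½ ℚ.* ε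
  half⁺ {ε} ε>0 = ℚ.positive⁻¹ (½ ℚ.* ε) {{ℚ.pos*pos⇒pos ½ ε {{ℚ.positive ε>0}}}}

  *⁺ : ∀ {p q} → 0ℚ ℚ.< p → 0ℚ ℚ.< q → 0ℚ ℚ.< p ℚ.* q
  *⁺ {p} {q} p>0 q>0 =
    ℚ.positive⁻¹ (p ℚ.* q) {{ℚ.pos*pos⇒pos p {{ℚ.positive p>0}} q {{ℚ.positive q>0}}}}

  halves : ∀ ε → ½ ℚ.* ε ℚ.+ ½ ℚ.* ε ≡ ε
  halves ε = trans (sym (ℚ.*-distribʳ-+ ε ½ ½)) (ℚ.*-identityˡ ε)

  *-mono : ∀ {p q r s} → 0ℚ ℚ.≤ p → 0ℚ ℚ.≤ s → p ℚ.≤ q → r ℚ.≤ s →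
           p ℚ.* r ℚ.≤ q ℚ.* s
  *-mono {p} {q} {r} {s} 0≤p 0≤s p≤q r≤s = ℚ.≤-trans
    (ℚ.*-monoˡ-≤-nonNeg p {{ℚ.nonNegative 0≤p}} r≤s)
    (ℚ.*-monoʳ-≤-nonNeg s {{ℚ.nonNegative 0≤s}} p≤q)

  abs-≤ : ∀ {p r} → p ℚ.≤ r → ℚ.- p ℚ.≤ r → ℚ.∣ p ∣ ℚ.≤ r
  abs-≤ {p} {r} p≤r -p≤r with ℚ.∣p∣≡p∨∣p∣≡-p p
  ... | inj₁ eq = subst (ℚ._≤ r) (sym eq) p≤r
  ... | inj₂ eq = subst (ℚ._≤ r) (sym eq) -p≤r

  p≤∣p∣ : ∀ p → p ℚ.≤ ℚ.∣ p ∣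
  p≤∣p∣ p with ℚ.≤-total 0ℚ p
  ... | inj₁ 0≤p = ℚ.≤-reflexive (sym (ℚ.0≤p⇒∣p∣≡p 0≤p))
  ... | inj₂ p≤0 = ℚ.≤-trans p≤0 (ℚ.0≤∣p∣ p)

  ≤-+⇒-≤ : ∀ p q r → p ℚ.≤ q ℚ.+ r → p ℚ.- q ℚ.≤ r
  ≤-+⇒-≤ p q r h = subst (p ℚ.- q ℚ.≤_)
    (solve 2 (λ q r → (q :+ r) :- q := r) refl q r)
    (ℚ.+-monoˡ-≤ (ℚ.- q) h)
    where open +-*-Solver

  ∣-∣-sym : ∀ p q → ℚ.∣ p ℚ.- q ∣ ≡ ℚ.∣ q ℚ.- p ∣
  ∣-∣-sym p q = trans (sym (ℚ.∣-p∣≡∣p∣ (p ℚ.- q)))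
    (cong ℚ.∣_∣ (solve 2 (λ p q → :- (p :- q) := q :- p) refl p q))
    where open +-*-Solver

  ∣∣-∣∣≤ : ∀ p q → ℚ.∣ ℚ.∣ p ∣ ℚ.- ℚ.∣ q ∣ ∣ ℚ.≤ ℚ.∣ p ℚ.- q ∣
  ∣∣-∣∣≤ p q = abs-≤ (one p q)
    (subst₂ ℚ._≤_ (solve 2 (λ a b → b :- a := :- (a :- b)) refl ℚ.∣ p ∣ ℚ.∣ q ∣)
                  (∣-∣-sym q p) (one q p))
    where
    open +-*-Solver
    one : ∀ p q → ℚ.∣ p ∣ ℚ.- ℚ.∣ q ∣ ℚ.≤ ℚ.∣ p ℚ.- q ∣
    one p q = ≤-+⇒-≤ ℚ.∣ p ∣ ℚ.∣ q ∣ ℚ.∣ p ℚ.- q ∣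
      (subst (λ z → ℚ.∣ z ∣ ℚ.≤ ℚ.∣ q ∣ ℚ.+ ℚ.∣ p ℚ.- q ∣)
        (solve 2 (λ p q → q :+ (p :- q) := p) refl p q)
        (ℚ.∣p+q∣≤∣p∣+∣q∣ q (p ℚ.- q)))

  abstract
    bounded : ∀ x → ∃₂ λ B N → 0ℚ ℚ.< B × (∀ n → N ℕ.≤ n → ℚ.∣ seq x n ∣ ℚ.≤ B)
    bounded x with cauchy x 1ℚ (ℚ.positive⁻¹ 1ℚ)
    ... | N , h = ℚ.∣ seq x N ∣ ℚ.+ 1ℚ , N ,
      ℚ.<-≤-trans (ℚ.positive⁻¹ 1ℚ)
        (subst (ℚ._≤ ℚ.∣ seq x N ∣ ℚ.+ 1ℚ) (ℚ.+-identityˡ 1ℚ)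
          (ℚ.+-monoˡ-≤ 1ℚ (ℚ.0≤∣p∣ (seq x N)))) ,
      λ n N≤n → ℚ.≤-trans
        (subst (λ z → ℚ.∣ z ∣ ℚ.≤ ℚ.∣ seq x N ∣ ℚ.+ ℚ.∣ seq x n ℚ.- seq x N ∣)
          (solve 2 (λ p q → q :+ (p :- q) := p) refl (seq x n) (seq x N))
          (ℚ.∣p+q∣≤∣p∣+∣q∣ (seq x N) (seq x n ℚ.- seq x N)))
        (ℚ.+-monoʳ-≤ ℚ.∣ seq x N ∣ (h n N N≤n ℕ.≤-refl))
      where open +-*-Solver

  inv : ∀ p → 0ℚ ℚ.< p → ℚ
  inv p p>0 = (ℚ.1/ p) {{ℚ.pos⇒nonZero p {{ℚ.positive p>0}}}}

  inv⁺ : ∀ p (p>0 : 0ℚ ℚ.< p) → 0ℚ ℚ.< inv p p>0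
  inv⁺ p p>0 = ℚ.positive⁻¹ (inv p p>0) {{ℚ.1/pos⇒pos p {{ℚ.positive p>0}}}}

  *-inv : ∀ p (p>0 : 0ℚ ℚ.< p) → p ℚ.* inv p p>0 ≡ 1ℚ
  *-inv p p>0 = ℚ.*-inverseʳ p {{ℚ.pos⇒nonZero p {{ℚ.positive p>0}}}}

  abstract
    share : ∀ {ε B} → 0ℚ ℚ.< ε → 0ℚ ℚ.< B → ∃ λ η → 0ℚ ℚ.< η × B ℚ.* η ≡ ½ ℚ.* ε
    share {ε} {B} ε>0 B>0 = ½ ℚ.* ε ℚ.* inv B B>0 , *⁺ (half⁺ ε>0) (inv⁺ B B>0) ,
      (begin
        B ℚ.* (½ ℚ.* ε ℚ.* inv B B>0)   ≡⟨ solve 3 (λ b h i → b :* (h :* i) := h :* (b :* i)) refl B (½ ℚ.* ε) (inv B B>0) ⟩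
        ½ ℚ.* ε ℚ.* (B ℚ.* inv B B>0)   ≡⟨ cong (½ ℚ.* ε ℚ.*_) (*-inv B B>0) ⟩
        ½ ℚ.* ε ℚ.* 1ℚ                  ≡⟨ ℚ.*-identityʳ _ ⟩
        ½ ℚ.* ε                         ∎)
      where
      open ≡-Reasoning
      open +-*-Solver

  *-estimate : ∀ {a b c d A B η θ ε} → A ℚ.* η ≡ ½ ℚ.* ε → B ℚ.* θ ≡ ½ ℚ.* ε →
               0ℚ ℚ.≤ η → 0ℚ ℚ.≤ θ →
               ℚ.∣ a ∣ ℚ.≤ A → ℚ.∣ d ∣ ℚ.≤ B →
               ℚ.∣ c ℚ.- d ∣ ℚ.≤ η → ℚ.∣ a ℚ.- b ∣ ℚ.≤ θ →
               ℚ.∣ a ℚ.* c ℚ.- b ℚ.* d ∣ ℚ.≤ ε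
  *-estimate {a} {b} {c} {d} {A} {B} {η} {θ} {ε} Aη≡ Bθ≡ η≥0 θ≥0 a≤A d≤B h k = begin
    ℚ.∣ a ℚ.* c ℚ.- b ℚ.* d ∣
      ≡⟨ cong ℚ.∣_∣ (solve 4 (λ a b c d → a :* c :- b :* d := a :* (c :- d) :+ d :* (a :- b)) refl a b c d) ⟩
    ℚ.∣ a ℚ.* (c ℚ.- d) ℚ.+ d ℚ.* (a ℚ.- b) ∣
      ≤⟨ ℚ.∣p+q∣≤∣p∣+∣q∣ (a ℚ.* (c ℚ.- d)) (d ℚ.* (a ℚ.- b)) ⟩
    ℚ.∣ a ℚ.* (c ℚ.- d) ∣ ℚ.+ ℚ.∣ d ℚ.* (a ℚ.- b) ∣
      ≡⟨ cong₂ ℚ._+_ (ℚ.∣p*q∣≡∣p∣*∣q∣ a (c ℚ.- d)) (ℚ.∣p*q∣≡∣p∣*∣q∣ d (a ℚ.- b)) ⟩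
    ℚ.∣ a ∣ ℚ.* ℚ.∣ c ℚ.- d ∣ ℚ.+ ℚ.∣ d ∣ ℚ.* ℚ.∣ a ℚ.- b ∣
      ≤⟨ ℚ.+-mono-≤ (*-mono (ℚ.0≤∣p∣ a) η≥0 a≤A h) (*-mono (ℚ.0≤∣p∣ d) θ≥0 d≤B k) ⟩
    A ℚ.* η ℚ.+ B ℚ.* θ
      ≡⟨ cong₂ ℚ._+_ Aη≡ Bθ≡ ⟩
    ½ ℚ.* ε ℚ.+ ½ ℚ.* ε
      ≡⟨ halves ε ⟩
    ε ∎
    where
    open ℚ.≤-Reasoning
    open +-*-Solver

  +-estimate : ∀ {a b c d η θ} → ℚ.∣ a ℚ.- b ∣ ℚ.≤ η → ℚ.∣ c ℚ.- d ∣ ℚ.≤ θ →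
               ℚ.∣ (a ℚ.+ c) ℚ.- (b ℚ.+ d) ∣ ℚ.≤ η ℚ.+ θ
  +-estimate {a} {b} {c} {d} {η} {θ} h k = begin
    ℚ.∣ (a ℚ.+ c) ℚ.- (b ℚ.+ d) ∣
      ≡⟨ cong ℚ.∣_∣ (solve 4 (λ a b c d → (a :+ c) :- (b :+ d) := (a :- b) :+ (c :- d)) refl a b c d) ⟩
    ℚ.∣ (a ℚ.- b) ℚ.+ (c ℚ.- d) ∣
      ≤⟨ ℚ.∣p+q∣≤∣p∣+∣q∣ (a ℚ.- b) (c ℚ.- d) ⟩
    ℚ.∣ a ℚ.- b ∣ ℚ.+ ℚ.∣ c ℚ.- d ∣
      ≤⟨ ℚ.+-mono-≤ h k ⟩
    η ℚ.+ θ ∎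
    where
    open ℚ.≤-Reasoning
    open +-*-Solver

  inv-diff : ∀ a b (a>0 : 0ℚ ℚ.< a) (b>0 : 0ℚ ℚ.< b) →
             inv a a>0 ℚ.- inv b b>0 ≡ inv a a>0 ℚ.* inv b b>0 ℚ.* (b ℚ.- a)
  inv-diff a b a>0 b>0 = sym $ begin
    a' ℚ.* b' ℚ.* (b ℚ.- a)
      ≡⟨ solve 4 (λ a b a' b' → a' :* b' :* (b :- a) := a' :* (b :* b') :- b' :* (a :* a')) refl a b a' b' ⟩
    a' ℚ.* (b ℚ.* b') ℚ.- b' ℚ.* (a ℚ.* a')
      ≡⟨ cong₂ (λ u v → a' ℚ.* u ℚ.- b' ℚ.* v) (*-inv b b>0) (*-inv a a>0) ⟩
    a' ℚ.* 1ℚ ℚ.- b' ℚ.* 1ℚ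
      ≡⟨ cong₂ ℚ._-_ (ℚ.*-identityʳ a') (ℚ.*-identityʳ b') ⟩
    a' ℚ.- b' ∎
    where
    open ≡-Reasoning
    open +-*-Solver
    a' = inv a a>0
    b' = inv b b>0

  inv-antimono : ∀ {a b} (a>0 : 0ℚ ℚ.< a) (b>0 : 0ℚ ℚ.< b) → a ℚ.≤ b →
                 inv b b>0 ℚ.≤ inv a a>0
  inv-antimono {a} {b} a>0 b>0 a≤b = subst₂ ℚ._≤_
    (trans (cong (ℚ._* b') (trans (ℚ.*-comm a' a) (*-inv a a>0))) (ℚ.*-identityˡ b'))
    (begin
      a' ℚ.* b ℚ.* b'    ≡⟨ ℚ.*-assoc a' b b' ⟩
      a' ℚ.* (b ℚ.* b')  ≡⟨ cong (a' ℚ.*_) (*-inv b b>0) ⟩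
      a' ℚ.* 1ℚ          ≡⟨ ℚ.*-identityʳ a' ⟩
      a'                 ∎)
    (ℚ.*-monoʳ-≤-nonNeg b' {{ℚ.nonNegative (ℚ.<⇒≤ (inv⁺ b b>0))}}
      (ℚ.*-monoˡ-≤-nonNeg a' {{ℚ.nonNegative (ℚ.<⇒≤ (inv⁺ a a>0))}} a≤b))
    where
    open ≡-Reasoning
    a' = inv a a>0
    b' = inv b b>0

  inv-estimate : ∀ {a b δ ε} (a>0 : 0ℚ ℚ.< a) (b>0 : 0ℚ ℚ.< b) → 0ℚ ℚ.< δ → 0ℚ ℚ.≤ ε →
                 δ ℚ.≤ a → δ ℚ.≤ b → ℚ.∣ b ℚ.- a ∣ ℚ.≤ ε ℚ.* (δ ℚ.* δ) →
                 ℚ.∣ inv a a>0 ℚ.- inv b b>0 ∣ ℚ.≤ ε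
  inv-estimate {a} {b} {δ} {ε} a>0 b>0 δ>0 ε≥0 δ≤a δ≤b h = begin
    ℚ.∣ a' ℚ.- b' ∣
      ≡⟨ cong ℚ.∣_∣ (inv-diff a b a>0 b>0) ⟩
    ℚ.∣ a' ℚ.* b' ℚ.* (b ℚ.- a) ∣
      ≡⟨ ℚ.∣p*q∣≡∣p∣*∣q∣ (a' ℚ.* b') (b ℚ.- a) ⟩
    ℚ.∣ a' ℚ.* b' ∣ ℚ.* ℚ.∣ b ℚ.- a ∣
      ≡⟨ cong (ℚ._* ℚ.∣ b ℚ.- a ∣) (ℚ.0≤p⇒∣p∣≡p (ℚ.<⇒≤ (*⁺ (inv⁺ a a>0) (inv⁺ b b>0)))) ⟩
    a' ℚ.* b' ℚ.* ℚ.∣ b ℚ.- a ∣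
      ≤⟨ *-mono (ℚ.<⇒≤ (*⁺ (inv⁺ a a>0) (inv⁺ b b>0)))
           (ℚ.≤-trans (ℚ.0≤∣p∣ (b ℚ.- a)) h)
           (*-mono (ℚ.<⇒≤ (inv⁺ a a>0)) (ℚ.<⇒≤ (inv⁺ δ δ>0))
             (inv-antimono δ>0 a>0 δ≤a) (inv-antimono δ>0 b>0 δ≤b)) h ⟩
    δ' ℚ.* δ' ℚ.* (ε ℚ.* (δ ℚ.* δ))
      ≡⟨ solve 3 (λ i e d → i :* i :* (e :* (d :* d)) := e :* ((d :* i) :* (d :* i))) refl δ' ε δ ⟩
    ε ℚ.* ((δ ℚ.* δ') ℚ.* (δ ℚ.* δ'))
      ≡⟨ cong (λ z → ε ℚ.* (z ℚ.* z)) (*-inv δ δ>0) ⟩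
    ε ℚ.* 1ℚ
      ≡⟨ ℚ.*-identityʳ ε ⟩
    ε ∎
    where
    open ℚ.≤-Reasoning
    open +-*-Solver
    a' = inv a a>0
    b' = inv b b>0
    δ' = inv δ δ>0

open RealLemmas

infix  4 _≈_ _<ʳ_
infixl 6 _+ʳ_ _-ʳ_
infixl 7 _*ʳ_ _/ʳ_⟨_⟩
infixr 8 _^ʳ_

_≈_ : ℝ → ℝ → Set
x ≈ y = ∀ ε → 0ℚ ℚ.< ε → ∃ λ N → ∀ n → N ℕ.≤ n → ℚ.∣ seq x n ℚ.- seq y n ∣ ℚ.≤ ε

_<ʳ_ : ℝ → ℝ → Set
x <ʳ y = ∃₂ λ δ N → 0ℚ ℚ.< δ × (∀ n → N ℕ.≤ n → seq x n ℚ.+ δ ℚ.≤ seq y n)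

fromℚ : ℚ → ℝ
fromℚ p .seq _ = p
fromℚ p .cauchy ε ε>0 = 0 , λ _ _ _ _ →
  subst (ℚ._≤ ε) (cong ℚ.∣_∣ (sym (ℚ.+-inverseʳ p))) (ℚ.<⇒≤ ε>0)

0ʳ 1ʳ : ℝ
0ʳ = fromℚ 0ℚ
1ʳ = fromℚ 1ℚ

_+ʳ_ : ℝ → ℝ → ℝ
(x +ʳ y) .seq n = seq x n ℚ.+ seq y n
(x +ʳ y) .cauchy ε ε>0
  with M , f ← cauchy x (½ ℚ.* ε) (half⁺ ε>0)
     | N , g ← cauchy y (½ ℚ.* ε) (half⁺ ε>0)
  = M ℕ.⊔ N , λ m n m≥ n≥ → subst (_ ℚ.≤_) (halves ε) $
    +-estimate {seq x m} {seq x n} {seq y m} {seq y n}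
      (f m n (ℕ.m⊔n≤o⇒m≤o M N m≥) (ℕ.m⊔n≤o⇒m≤o M N n≥))
      (g m n (ℕ.m⊔n≤o⇒n≤o M N m≥) (ℕ.m⊔n≤o⇒n≤o M N n≥))

-ʳ_ : ℝ → ℝ
(-ʳ x) .seq n = ℚ.- seq x n
(-ʳ x) .cauchy ε ε>0 with N , f ← cauchy x ε ε>0 = N , λ m n m≥ n≥ →
  subst (ℚ._≤ ε)
    (trans (∣-∣-sym (seq x m) (seq x n))
      (cong ℚ.∣_∣ (solve 2 (λ a b → b :- a := :- a :- :- b) refl (seq x m) (seq x n))))
    (f m n m≥ n≥)
  where open +-*-Solver

_-ʳ_ : ℝ → ℝ → ℝ
x -ʳ y = x +ʳ (-ʳ y)

∣_∣ʳ : ℝ → ℝ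
∣ x ∣ʳ .seq n = ℚ.∣ seq x n ∣
∣ x ∣ʳ .cauchy ε ε>0 with N , f ← cauchy x ε ε>0 = N , λ m n m≥ n≥ →
  ℚ.≤-trans (∣∣-∣∣≤ (seq x m) (seq x n)) (f m n m≥ n≥)

_*ʳ_ : ℝ → ℝ → ℝ
(x *ʳ y) .seq n = seq x n ℚ.* seq y n
(x *ʳ y) .cauchy ε ε>0
  with A , M₁ , A>0 , x≤A ← bounded x
     | B , M₂ , B>0 , y≤B ← bounded y
  with η , η>0 , Aη≡ ← share ε>0 A>0
     | θ , θ>0 , Bθ≡ ← share ε>0 B>0
  with M , f ← cauchy x θ θ>0
     | N , g ← cauchy y η η>0
  = (M₁ ℕ.⊔ M₂) ℕ.⊔ (M ℕ.⊔ N) , λ m n m≥ n≥ →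
  let l = λ k (k≥ : (M₁ ℕ.⊔ M₂) ℕ.⊔ (M ℕ.⊔ N) ℕ.≤ k) → ℕ.m⊔n≤o⇒m≤o (M₁ ℕ.⊔ M₂) (M ℕ.⊔ N) k≥
      r = λ k (k≥ : (M₁ ℕ.⊔ M₂) ℕ.⊔ (M ℕ.⊔ N) ℕ.≤ k) → ℕ.m⊔n≤o⇒n≤o (M₁ ℕ.⊔ M₂) (M ℕ.⊔ N) k≥
  in *-estimate {seq x m} {seq x n} {seq y m} {seq y n} {A} {B} {η} {θ} {ε} Aη≡ Bθ≡ (ℚ.<⇒≤ η>0) (ℚ.<⇒≤ θ>0)
      (x≤A m (ℕ.m⊔n≤o⇒m≤o M₁ M₂ (l m m≥)))
      (y≤B n (ℕ.m⊔n≤o⇒n≤o M₁ M₂ (l n n≥)))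
      (g m n (ℕ.m⊔n≤o⇒n≤o M N (r m m≥)) (ℕ.m⊔n≤o⇒n≤o M N (r n n≥)))
      (f m n (ℕ.m⊔n≤o⇒m≤o M N (r m m≥)) (ℕ.m⊔n≤o⇒m≤o M N (r n n≥)))

_^ʳ_ : ℝ → ℕ → ℝ
x ^ʳ zero     = 1ʳ
x ^ʳ ℕ.suc n  = x *ʳ x ^ʳ n

-- The cut-off at δ only affects finitely many terms, and makes every term
-- of the divisor invertible.
_⁻¹⟨_⟩ : (x : ℝ) → 0ʳ <ʳ x → ℝ
(x ⁻¹⟨ δ , _ , δ>0 , _ ⟩) .seq n =
  inv (δ ℚ.⊔ seq x n) (ℚ.<-≤-trans δ>0 (ℚ.p≤p⊔q δ (seq x n)))
(x ⁻¹⟨ δ , N₀ , δ>0 , x≥δ ⟩) .cauchy ε ε>0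
  with N , f ← cauchy x (ε ℚ.* (δ ℚ.* δ)) (*⁺ ε>0 (*⁺ δ>0 δ>0))
  = N₀ ℕ.⊔ N , λ m n m≥ n≥ →
  inv-estimate (ℚ.<-≤-trans δ>0 (ℚ.p≤p⊔q δ (seq x m))) (ℚ.<-≤-trans δ>0 (ℚ.p≤p⊔q δ (seq x n)))
    δ>0 (ℚ.<⇒≤ ε>0) (ℚ.p≤p⊔q δ (seq x m)) (ℚ.p≤p⊔q δ (seq x n))
    (subst (λ z → ℚ.∣ z ∣ ℚ.≤ ε ℚ.* (δ ℚ.* δ))
      (cong₂ ℚ._-_ (cut n (ℕ.m⊔n≤o⇒m≤o N₀ N n≥)) (cut m (ℕ.m⊔n≤o⇒m≤o N₀ N m≥)))
      (f n m (ℕ.m⊔n≤o⇒n≤o N₀ N n≥) (ℕ.m⊔n≤o⇒n≤o N₀ N m≥)))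
  where
  cut : ∀ k → N₀ ℕ.≤ k → seq x k ≡ δ ℚ.⊔ seq x k
  cut k k≥ = sym (ℚ.p≤q⇒p⊔q≡q (subst (ℚ._≤ seq x k) (ℚ.+-identityˡ δ) (x≥δ k k≥)))

_/ʳ_⟨_⟩ : ℝ → (y : ℝ) → 0ʳ <ʳ y → ℝ
x /ʳ y ⟨ y>0 ⟩ = x *ʳ y ⁻¹⟨ y>0 ⟩

-- isqrt n = ⌊√n⌋
isqrt : ℕ → ℕ
isqrt zero = 0
isqrt (ℕ.suc n) with (ℕ.suc (isqrt n)) ℕ.* (ℕ.suc (isqrt n)) ℕ.≤? ℕ.suc n
... | yes _ = ℕ.suc (isqrt n)
... | no  _ = isqrt n

module SqrtLemmas where

  isqrt-lower : ∀ n → isqrt n ℕ.* isqrt n ℕ.≤ n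
  isqrt-lower zero = ℕ.z≤n
  isqrt-lower (ℕ.suc n) with (ℕ.suc (isqrt n)) ℕ.* (ℕ.suc (isqrt n)) ℕ.≤? ℕ.suc n
  ... | yes h = h
  ... | no  _ = ℕ.m≤n⇒m≤1+n (isqrt-lower n)

  isqrt-upper : ∀ n → n ℕ.< ℕ.suc (isqrt n) ℕ.* ℕ.suc (isqrt n)
  isqrt-upper zero = ℕ.s≤s ℕ.z≤n
  isqrt-upper (ℕ.suc n) with (ℕ.suc (isqrt n)) ℕ.* (ℕ.suc (isqrt n)) ℕ.≤? ℕ.suc n
  ... | yes _ = ℕ.≤-<-trans (isqrt-upper n)
    (ℕ.*-mono-< (ℕ.n<1+n (ℕ.suc (isqrt n))) (ℕ.n<1+n (ℕ.suc (isqrt n))))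
  ... | no h = ℕ.≰⇒> h

  isqrt-greatest : ∀ k n → k ℕ.* k ℕ.≤ n → k ℕ.≤ isqrt n
  isqrt-greatest k n h with k ℕ.≤? isqrt n
  ... | yes k≤ = k≤
  ... | no  k≰ = contradiction (ℕ.≤-<-trans h (isqrt-upper n))
    (ℕ.≤⇒≯ (ℕ.*-mono-≤ (ℕ.≰⇒> k≰) (ℕ.≰⇒> k≰)))

  ≤-of-squares : ∀ a b → a ℕ.* a ℕ.≤ b ℕ.* b → a ℕ.≤ b
  ≤-of-squares a b h with a ℕ.≤? b
  ... | yes a≤b = a≤b
  ... | no  a≰b = contradiction (ℕ.*-mono-< (ℕ.≰⇒> a≰b) (ℕ.≰⇒> a≰b)) (ℕ.≤⇒≯ h)

  square-swap : ∀ x y → (x ℕ.* y) ℕ.* (x ℕ.* y) ≡ (x ℕ.* x) ℕ.* (y ℕ.* y)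
  square-swap x y = solve 2 (λ x y → (x :* y) :* (x :* y) := (x :* x) :* (y :* y)) refl x y
    where open ℕ+-*-Solver

  -- ⌊√(nK²)⌋ M ≤ (⌊√(nM²)⌋ + 1) K
  isqrt-compare : ∀ n K M →
    isqrt (n ℕ.* (K ℕ.* K)) ℕ.* M ℕ.≤ ℕ.suc (isqrt (n ℕ.* (M ℕ.* M))) ℕ.* K
  isqrt-compare n K M = ≤-of-squares (a ℕ.* M) (b ℕ.* K) $ begin
    (a ℕ.* M) ℕ.* (a ℕ.* M)             ≡⟨ square-swap a M ⟩
    (a ℕ.* a) ℕ.* (M ℕ.* M)             ≤⟨ ℕ.*-monoˡ-≤ (M ℕ.* M) (isqrt-lower (n ℕ.* (K ℕ.* K))) ⟩
    n ℕ.* (K ℕ.* K) ℕ.* (M ℕ.* M)       ≡⟨ solve 3 (λ n k m → n :* k :* m := n :* m :* k) refl n (K ℕ.* K) (M ℕ.* M) ⟩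
    n ℕ.* (M ℕ.* M) ℕ.* (K ℕ.* K)       ≤⟨ ℕ.*-monoˡ-≤ (K ℕ.* K) (ℕ.<⇒≤ (isqrt-upper (n ℕ.* (M ℕ.* M)))) ⟩
    (b ℕ.* b) ℕ.* (K ℕ.* K)             ≡⟨ sym (square-swap b K) ⟩
    (b ℕ.* K) ℕ.* (b ℕ.* K)             ∎
    where
    open ℕ.≤-Reasoning
    open ℕ+-*-Solver
    a = isqrt (n ℕ.* (K ℕ.* K))
    b = ℕ.suc (isqrt (n ℕ.* (M ℕ.* M)))

  frac-≤ : ∀ a b k m → a ℕ.* ℕ.suc m ℕ.≤ ℕ.suc b ℕ.* ℕ.suc k →
           + a ℚ./ ℕ.suc k ℚ.- + b ℚ./ ℕ.suc m ℚ.≤ + 1 ℚ./ ℕ.suc m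
  frac-≤ a b k m h = ≤-+⇒-≤ (+ a ℚ./ ℕ.suc k) (+ b ℚ./ ℕ.suc m) (+ 1 ℚ./ ℕ.suc m)
    (ℚ.toℚᵘ-cancel-≤
      (ℚᵘ.≤-respˡ-≃ (ℚᵘ.≃-sym (ℚ.toℚᵘ-fromℚᵘ (ℚᵘ.mkℚᵘ (+ a) k)))
        (ℚᵘ.≤-respʳ-≃ {x = ℚᵘ.mkℚᵘ (+ a) k}
          (ℚᵘ.≃-sym (ℚᵘ.≃-trans (ℚ.toℚᵘ-homo-+ (+ b ℚ./ ℕ.suc m) (+ 1 ℚ./ ℕ.suc m))
            (ℚᵘ.+-cong (ℚ.toℚᵘ-fromℚᵘ (ℚᵘ.mkℚᵘ (+ b) m)) (ℚ.toℚᵘ-fromℚᵘ (ℚᵘ.mkℚᵘ (+ 1) m)))))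
          (ℚᵘ.*≤* (subst₂ ℤ._≤_ eq₁ eq₂ (ℤ.+≤+ (ℕ.*-monoˡ-≤ (ℕ.suc m) h)))))))
    where
    open ℕ+-*-Solver
    eq₁ : + (a ℕ.* ℕ.suc m ℕ.* ℕ.suc m) ≡ + a ℤ.* (+ ℕ.suc m ℤ.* + ℕ.suc m)
    eq₁ = trans (cong +_ (ℕ.*-assoc a (ℕ.suc m) (ℕ.suc m)))
                (ℤ.pos-* a (ℕ.suc m ℕ.* ℕ.suc m))
    eq₂ : + (ℕ.suc b ℕ.* ℕ.suc k ℕ.* ℕ.suc m)
        ≡ (+ b ℤ.* + ℕ.suc m ℤ.+ + 1 ℤ.* + ℕ.suc m) ℤ.* + ℕ.suc k
    eq₂ = trans
      (cong +_ (solve 3 (λ b k m → (con 1 :+ b) :* k :* m := (b :* m :+ con 1 :* m) :* k)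
                        refl b (ℕ.suc k) (ℕ.suc m)))
      (trans (ℤ.pos-* (b ℕ.* ℕ.suc m ℕ.+ 1 ℕ.* ℕ.suc m) (ℕ.suc k))
        (cong (ℤ._* + ℕ.suc k)
          (cong₂ ℤ._+_ (ℤ.pos-* b (ℕ.suc m)) (ℤ.pos-* 1 (ℕ.suc m)))))

  1/suc-≤ : ∀ ε → 0ℚ ℚ.< ε → ∀ n → ℚ.↧ₙ ε ℕ.≤ n → + 1 ℚ./ ℕ.suc n ℚ.≤ ε
  1/suc-≤ ε@(ℚ.mkℚ ℤ.+[1+ i ] d _) _ n d<n = ℚ.toℚᵘ-cancel-≤
    (ℚᵘ.≤-respˡ-≃ {ℚ.toℚᵘ ε} (ℚᵘ.≃-sym (ℚ.toℚᵘ-fromℚᵘ (ℚᵘ.mkℚᵘ (+ 1) n)))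
      (ℚᵘ.*≤* (subst₂ ℤ._≤_ (ℤ.pos-* 1 (ℕ.suc d)) (ℤ.pos-* (ℕ.suc i) (ℕ.suc n))
        (ℤ.+≤+ (ℕ.*-mono-≤ (ℕ.s≤s (ℕ.z≤n {i})) (ℕ.m≤n⇒m≤1+n d<n))))))
  1/suc-≤ (ℚ.mkℚ (+ zero) _ _)   ε>0 = contradiction (ℚ.positive ε>0) λ ()
  1/suc-≤ (ℚ.mkℚ ℤ.-[1+ _ ] _ _) ε>0 = contradiction (ℚ.positive ε>0) λ ()

open SqrtLemmas

infix 9 √_

-- The k-th term is ⌊√n · (k + 1)⌋ / (k + 1).
√_ : ℕ → ℝ
(√ n) .seq k = + isqrt (n ℕ.* (ℕ.suc k ℕ.* ℕ.suc k)) ℚ./ ℕ.suc k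
(√ n) .cauchy ε ε>0 = ℚ.↧ₙ ε , λ k m k≥ m≥ →
  abs-≤ (ℚ.≤-trans (one k m) (1/suc-≤ ε ε>0 m m≥))
        (subst (ℚ._≤ ε) (flip- (seq (√ n) k) (seq (√ n) m))
          (ℚ.≤-trans (one m k) (1/suc-≤ ε ε>0 k k≥)))
  where
  one : ∀ k m → seq (√ n) k ℚ.- seq (√ n) m ℚ.≤ + 1 ℚ./ ℕ.suc m
  one k m = frac-≤ (isqrt (n ℕ.* (ℕ.suc k ℕ.* ℕ.suc k))) (isqrt (n ℕ.* (ℕ.suc m ℕ.* ℕ.suc m))) k m
    (isqrt-compare n (ℕ.suc k) (ℕ.suc m))
  flip- : ∀ p q → q ℚ.- p ≡ ℚ.- (p ℚ.- q)
  flip- p q = solve 2 (λ p q → q :- p := :- (p :- q)) refl p q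
    where open +-*-Solver

module PositivityLemmas where

  √⁺ : ∀ n .{{_ : NonZero n}} → 0ʳ <ʳ √ n
  √⁺ (ℕ.suc n) = 1ℚ , 0 , ℚ.positive⁻¹ 1ℚ , λ k _ → subst (ℚ._≤ seq (√ ℕ.suc n) k)
    (sym (ℚ.+-identityˡ 1ℚ))
    (ℚ.toℚᵘ-cancel-≤ (ℚᵘ.≤-respʳ-≃ {x = ℚᵘ.1ℚᵘ}
      (ℚᵘ.≃-sym (ℚ.toℚᵘ-fromℚᵘ (ℚᵘ.mkℚᵘ (+ isqrt (ℕ.suc n ℕ.* (ℕ.suc k ℕ.* ℕ.suc k))) k)))
      (ℚᵘ.*≤* (subst₂ ℤ._≤_ (ℤ.pos-* 1 (ℕ.suc k))
        (ℤ.pos-* (isqrt (ℕ.suc n ℕ.* (ℕ.suc k ℕ.* ℕ.suc k))) 1) (ℤ.+≤+ (lower k))))))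
    where
    lower : ∀ k → 1 ℕ.* ℕ.suc k ℕ.≤ isqrt (ℕ.suc n ℕ.* (ℕ.suc k ℕ.* ℕ.suc k)) ℕ.* 1
    lower k = subst₂ ℕ._≤_ (sym (ℕ.*-identityˡ (ℕ.suc k)))
      (sym (ℕ.*-identityʳ (isqrt (ℕ.suc n ℕ.* (ℕ.suc k ℕ.* ℕ.suc k)))))
      (isqrt-greatest (ℕ.suc k) (ℕ.suc n ℕ.* (ℕ.suc k ℕ.* ℕ.suc k)) (ℕ.m≤n*m (ℕ.suc k ℕ.* ℕ.suc k) (ℕ.suc n)))

  *ʳ⁺ : ∀ {x y} → 0ʳ <ʳ x → 0ʳ <ʳ y → 0ʳ <ʳ x *ʳ y
  *ʳ⁺ {x} {y} (δ , M , δ>0 , f) (η , N , η>0 , g) =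
    δ ℚ.* η , M ℕ.⊔ N , *⁺ δ>0 η>0 , λ n n≥ →
    subst (ℚ._≤ seq x n ℚ.* seq y n) (sym (ℚ.+-identityˡ (δ ℚ.* η)))
      (*-mono (ℚ.<⇒≤ δ>0)
        (ℚ.≤-trans (ℚ.<⇒≤ η>0) (drop (g n (ℕ.m⊔n≤o⇒n≤o M N n≥))))
        (drop (f n (ℕ.m⊔n≤o⇒m≤o M N n≥)))
        (drop (g n (ℕ.m⊔n≤o⇒n≤o M N n≥))))
    where
    drop : ∀ {p q} → 0ℚ ℚ.+ p ℚ.≤ q → p ℚ.≤ q
    drop {p} {q} = subst (ℚ._≤ q) (ℚ.+-identityˡ p)

  ^ʳ⁺ : ∀ {x} → 0ʳ <ʳ x → ∀ n → 0ʳ <ʳ x ^ʳ n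
  ^ʳ⁺ x>0 zero = 1ℚ , 0 , ℚ.positive⁻¹ 1ℚ , λ _ _ → ℚ.≤-reflexive (ℚ.+-identityˡ 1ℚ)
  ^ʳ⁺ {x} x>0 (ℕ.suc n) = *ʳ⁺ {x} {x ^ʳ n} x>0 (^ʳ⁺ {x} x>0 n)

  √^⁺ : ∀ n .{{_ : NonZero n}} k → 0ʳ <ʳ (√ n) ^ʳ k
  √^⁺ n k = ^ʳ⁺ {√ n} (√⁺ n) k

open PositivityLemmas public

record Finite (X : Set) : Set where
  infix 4 _≟_
  field
    _≟_      : DecidableEquality X
    elements : List X
    complete : ∀ x → x ∈ˡ elements
    unique   : Unique elements

open Finite {{...}} public

∃? : {X : Set} {{_ : Finite X}} {P : X → Set} → (∀ x → Dec (P x)) → Dec (∃ P)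
∃? P? = map′ Any.satisfied (λ (x , px) → Any.map (λ { refl → px }) (complete x))
             (Any.any? P? elements)

Finite-× : {X Y : Set} {{_ : Finite X}} {{_ : Finite Y}} → Finite (X × Y)
Finite-× = record
  { _≟_      = Product.≡-dec _≟_ _≟_
  ; elements = List.cartesianProduct elements elements
  ; complete = λ (x , y) → ∈-cartesianProductWith⁺ _,_ (complete x) (complete y)
  ; unique   = Unique.cartesianProduct⁺ unique unique
  }

Finite-Vec : {X : Set} {{_ : Finite X}} {n : ℕ} → Finite (Vec X n)
Finite-Vec {X} = record
  { _≟_      = Vec.≡-dec _≟_
  ; elements = vectors _
  ; complete = vectors-complete
  ; unique   = vectors-unique _
  }
  where
  vectors : ∀ n → List (Vec X n)
  vectors zero      = [] ∷ []
  vectors (ℕ.suc n) = List.cartesianProductWith _∷_ elements (vectors n)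

  vectors-complete : ∀ {n} (xs : Vec X n) → xs ∈ˡ vectors n
  vectors-complete []       = here refl
  vectors-complete (x ∷ xs) = ∈-cartesianProductWith⁺ _∷_ (complete x) (vectors-complete xs)

  vectors-unique : ∀ n → Unique (vectors n)
  vectors-unique zero      = [] ∷ []
  vectors-unique (ℕ.suc n) =
    Unique.cartesianProductWith⁺ _∷_ Vec.∷-injective unique (vectors-unique n)

record Subset (X : Set) : Set₁ where
  field
    Mem  : Pred X 0ℓ
    mem? : U.Decidable Mem

open Subset public

infix 4 _∈_ _≐_
infixr 7 _∩_

_∈_ : {X : Set} → X → Subset X → Set
x ∈ A = Mem A x

_≐_ : {X : Set} → Subset X → Subset X → Set
A ≐ B = Mem A U.≐ Mem B

_∩_ : {X : Set} → Subset X → Subset X → Subset X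
(A ∩ B) .Mem  = Mem A U.∩ Mem B
(A ∩ B) .mem? x = mem? A x ×-dec mem? B x

Nonempty : {X : Set} → Subset X → Set
Nonempty A = ∃ λ x → x ∈ A

module _ {X : Set} {{_ : Finite X}} where

  members : Subset X → List X
  members A = List.filter (mem? A) elements

  ∣_∣ : Subset X → ℕ
  ∣ A ∣ = List.length (members A)

  ∣∣-nonZero : (A : Subset X) → Nonempty A → NonZero ∣ A ∣
  ∣∣-nonZero A (x , x∈A) =
    ℕ.>-nonZero (∈-length (∈-filter⁺ (mem? A) (complete x) x∈A))

  ∑ : Subset X → (X → ℚ) → ℚ
  ∑ A f = List.foldr ℚ._+_ 0ℚ (List.map f (members A))

fromℕ : ℕ → ℚ
fromℕ n = + n ℚ./ 1

OddPrimePower : ℕ → Set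
OddPrimePower q = ∃₂ λ p k → Prime p × p ≢ 2 × 1 ℕ.≤ k × q ≡ p ℕ.^ k

-- A field with exactly q elements; with propositional equality decidable,
-- inequality is the apartness relation of the field.
record FiniteField (q : ℕ) : Set₁ where
  infix  8 -_
  infixl 7 _*_
  infixl 6 _+_
  field
    Carrier        : Set
    _+_ _*_        : Carrier → Carrier → Carrier
    -_             : Carrier → Carrier
    0# 1#          : Carrier
    isHeytingField : IsHeytingField _≡_ _≢_ _+_ _*_ -_ 0# 1#
    enumeration    : Carrier ↔ Fin q

  open IsHeytingField isHeytingField public
    using (_-_; isCommutativeRing; #⇒invertible; invertible⇒#)

  instance
    finite : Finite Carrier
    finite = record
      { _≟_      = Fin.inj⇒≟ (Inverse.↔⇒↣ enumeration)
      ; elements = List.map from (List.allFin q)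
      ; complete = λ x → subst (_∈ˡ List.map from (List.allFin q)) (strictlyInverseʳ x)
                           (∈-map⁺ from (∈-allFin (to x)))
      ; unique   = Unique.map⁺ from-injective (Unique.allFin⁺ q)
      }
      where
      open Bundles.Inverse enumeration
      from-injective : ∀ {i j} → from i ≡ from j → i ≡ j
      from-injective {i} {j} eq =
        trans (sym (strictlyInverseˡ i)) (trans (cong to eq) (strictlyInverseˡ j))

    q-nonZero : NonZero q
    q-nonZero = Fin.nonZeroIndex (Bundles.Inverse.to enumeration 0#)

  infix 9 _⁻¹

  -- 0⁻¹ = 0 by convention
  _⁻¹ : Carrier → Carrier
  x ⁻¹ with x ≟ 0#
  ... | yes _   = 0#
  ... | no  x≢0 = proj₁ (#⇒invertible x≢0)

module Geometry {q : ℕ} (F : FiniteField q) where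

  open FiniteField F

  2# : Carrier
  2# = 1# + 1#

  infixl 6 _⊕_ _⊖_
  infixr 7 _·_

  Point : ℕ → Set
  Point d = Vec Carrier d

  -- A sphere is identified with its parameters (centre , radius).
  Sphere : ℕ → Set
  Sphere d = Point d × Carrier

  instance
    finitePoint : ∀ {d} → Finite (Point d)
    finitePoint = Finite-Vec

    finiteSphere : ∀ {d} → Finite (Sphere d)
    finiteSphere = Finite-×

    finiteIncidence : ∀ {d} → Finite (Point d × Sphere d)
    finiteIncidence = Finite-×

  centreOf : ∀ {d} → Sphere d → Point d
  centreOf = proj₁

  𝟎 : ∀ {d} → Point d
  𝟎 = Vec.replicate _ 0#

  _⊕_ _⊖_ : ∀ {d} → Point d → Point d → Point d
  _⊕_ = Vec.zipWith _+_
  _⊖_ = Vec.zipWith _-_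

  _·_ : ∀ {d} → Carrier → Point d → Point d
  a · x = Vec.map (a *_) x

  dot : ∀ {d} → Point d → Point d → Carrier
  dot x y = Vec.foldr′ _+_ 0# (Vec.zipWith _*_ x y)

  -- {x : a₁x₁ + … + a_dx_d = b}; an affine hyperplane when a ≢ 𝟎
  hyperplane : ∀ {d} → Point d → Carrier → Subset (Point d)
  hyperplane a b .Mem  x = dot a x ≡ b
  hyperplane a b .mem? x = dot a x ≟ b

  hyperplaneParameters : ∀ d → Subset (Point d × Carrier)
  hyperplaneParameters d .Mem  (a , _) = a ≢ 𝟎
  hyperplaneParameters d .mem? (a , _) = ¬? (a ≟ 𝟎)

  module Form {d : ℕ} (Q : Point d → Carrier) where

    polar : Point d → Point d → Carrier
    polar x y = Q (x ⊕ y) - Q x - Q y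

    ⟨_,_⟩ : Point d → Point d → Carrier
    ⟨ x , y ⟩ = polar x y * 2# ⁻¹

    record IsQuadraticForm : Set where
      field
        homogeneous : ∀ a x → Q (a · x) ≡ a * a * Q x
        polar-⊕ˡ    : ∀ x y z → polar (x ⊕ y) z ≡ polar x z + polar y z
        polar-·ˡ    : ∀ a x y → polar (a · x) y ≡ a * polar x y

    Nondegenerate : Set
    Nondegenerate = ∀ x → (∀ y → ⟨ x , y ⟩ ≡ 0#) → x ≡ 𝟎

    _^⊥ : Point d → Subset (Point d)
    (v ^⊥) .Mem  x = ⟨ x , v ⟩ ≡ 0#
    (v ^⊥) .mem? x = ⟨ x , v ⟩ ≟ 0#

    -- S_Q(c , r)
    points : Sphere d → Subset (Point d)
    points (c , r) .Mem  x = Q (x ⊖ c) ≡ r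
    points (c , r) .mem? x = Q (x ⊖ c) ≟ r

    incidences : Subset (Point d) → Subset (Sphere d) → Subset (Point d × Sphere d)
    incidences A 𝒯 .Mem  (p , S) = p ∈ A × S ∈ 𝒯 × p ∈ points S
    incidences A 𝒯 .mem? (p , S) = mem? A p ×-dec mem? 𝒯 S ×-dec mem? (points S) p

    σ : Subset (Point d) → Subset (Sphere d) → ℚ
    σ A 𝒯 = fromℕ ∣ incidences A 𝒯 ∣ ℚ.- + (∣ A ∣ ℕ.* ∣ 𝒯 ∣) ℚ./ q

    spheresThrough : Subset (Sphere d) → Point d → Subset (Sphere d)
    spheresThrough 𝒮 x .Mem  S = S ∈ 𝒮 × x ∈ points S
    spheresThrough 𝒮 x .mem? S = mem? 𝒮 S ×-dec mem? (points S) x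

    degree : Subset (Sphere d) → Point d → ℕ
    degree 𝒮 x = ∣ spheresThrough 𝒮 x ∣

    -- Only meaningful for nonconcentric spheres, i.e. c ≢ c′.
    radicalHyperplane : Sphere d → Sphere d → Subset (Point d)
    radicalHyperplane (c , r) (c′ , r′) .Mem  x =
      2# * ⟨ c′ ⊖ c , x ⟩ ≡ (r - r′) - Q c + Q c′
    radicalHyperplane (c , r) (c′ , r′) .mem? x =
      2# * ⟨ c′ ⊖ c , x ⟩ ≟ (r - r′) - Q c + Q c′

    -- K satisfies σ(A, 𝒯) = K q^((d-1)/2) √(|A||𝒯|), with q^((d-1)/2) = (√q)^(d-1).
    IsExactParameter : Subset (Point d) → Subset (Sphere d) → ℝ → Set
    IsExactParameter A 𝒯 K =
      fromℚ (σ A 𝒯) ≈ K *ʳ (√ q) ^ʳ (d ℕ.∸ 1) *ʳ √ (∣ A ∣ ℕ.* ∣ 𝒯 ∣)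

    -- The default value 0 only matters for an empty list of hyperplanes, as the
    -- densities are nonnegative.
    maxHyperplaneDensity : (A : Subset (Point d)) → .{{NonZero ∣ A ∣}} → ℚ
    maxHyperplaneDensity A = max 0ℚ (List.map
      (λ (a , b) → + ∣ A ∩ hyperplane a b ∣ ℚ./ ∣ A ∣)
      (members (hyperplaneParameters d)))

record IsotropicPair {q} (F : FiniteField q) (d : ℕ) : Set where
  open FiniteField F
  open Geometry F
  field
    Q               : Point d → Carrier
    isQuadraticForm : Form.IsQuadraticForm Q
    nondegenerate   : Form.Nondegenerate Q

  open Form Q public

  field
    v w     : Point d
    v≢𝟎     : v ≢ 𝟎
    Qv≡0    : Q v ≡ 0#
    ⟨w,v⟩≡1 : ⟨ w , v ⟩ ≡ 1#

  Admissible : Carrier → Set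
  Admissible R = R ≢ 0# × ∃ λ y → y ∈ v ^⊥ × Q y ≡ R

record BlockConstruction {q} (F : FiniteField q) (d : ℕ) : Set₁ where
  constructor block
  open FiniteField F
  open Geometry F
  field
    isotropicPair : IsotropicPair F d

  open IsotropicPair isotropicPair public

  field
    R            : Carrier
    R-admissible : Admissible R
    Z            : Subset Carrier
    Z-nonempty   : Nonempty Z

  X : Subset (Point d)
  X .Mem  y = y ∈ v ^⊥ × Q y ≡ R
  X .mem? y = mem? (v ^⊥) y ×-dec Q y ≟ R

  N t : ℕ
  N = ∣ X ∣
  t = ∣ Z ∣

  centre : Carrier → Point d
  centre z = z · w

  A : Carrier → Subset (Point d)
  A z .Mem  x = ∃ λ y → y ∈ X × x ≡ centre z ⊕ y
  A z .mem? x = ∃? λ y → mem? X y ×-dec x ≟ (centre z ⊕ y)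

  sphere : Carrier → Carrier → Sphere d
  sphere z u = centre z ⊕ u · v , R

  𝒮ᶻ : Carrier → Subset (Sphere d)
  𝒮ᶻ z .Mem  S = ∃ λ u → S ≡ sphere z u
  𝒮ᶻ z .mem? S = ∃? λ u → S ≟ sphere z u

  P : Subset (Point d)
  P .Mem  x = ∃ λ z → z ∈ Z × x ∈ A z
  P .mem? x = ∃? λ z → mem? Z z ×-dec mem? (A z) x

  𝒮 : Subset (Sphere d)
  𝒮 .Mem  S = ∃ λ z → z ∈ Z × S ∈ 𝒮ᶻ z
  𝒮 .mem? S = ∃? λ z → mem? Z z ×-dec mem? (𝒮ᶻ z) S

  H : Carrier → Subset (Point d)
  H z .Mem  x = ⟨ x , v ⟩ ≡ z
  H z .mem? x = ⟨ x , v ⟩ ≟ z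

  instance
    t-nonZero : NonZero t
    t-nonZero = ∣∣-nonZero Z Z-nonempty

    P-nonZero : NonZero ∣ P ∣
    P-nonZero = ∣∣-nonZero P
      ( _ , proj₁ Z-nonempty , proj₂ Z-nonempty
      , proj₁ (proj₂ R-admissible) , proj₂ (proj₂ R-admissible) , refl )

{-# OPTIONS --safe #-}

-- The identity Q(x − zw − uv) = Q(x − zw) − 2u(⟨x,v⟩ − z), together with ⟨x,v⟩ = b on A_b,
-- shows that a point of A_b lies on every sphere of 𝒮_b and on exactly one sphere of 𝒮_z
-- for z ≠ b; all incidence counts, intersections and radical hyperplanes follow.
--
-- Character sums are avoided in estimating N = |X_R|.  Let M = q^(d−2), and let f(r) be the
-- number of y in v^⊥ with Q(y) = r.  Fixing s = y′ − y makes Q(y) = Q(y′) linear in y, which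
-- bounds the second moment of f and gives ∑ (f(r) − M)² ≤ q²M.  Since f(a²R) = f(R), the term
-- of R occurs (q − 1)/2 times in this sum, so (N − M)² ≤ 4qM.  When d = 3, v^⊥ is spanned by
-- v and any y in v^⊥ with Q(y) ≠ 0, and R = Q(y) gives N = 2q.
--
-- A hyperplane not parallel to v^⊥ cuts X_R in the zeros of Q − R on an affine subspace W of
-- codimension 1 in v^⊥.  If a line direction e of W has Q(e) ≠ 0, or if Q vanishes on all
-- directions of W but ⟨y₀,e⟩ ≠ 0 for a point y₀ of W, then each line of W in direction e
-- contains at most two zeros, hence there are at most 2|W|/q.  Otherwise Q is constant on W, and
-- if this constant is R, then the directions of W are multiples of v, impossible for d ≥ 4.

module Submission where

open import Defs
open import Algebra.Bundles using (CommutativeRing)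
import Algebra.Solver.Ring
import Algebra.Solver.Ring.AlmostCommutativeRing as ACR
open import Data.Fin.Base as Fin using (Fin)
import Data.Fin.Properties as Fin
open import Data.Integer.Base as ℤ using (ℤ; +_; -[1+_])
import Data.Integer.Properties as ℤ
open import Data.List.Base as List using (List; []; _∷_)
import Data.List.Properties as List
open import Data.List.Membership.Propositional using () renaming (_∈_ to _∈ˡ_)
open import Data.List.Membership.Propositional.Properties using (∈-allFin)
open import Data.List.Relation.Unary.All as All using (All)
import Data.List.Relation.Unary.All.Properties as All
open import Data.List.Relation.Unary.AllPairs using (_∷_)
open import Data.List.Relation.Unary.Any using (here; there)
open import Data.List.Relation.Unary.Unique.Propositional using (Unique)
import Data.List.Relation.Unary.Unique.Propositional.Properties as Unique
open import Data.Maybe.Base as Maybe using (Maybe)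
open import Data.Nat.Base as ℕ using (ℕ; zero; suc; NonZero) renaming (∣_-_∣ to dist)
open import Data.Nat.Divisibility using (_∣_; divides; ∣1⇒≡1)
open import Data.Nat.Primality using (euclidsLemma; prime[2]; prime⇒irreducible)
import Data.Nat.Properties as ℕ
import Data.Nat.Solver as ℕ
open import Data.Product.Base using (Σ; ∃; _×_; _,_; proj₁; proj₂)
open import Data.Rational.Base as ℚ using (ℚ; 0ℚ; 1ℚ; ½)
import Data.Rational.Properties as ℚ
open import Data.Rational.Solver using (module +-*-Solver)
import Data.Rational.Unnormalised.Base as ℚᵘ
import Data.Rational.Unnormalised.Properties as ℚᵘ
open import Data.Sign.Base as Sign using (Sign)
open import Data.Sum.Base using (_⊎_; inj₁; inj₂)
open import Data.Unit.Base using (⊤; tt)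
open import Data.Vec.Base as Vec using (Vec; []; _∷_)
import Data.Vec.Properties as Vec
open import Function.Base using (_∘_; id)
open import Function.Bundles using (_⇔_; mk⇔; module Equivalence; module Inverse)
open import Relation.Binary.Bundles using (Setoid; DecTotalOrder)
open import Relation.Binary.PropositionalEquality hiding (setoid)
open import Relation.Nullary.Decidable using (Dec; yes; no; ¬?; _×-dec_; _⊎-dec_; dec⇒maybe; decidable-stable)
open import Relation.Nullary.Negation using (¬_; contradiction)
open import Relation.Unary using (Decidable)
open import Data.List.Extrema (DecTotalOrder.totalOrder ℚ.≤-decTotalOrder) using (max≤v⁺)

-- Everything about incidences reduces to degrees: if each point of A lies on k spheres of 𝒯 and |𝒯|
-- = sq, the discrepancy is |A|(k - s). The delicate input is the size of N. In the second moment,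
-- pairs differing by s contribute at most M unless s is a multiple of v, the radical of Q on v^⊥;
-- these q values of s account for the error term q²M. The resulting (N - M)² ≤ 4qM means a relative
-- error of at most 2q^((3-d)/2), which tends to 0 precisely when d ≥ 4; for d = 3 it gives no
-- asymptotics, so there a suitable R is chosen and its level set is counted exactly. Closeness of K
-- to 1 is obtained in ℚ from K² = (1 - 1/q)²N/M, through |K - 1| ≤ |K² - 1|. Subspaces are handled
-- without bases or dimensions: a linear functional that is nonzero on e cuts a set invariant under
-- translation by multiples of e into q slices of equal size, and comparing cardinalities replaces
-- dimension arguments.

-- Counting in finite types by sums of indicators.

module Counting where

  open import Data.Nat.Base using (_+_; _*_; _≤_; _<_; z≤n; s≤s)

  -- Indicators, sums and cardinalities are abstract so that unification treats them as rigid.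
  abstract

    ⟦_⟧ : {P : Set} → Dec P → ℕ
    ⟦ yes _ ⟧ = 1
    ⟦ no  _ ⟧ = 0

    ⟦⟧-yes : {P : Set} {p? : Dec P} → P → ⟦ p? ⟧ ≡ 1
    ⟦⟧-yes {p? = yes _} _ = refl
    ⟦⟧-yes {p? = no ¬p} p = contradiction p ¬p

    ⟦⟧-no : {P : Set} {p? : Dec P} → ¬ P → ⟦ p? ⟧ ≡ 0
    ⟦⟧-no {p? = yes p} ¬p = contradiction p ¬p
    ⟦⟧-no {p? = no _}  _  = refl

  ⟦⟧-cong : {P Q : Set} {p? : Dec P} {q? : Dec Q} → (P → Q) → (Q → P) → ⟦ p? ⟧ ≡ ⟦ q? ⟧
  ⟦⟧-cong {p? = yes p} f g = trans (⟦⟧-yes p) (sym (⟦⟧-yes (f p)))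
  ⟦⟧-cong {p? = no ¬p} f g = trans (⟦⟧-no ¬p) (sym (⟦⟧-no (¬p ∘ g)))

  ⟦⟧-× : {P Q : Set} (p? : Dec P) (q? : Dec Q) → ⟦ p? ×-dec q? ⟧ ≡ ⟦ p? ⟧ * ⟦ q? ⟧
  ⟦⟧-× (yes p) (yes q) = trans (⟦⟧-yes (p , q)) (sym (cong₂ _*_ (⟦⟧-yes p) (⟦⟧-yes q)))
  ⟦⟧-× (yes p) (no ¬q) = trans (⟦⟧-no (¬q ∘ proj₂)) (sym (trans (cong (⟦ yes p ⟧ *_) (⟦⟧-no ¬q)) (ℕ.*-zeroʳ ⟦ yes p ⟧)))
  ⟦⟧-× (no ¬p) q?      = trans (⟦⟧-no (¬p ∘ proj₁)) (sym (cong (_* ⟦ q? ⟧) (⟦⟧-no ¬p)))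

  ≤⟦⟧* : {P : Set} {p? : Dec P} → P → ∀ k → k ≤ ⟦ p? ⟧ * k
  ≤⟦⟧* p k = ℕ.≤-reflexive (sym (trans (cong (_* k) (⟦⟧-yes p)) (ℕ.*-identityˡ k)))

  module _ {X : Set} where

    sumˡ : List X → (X → ℕ) → ℕ
    sumˡ []       f = 0
    sumˡ (x ∷ xs) f = f x + sumˡ xs f

    sumˡ-cong : ∀ xs {f g : X → ℕ} → (∀ x → f x ≡ g x) → sumˡ xs f ≡ sumˡ xs g
    sumˡ-cong []       f≗g = refl
    sumˡ-cong (x ∷ xs) f≗g = cong₂ _+_ (f≗g x) (sumˡ-cong xs f≗g)

    sumˡ-mono : ∀ xs {f g : X → ℕ} → (∀ x → f x ≤ g x) → sumˡ xs f ≤ sumˡ xs g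
    sumˡ-mono []       f≤g = z≤n
    sumˡ-mono (x ∷ xs) f≤g = ℕ.+-mono-≤ (f≤g x) (sumˡ-mono xs f≤g)

    sumˡ-+ : ∀ xs (f g : X → ℕ) → sumˡ xs (λ x → f x + g x) ≡ sumˡ xs f + sumˡ xs g
    sumˡ-+ []       f g = refl
    sumˡ-+ (x ∷ xs) f g = trans (cong (_+_ (f x + g x)) (sumˡ-+ xs f g))
      (solve 4 (λ a b c d → a :+ b :+ (c :+ d) := a :+ c :+ (b :+ d)) refl
        (f x) (g x) (sumˡ xs f) (sumˡ xs g))
      where open ℕ.+-*-Solver

    sumˡ-* : ∀ xs (f : X → ℕ) c → sumˡ xs (λ x → f x * c) ≡ sumˡ xs f * c
    sumˡ-* []       f c = refl
    sumˡ-* (x ∷ xs) f c = trans (cong (_+_ (f x * c)) (sumˡ-* xs f c))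
      (sym (ℕ.*-distribʳ-+ c (f x) (sumˡ xs f)))

    sumˡ-0 : ∀ {xs} {f : X → ℕ} → All (λ x → f x ≡ 0) xs → sumˡ xs f ≡ 0
    sumˡ-0 All.[]           = refl
    sumˡ-0 (fx≡0 All.∷ all) = cong₂ _+_ fx≡0 (sumˡ-0 all)

    sumˡ-single : ∀ {xs a} {f : X → ℕ} → Unique xs → a ∈ˡ xs → (∀ x → x ≢ a → f x ≡ 0) →
                  sumˡ xs f ≡ f a
    sumˡ-single {f = f} (a∉ ∷ _) (here refl) off =
      trans (cong (_+_ (f _)) (sumˡ-0 (All.map (λ a≢x → off _ (a≢x ∘ sym)) a∉))) (ℕ.+-identityʳ _)
    sumˡ-single {f = f} (x∉ ∷ xs!) (there a∈) off =
      cong₂ _+_ (off _ (All.lookup x∉ a∈)) (sumˡ-single xs! a∈ off)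

  sumˡ-swap : {X Y : Set} (xs : List X) (ys : List Y) (f : X → Y → ℕ) →
              sumˡ xs (λ x → sumˡ ys (f x)) ≡ sumˡ ys (λ y → sumˡ xs (λ x → f x y))
  sumˡ-swap []       ys f = sym (sumˡ-0 (All.universal (λ _ → refl) ys))
  sumˡ-swap (x ∷ xs) ys f = trans (cong (_+_ (sumˡ ys (f x))) (sumˡ-swap xs ys f))
    (sym (sumˡ-+ ys (f x) (λ y → sumˡ xs (λ x → f x y))))

  module _ {X : Set} {{_ : Finite X}} where

    abstract

      sum : (X → ℕ) → ℕ
      sum = sumˡ elements

      card : {P : X → Set} → Decidable P → ℕ
      card P? = sum (λ x → ⟦ P? x ⟧)

      card≡sum : {P : X → Set} {P? : Decidable P} → card P? ≡ sum (λ x → ⟦ P? x ⟧)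
      card≡sum = refl

      ∣∣≡card : ∀ A → ∣ A ∣ ≡ card (mem? A)
      ∣∣≡card A = go elements
        where
        go : ∀ xs → List.length (List.filter (mem? A) xs) ≡ sumˡ xs (λ x → ⟦ mem? A x ⟧)
        go []       = refl
        go (x ∷ xs) with mem? A x
        ... | yes _ = cong suc (go xs)
        ... | no  _ = go xs

      sum-cong : {f g : X → ℕ} → (∀ x → f x ≡ g x) → sum f ≡ sum g
      sum-cong = sumˡ-cong elements

      sum-mono : {f g : X → ℕ} → (∀ x → f x ≤ g x) → sum f ≤ sum g
      sum-mono = sumˡ-mono elements

      sum-+ : ∀ (f g : X → ℕ) → sum (λ x → f x + g x) ≡ sum f + sum g
      sum-+ = sumˡ-+ elements

      sum-* : ∀ (f : X → ℕ) c → sum (λ x → f x * c) ≡ sum f * c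
      sum-* = sumˡ-* elements

      sum-0 : {f : X → ℕ} → (∀ x → f x ≡ 0) → sum f ≡ 0
      sum-0 f≡0 = sumˡ-0 (All.universal f≡0 elements)

      sum-single : ∀ a {f : X → ℕ} → (∀ x → x ≢ a → f x ≡ 0) → sum f ≡ f a
      sum-single a = sumˡ-single unique (complete a)

    module _ {P : X → Set} {P? : Decidable P} where

      card-cong : {Q : X → Set} {Q? : Decidable Q} →
                  (∀ x → P x → Q x) → (∀ x → Q x → P x) → card P? ≡ card Q?
      card-cong f g = trans card≡sum (trans (sum-cong (λ x → ⟦⟧-cong (f x) (g x))) (sym card≡sum))

      card-none : (∀ x → ¬ P x) → card P? ≡ 0
      card-none ¬P = trans card≡sum (sum-0 (λ x → ⟦⟧-no (¬P x)))

      card-one : ∀ a → P a → (∀ x → P x → x ≡ a) → card P? ≡ 1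
      card-one a Pa P⇒≡a = trans card≡sum
        (trans (sum-single a (λ x x≢a → ⟦⟧-no (x≢a ∘ P⇒≡a x))) (⟦⟧-yes Pa))

      card-≤1 : (∀ x y → P x → P y → x ≡ y) → card P? ≤ 1
      card-≤1 P-unique with ∃? P?
      ... | yes (a , Pa) = ℕ.≤-reflexive (card-one a Pa (λ x Px → P-unique x a Px Pa))
      ... | no  ¬∃P      = ℕ.≤-trans (ℕ.≤-reflexive (card-none (λ x Px → ¬∃P (x , Px)))) z≤n

      sum-indicator : ∀ k → sum (λ x → ⟦ P? x ⟧ * k) ≡ card P? * k
      sum-indicator k = trans (sum-* _ k) (cong (_* k) (sym card≡sum))

      sum-on : ∀ {f : X → ℕ} k → (∀ x → P x → f x ≡ k) → (∀ x → ¬ P x → f x ≡ 0) →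
               sum f ≡ card P? * k
      sum-on {f} k on off = trans (sum-cong eq) (sum-indicator k)
        where
        eq : ∀ x → f x ≡ ⟦ P? x ⟧ * k
        eq x with P? x
        ... | yes Px = trans (on x Px) (sym (trans (cong (_* k) (⟦⟧-yes Px)) (ℕ.+-identityʳ k)))
        ... | no ¬Px = trans (off x ¬Px) (sym (cong (_* k) (⟦⟧-no ¬Px)))

      sum-on-≤ : ∀ {f : X → ℕ} k → (∀ x → P x → f x ≤ k) → (∀ x → ¬ P x → f x ≡ 0) →
                 sum f ≤ card P? * k
      sum-on-≤ {f} k on off = ℕ.≤-trans (sum-mono le) (ℕ.≤-reflexive (sum-indicator k))
        where
        le : ∀ x → f x ≤ ⟦ P? x ⟧ * k
        le x with P? x
        ... | yes Px = ℕ.≤-trans (on x Px)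
          (ℕ.≤-reflexive (sym (trans (cong (_* k) (⟦⟧-yes Px)) (ℕ.+-identityʳ k))))
        ... | no ¬Px = ℕ.≤-trans (ℕ.≤-reflexive (off x ¬Px)) z≤n

  module _ {X Y : Set} {{_ : Finite X}} {{_ : Finite Y}} where

    abstract

      sum-swap : ∀ (f : X → Y → ℕ) → sum (λ x → sum (f x)) ≡ sum (λ y → sum (λ x → f x y))
      sum-swap = sumˡ-swap elements elements

    module _ {P : X → Set} {P? : Decidable P} where

      -- The indicators of `g x ≟ y` sum to one over `y`; inserting them and exchanging the sums
      -- groups the `x` by the value of `g`. The weight `f` is what later turns a second moment into
      -- a count of pairs.
      sum-fibres : ∀ (g : X → Y) (f : Y → ℕ) →
        sum (λ x → ⟦ P? x ⟧ * f (g x)) ≡ sum (λ y → card (λ x → P? x ×-dec g x ≟ y) * f y)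
      sum-fibres g f = begin
        sum (λ x → ⟦ P? x ⟧ * f (g x))
          ≡⟨ sum-cong (λ x → trans (eq x) (sym (sum-single (g x) (off x)))) ⟩
        sum (λ x → sum (λ y → ⟦ P? x ×-dec g x ≟ y ⟧ * f y))
          ≡⟨ sum-swap _ ⟩
        sum (λ y → sum (λ x → ⟦ P? x ×-dec g x ≟ y ⟧ * f y))
          ≡⟨ sum-cong (λ y → trans (sum-* _ (f y)) (cong (_* f y) (sym card≡sum))) ⟩
        sum (λ y → card (λ x → P? x ×-dec g x ≟ y) * f y) ∎
        where
        open ≡-Reasoning
        eq : ∀ x → ⟦ P? x ⟧ * f (g x) ≡ ⟦ P? x ×-dec g x ≟ g x ⟧ * f (g x)
        eq x = cong (_* f (g x)) (⟦⟧-cong (λ Px → Px , refl) proj₁)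
        off : ∀ x y → y ≢ g x → ⟦ P? x ×-dec g x ≟ y ⟧ * f y ≡ 0
        off x y y≢ = cong (_* f y) (⟦⟧-no (λ (_ , gx≡y) → y≢ (sym gx≡y)))

      card-fibres : ∀ (g : X → Y) → card P? ≡ sum (λ y → card (λ x → P? x ×-dec g x ≟ y))
      card-fibres g = begin
        card P?                                                   ≡⟨ trans card≡sum (sum-cong (λ x → sym (ℕ.*-identityʳ _))) ⟩
        sum (λ x → ⟦ P? x ⟧ * 1)                                  ≡⟨ sum-fibres g (λ _ → 1) ⟩
        sum (λ y → card (λ x → P? x ×-dec g x ≟ y) * 1)           ≡⟨ sum-cong (λ y → ℕ.*-identityʳ _) ⟩
        sum (λ y → card (λ x → P? x ×-dec g x ≟ y))               ∎
        where open ≡-Reasoning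

      module _ {Q : Y → Set} {Q? : Decidable Q} where

        card-fibres-≡ : ∀ (g : X → Y) k → (∀ x → P x → Q (g x)) →
          (∀ y → Q y → card (λ x → P? x ×-dec g x ≟ y) ≡ k) → card P? ≡ card Q? * k
        card-fibres-≡ g k P⇒Q fibre = trans (card-fibres g)
          (sum-on k fibre (λ y ¬Qy → card-none (λ x (Px , gx≡y) → ¬Qy (subst Q gx≡y (P⇒Q x Px)))))

        card-fibres-≤ : ∀ (g : X → Y) k → (∀ x → P x → Q (g x)) →
          (∀ y → Q y → card (λ x → P? x ×-dec g x ≟ y) ≤ k) → card P? ≤ card Q? * k
        card-fibres-≤ g k P⇒Q fibre = ℕ.≤-trans (ℕ.≤-reflexive (card-fibres g))
          (sum-on-≤ k fibre (λ y ¬Qy → card-none (λ x (Px , gx≡y) → ¬Qy (subst Q gx≡y (P⇒Q x Px)))))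

        card-injection : (φ : X → Y) → (∀ x → P x → Q (φ x)) →
          (∀ x x′ → P x → P x′ → φ x ≡ φ x′ → x ≡ x′) → card P? ≤ card Q?
        card-injection φ P⇒Q inj = ℕ.≤-trans
          (card-fibres-≤ φ 1 P⇒Q (λ y _ → card-≤1 (λ x x′ (Px , φx≡y) (Px′ , φx′≡y) →
            inj x x′ Px Px′ (trans φx≡y (sym φx′≡y)))))
          (ℕ.≤-reflexive (ℕ.*-identityʳ _))

  card-bijection : {X Y : Set} {{_ : Finite X}} {{_ : Finite Y}}
    {P : X → Set} {P? : Decidable P} {Q : Y → Set} {Q? : Decidable Q}
    (φ : X → Y) (ψ : Y → X) → (∀ x → P x → Q (φ x)) → (∀ y → Q y → P (ψ y)) →
    (∀ x → P x → ψ (φ x) ≡ x) → (∀ y → Q y → φ (ψ y) ≡ y) → card P? ≡ card Q?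
  card-bijection φ ψ P⇒Q Q⇒P ψφ φψ = ℕ.≤-antisym
    (card-injection φ P⇒Q (λ x x′ Px Px′ eq → trans (sym (ψφ x Px)) (trans (cong ψ eq) (ψφ x′ Px′))))
    (card-injection ψ Q⇒P (λ y y′ Qy Qy′ eq → trans (sym (φψ y Qy)) (trans (cong φ eq) (φψ y′ Qy′))))

  module _ {X : Set} {{_ : Finite X}} where

    everything? : Decidable {A = X} (λ _ → ⊤)
    everything? _ = yes tt

    card-mono : {P Q : X → Set} {P? : Decidable P} {Q? : Decidable Q} →
                (∀ x → P x → Q x) → card P? ≤ card Q?
    card-mono P⇒Q = card-injection id P⇒Q (λ _ _ _ _ eq → eq)

    card-⊎ : {P Q S : X → Set} {P? : Decidable P} {Q? : Decidable Q} {S? : Decidable S} →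
             (∀ x → P x → Q x ⊎ S x) → (∀ x → Q x → P x) → (∀ x → S x → P x) →
             (∀ x → Q x → ¬ S x) → card P? ≡ card Q? + card S?
    card-⊎ {P? = P?} {Q?} {S?} split Q⇒P S⇒P disjoint = trans card≡sum (trans (sum-cong eq)
      (trans (sum-+ _ _) (cong₂ _+_ (sym card≡sum) (sym card≡sum))))
      where
      eq : ∀ x → ⟦ P? x ⟧ ≡ ⟦ Q? x ⟧ + ⟦ S? x ⟧
      eq x with Q? x | S? x
      ... | yes Qx | yes Sx = contradiction Sx (disjoint x Qx)
      ... | yes Qx | no ¬Sx = trans (⟦⟧-yes (Q⇒P x Qx)) (sym (cong₂ _+_ (⟦⟧-yes Qx) (⟦⟧-no ¬Sx)))
      ... | no ¬Qx | yes Sx = trans (⟦⟧-yes (S⇒P x Sx)) (sym (cong₂ _+_ (⟦⟧-no ¬Qx) (⟦⟧-yes Sx)))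
      ... | no ¬Qx | no ¬Sx = trans (⟦⟧-no ¬Px) (sym (cong₂ _+_ (⟦⟧-no ¬Qx) (⟦⟧-no ¬Sx)))
        where
        ¬Px : ¬ _
        ¬Px Px with split x Px
        ... | inj₁ Qx = ¬Qx Qx
        ... | inj₂ Sx = ¬Sx Sx

    card-complement : {P : X → Set} (P? : Decidable P) →
                      card everything? ≡ card P? + card (λ x → ¬? (P? x))
    card-complement P? = card-⊎ split _ _ (λ _ Px ¬Px → ¬Px Px)
      where
      split : ∀ x → _ → _
      split x _ with P? x
      ... | yes Px = inj₁ Px
      ... | no ¬Px = inj₂ ¬Px

    card-pair : {P : X → Set} {P? : Decidable P} → ∀ x y → x ≢ y → P x → P y →
                (∀ z → P z → z ≡ x ⊎ z ≡ y) → card P? ≡ 2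
    card-pair {P} x y x≢y Px Py only = trans
      (card-⊎ {Q? = _≟ x} {S? = _≟ y} only (λ { _ refl → Px }) (λ { _ refl → Py })
        (λ { _ refl → x≢y }))
      (cong₂ _+_ (card-one x refl (λ _ eq → eq)) (card-one y refl (λ _ eq → eq)))

    card-≤2 : {P : X → Set} {P? : Decidable P} →
              (∀ x y z → x ≢ y → P x → P y → P z → z ≡ x ⊎ z ≡ y) → card P? ≤ 2
    card-≤2 {P} {P?} no-third with ∃? P?
    ... | no ¬∃P = ℕ.≤-trans (ℕ.≤-reflexive (card-none (λ x Px → ¬∃P (x , Px)))) z≤n
    ... | yes (x , Px) with ∃? (λ y → ¬? (x ≟ y) ×-dec P? y)
    ...   | yes (y , x≢y , Py) =
            ℕ.≤-reflexive (card-pair x y x≢y Px Py (λ z → no-third x y z x≢y Px Py))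
    ...   | no ¬∃ = ℕ.≤-trans (card-≤1 single) (ℕ.n≤1+n 1)
      where
      ≡x : ∀ y → P y → y ≡ x
      ≡x y Py with x ≟ y
      ... | yes x≡y = sym x≡y
      ... | no  x≢y = contradiction (y , x≢y , Py) ¬∃
      single : ∀ y z → P y → P z → y ≡ z
      single y z Py Pz = trans (≡x y Py) (sym (≡x z Pz))

    -- An element of `P` outside `Q` could be added to `Q`, giving a subset of `P` with more than
    -- `card Q?` elements. This stands in for comparing the dimensions of nested subspaces.
    card-⊆-≡ : {P Q : X → Set} {P? : Decidable P} {Q? : Decidable Q} →
               (∀ x → Q x → P x) → card P? ≤ card Q? → ∀ x → P x → Q x
    card-⊆-≡ {P} {Q} {P?} {Q?} Q⇒P P≤Q x Px with Q? x
    ... | yes Qx = Qx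
    ... | no ¬Qx = contradiction P≤Q (ℕ.<⇒≱ (ℕ.≤-trans
      (ℕ.+-mono-≤ (ℕ.≤-reflexive (sym (card-one {P? = _≟ x} x refl (λ _ → id)))) (ℕ.≤-refl {card Q?}))
      (ℕ.≤-trans (ℕ.≤-reflexive (sym (card-⊎ {P? = λ y → y ≟ x ⊎-dec Q? y} (λ _ → id) (λ _ → inj₁) (λ _ → inj₂)
          (λ { _ refl → ¬Qx }))))
        (card-mono (λ { _ (inj₁ refl) → Px ; y (inj₂ Qy) → Q⇒P y Qy })))))

-- A ring solver with integer coefficients.

module IntegerCoefficients {c ℓ} (R : CommutativeRing c ℓ) where

  open CommutativeRing R hiding (zero; reflexive; isEquivalence)
    renaming (_≈_ to _≋_; refl to ≈-refl; sym to ≈-sym; trans to ≈-trans; setoid to ≈-setoid)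
  open import Algebra.Properties.Ring ring
    using (-‿distribˡ-*; -‿distribʳ-*; -‿involutive; -‿+-comm; -0#≈0#)
  open import Algebra.Properties.Semiring.Mult.TCOptimised semiring
    using (×-homo-+; ×1-homo-*; 1+×) renaming (_×_ to _×ᵗ_)
  open import Relation.Binary.Reasoning.Setoid ≈-setoid

  ⟦_⟧ᶻ : ℤ → Carrier
  ⟦ + n ⟧ᶻ      = n ×ᵗ 1#
  ⟦ -[1+ n ] ⟧ᶻ = - (suc n ×ᵗ 1#)

  -‿homo : ∀ i → ⟦ ℤ.- i ⟧ᶻ ≋ - ⟦ i ⟧ᶻ
  -‿homo (+ zero)  = ≈-sym -0#≈0#
  -‿homo (+ suc n) = ≈-refl
  -‿homo -[1+ n ]  = ≈-sym (-‿involutive _)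

  cancelˡ : ∀ x y z → (x + y) - (x + z) ≋ y - z
  cancelˡ x y z = begin
    (x + y) - (x + z)       ≈⟨ +-cong (+-comm x y) (≈-sym (-‿+-comm x z)) ⟩
    (y + x) + (- x + - z)   ≈⟨ +-assoc y x _ ⟩
    y + (x + (- x + - z))   ≈⟨ +-congˡ (≈-sym (+-assoc x (- x) (- z))) ⟩
    y + ((x + - x) + - z)   ≈⟨ +-congˡ (+-congʳ (-‿inverseʳ x)) ⟩
    y + (0# + - z)          ≈⟨ +-congˡ (+-identityˡ _) ⟩
    y - z                   ∎

  ⊖-homo : ∀ m n → ⟦ m ℤ.⊖ n ⟧ᶻ ≋ m ×ᵗ 1# - n ×ᵗ 1#
  ⊖-homo zero    zero    = ≈-sym (-‿inverseʳ 0#)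
  ⊖-homo zero    (suc n) = ≈-sym (+-identityˡ _)
  ⊖-homo (suc m) zero    = ≈-sym (≈-trans (+-congˡ -0#≈0#) (+-identityʳ _))
  ⊖-homo (suc m) (suc n) = begin
    ⟦ suc m ℤ.⊖ suc n ⟧ᶻ              ≡⟨ cong ⟦_⟧ᶻ (ℤ.[1+m]⊖[1+n]≡m⊖n m n) ⟩
    ⟦ m ℤ.⊖ n ⟧ᶻ                      ≈⟨ ⊖-homo m n ⟩
    m ×ᵗ 1# - n ×ᵗ 1#                 ≈⟨ cancelˡ 1# _ _ ⟨
    (1# + m ×ᵗ 1#) - (1# + n ×ᵗ 1#)   ≈⟨ +-cong (1+× m 1#) (-‿cong (1+× n 1#)) ⟨
    suc m ×ᵗ 1# - suc n ×ᵗ 1#         ∎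

  +-homo : ∀ i j → ⟦ i ℤ.+ j ⟧ᶻ ≋ ⟦ i ⟧ᶻ + ⟦ j ⟧ᶻ
  +-homo (+ m)    (+ n)    = ×-homo-+ 1# m n
  +-homo (+ m)    -[1+ n ] = ⊖-homo m (suc n)
  +-homo -[1+ m ] (+ n)    = ≈-trans (⊖-homo n (suc m)) (+-comm _ _)
  +-homo -[1+ m ] -[1+ n ] = begin
    - (suc (suc (m ℕ.+ n)) ×ᵗ 1#)           ≡⟨ cong (λ k → - (suc k ×ᵗ 1#)) (ℕ.+-suc m n) ⟨
    - ((suc m ℕ.+ suc n) ×ᵗ 1#)             ≈⟨ -‿cong (×-homo-+ 1# (suc m) (suc n)) ⟩
    - (suc m ×ᵗ 1# + suc n ×ᵗ 1#)           ≈⟨ -‿+-comm _ _ ⟨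
    - (suc m ×ᵗ 1#) + - (suc n ×ᵗ 1#)       ∎

  +◃-homo : ∀ n → ⟦ Sign.+ ℤ.◃ n ⟧ᶻ ≋ n ×ᵗ 1#
  +◃-homo zero    = ≈-refl
  +◃-homo (suc n) = ≈-refl

  -◃-homo : ∀ n → ⟦ Sign.- ℤ.◃ n ⟧ᶻ ≋ - (n ×ᵗ 1#)
  -◃-homo zero    = ≈-sym -0#≈0#
  -◃-homo (suc n) = ≈-refl

  *-homo : ∀ i j → ⟦ i ℤ.* j ⟧ᶻ ≋ ⟦ i ⟧ᶻ * ⟦ j ⟧ᶻ
  *-homo (+ m)    (+ n)    = ≈-trans (+◃-homo (m ℕ.* n)) (×1-homo-* m n)
  *-homo (+ m)    -[1+ n ] = ≈-trans (-◃-homo (m ℕ.* suc n))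
    (≈-trans (-‿cong (×1-homo-* m (suc n))) (-‿distribʳ-* _ _))
  *-homo -[1+ m ] (+ n)    = ≈-trans (-◃-homo (suc m ℕ.* n))
    (≈-trans (-‿cong (×1-homo-* (suc m) n)) (-‿distribˡ-* _ _))
  *-homo -[1+ m ] -[1+ n ] = ≈-trans (+◃-homo (suc m ℕ.* suc n))
    (≈-trans (×1-homo-* (suc m) (suc n)) (begin
      a * b           ≈⟨ -‿involutive (a * b) ⟨
      - (- (a * b))   ≈⟨ -‿cong (-‿distribˡ-* a b) ⟩
      - (- a * b)     ≈⟨ -‿distribʳ-* (- a) b ⟩
      - a * - b       ∎))
    where
    a = suc m ×ᵗ 1#
    b = suc n ×ᵗ 1#

  homomorphism : ℤ.+-*-rawRing ACR.-Raw-AlmostCommutative⟶ ACR.fromCommutativeRing R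
  homomorphism = record
    { ⟦_⟧    = ⟦_⟧ᶻ
    ; +-homo = +-homo
    ; *-homo = *-homo
    ; -‿homo = -‿homo
    ; 0-homo = ≈-refl
    ; 1-homo = ≈-refl
    }

  -- A sound test only: in positive characteristic distinct integers may have equal images, and the
  -- solver then merely fails to identify them.
  coefficient≟ : ∀ i j → Maybe (⟦ i ⟧ᶻ ≋ ⟦ j ⟧ᶻ)
  coefficient≟ i j = Maybe.map (λ { refl → ≈-refl }) (dec⇒maybe (i ℤ.≟ j))

module IntegerRingSolver {c ℓ} (R : CommutativeRing c ℓ) =
  Algebra.Solver.Ring ℤ.+-*-rawRing (ACR.fromCommutativeRing R)
    (IntegerCoefficients.homomorphism R) (IntegerCoefficients.coefficient≟ R)

-- Field arithmetic, quadratic equations and odd characteristic.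

module FieldProperties {q : ℕ} (F : FiniteField q) where

  open FiniteField F

  commutativeRing : CommutativeRing _ _
  commutativeRing = record { isCommutativeRing = isCommutativeRing }

  open CommutativeRing commutativeRing public
    using (*-comm; *-assoc; *-identityˡ; *-identityʳ; zeroˡ; zeroʳ; +-comm; +-assoc; +-identityˡ; +-identityʳ; -‿inverseʳ)

  open IntegerRingSolver commutativeRing public
    using (solve; _:=_; _:+_; _:*_; _:-_; :-_; con)
  open Geometry F using (2#)
  open Counting

  *-inverseʳ : ∀ {x} → x ≢ 0# → x * x ⁻¹ ≡ 1#
  *-inverseʳ {x} x≢0 with x ≟ 0#
  ... | yes x≡0 = contradiction x≡0 x≢0
  ... | no  x≢0 with #⇒invertible x≢0
  ...   | y , _ , x-0*y≡1 =
          trans (solve 2 (λ x y → x :* y := (x :- con (+ 0)) :* y) refl x y) x-0*y≡1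

  *-inverseˡ : ∀ {x} → x ≢ 0# → x ⁻¹ * x ≡ 1#
  *-inverseˡ x≢0 = trans (*-comm _ _) (*-inverseʳ x≢0)

  1≢0 : 1# ≢ 0#
  1≢0 = invertible⇒# {1#} {0#} (1# ,
    solve 0 (con (+ 1) :* (con (+ 1) :- con (+ 0)) := con (+ 1)) refl ,
    solve 0 ((con (+ 1) :- con (+ 0)) :* con (+ 1) := con (+ 1)) refl)

  *-cancelˡ : ∀ {x y z} → x ≢ 0# → x * y ≡ x * z → y ≡ z
  *-cancelˡ {x} {y} {z} x≢0 eq = begin
    y                  ≡⟨ *-identityˡ y ⟨
    1# * y             ≡⟨ cong (_* y) (*-inverseˡ x≢0) ⟨
    x ⁻¹ * x * y       ≡⟨ *-assoc _ x y ⟩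
    x ⁻¹ * (x * y)     ≡⟨ cong (x ⁻¹ *_) eq ⟩
    x ⁻¹ * (x * z)     ≡⟨ *-assoc _ x z ⟨
    x ⁻¹ * x * z       ≡⟨ cong (_* z) (*-inverseˡ x≢0) ⟩
    1# * z             ≡⟨ *-identityˡ z ⟩
    z                  ∎
    where open ≡-Reasoning

  *≡0 : ∀ {x y} → x ≢ 0# → x * y ≡ 0# → y ≡ 0#
  *≡0 {x} x≢0 xy≡0 = *-cancelˡ x≢0 (trans xy≡0 (sym (zeroʳ x)))

  *-≢0 : ∀ {x y} → x ≢ 0# → y ≢ 0# → x * y ≢ 0#
  *-≢0 x≢0 y≢0 xy≡0 = y≢0 (*≡0 x≢0 xy≡0)

  x-y≡0⇒x≡y : ∀ {x y} → x - y ≡ 0# → x ≡ y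
  x-y≡0⇒x≡y {x} {y} eq = trans (solve 2 (λ x y → x := (x :- y) :+ y) refl x y)
    (trans (cong (_+ y) eq) (+-identityˡ y))

  x≢y⇒x-y≢0 : ∀ {x y} → x ≢ y → x - y ≢ 0#
  x≢y⇒x-y≢0 x≢y = x≢y ∘ x-y≡0⇒x≡y

  -- Subtracting the equations of distinct roots x, y and cancelling x - y leaves a(x + y) + b = 0.
  -- Two such relations, for z, x and for x, y, differ by a(z - y), so a root z other than x equals
  -- y.
  quadratic-roots : ∀ a b c → a ≢ 0# → card (λ u → (a * (u * u) + b * u + c) ≟ 0#) ℕ.≤ 2
  quadratic-roots a b c a≢0 = card-≤2 λ x y z x≢y Px Py Pz → roots x y z x≢y Px Py Pz
    where
    open ≡-Reasoning
    f : Carrier → Carrier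
    f u = a * (u * u) + b * u + c
    difference : ∀ x y → (x - y) * (a * (x + y) + b) ≡ f x - f y
    difference x y = solve 5 (λ a b c x y → (x :- y) :* (a :* (x :+ y) :+ b) :=
      (a :* (x :* x) :+ b :* x :+ c) :- (a :* (y :* y) :+ b :* y :+ c)) refl a b c x y
    vieta : ∀ {x y} → x ≢ y → f x ≡ 0# → f y ≡ 0# → a * (x + y) + b ≡ 0#
    vieta {x} {y} x≢y fx≡0 fy≡0 = *≡0 (x≢y⇒x-y≢0 x≢y)
      (trans (difference x y) (trans (cong₂ _-_ fx≡0 fy≡0) (-‿inverseʳ 0#)))
    roots : ∀ x y z → x ≢ y → f x ≡ 0# → f y ≡ 0# → f z ≡ 0# → z ≡ x ⊎ z ≡ y
    roots x y z x≢y fx≡0 fy≡0 fz≡0 with z ≟ x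
    ... | yes z≡x = inj₁ z≡x
    ... | no  z≢x = inj₂ (x-y≡0⇒x≡y (*≡0 a≢0 (begin
      a * (z - y)                                     ≡⟨ solve 5 (λ a b x y z → a :* (z :- y) :=
                                                           (a :* (z :+ x) :+ b) :- (a :* (x :+ y) :+ b)) refl a b x y z ⟩
      (a * (z + x) + b) - (a * (x + y) + b)           ≡⟨ cong₂ _-_ (vieta z≢x fz≡0 fx≡0) (vieta x≢y fx≡0 fy≡0) ⟩
      0# - 0#                                         ≡⟨ -‿inverseʳ 0# ⟩
      0#                                              ∎)))

  card-field : card {X = Carrier} everything? ≡ q
  card-field = trans (card-bijection to from _ _ (λ x _ → strictlyInverseʳ x)
    (λ i _ → strictlyInverseˡ i)) card-Fin
    where
    open Inverse enumeration
    instance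
      finiteFin : Finite (Fin q)
      finiteFin = record
        { _≟_ = Fin._≟_ ; elements = List.allFin q ; complete = ∈-allFin ; unique = Unique.allFin⁺ q }
    card-Fin : card {X = Fin q} everything? ≡ q
    card-Fin = begin
      card everything?                                        ≡⟨ ∣∣≡card (record { Mem = λ _ → ⊤ ; mem? = everything? }) ⟨
      List.length (List.filter everything? (List.allFin q))   ≡⟨ cong List.length (List.filter-all everything? (All.universal _ (List.allFin q))) ⟩
      List.length (List.allFin q)                             ≡⟨ List.length-tabulate id ⟩
      q                                                       ∎
      where open ≡-Reasoning

  1<q : 1 ℕ.< q
  1<q = ℕ.≤-trans (ℕ.≤-reflexive (sym (card-pair {P = λ x → x ≡ 0# ⊎ x ≡ 1#} {P? = λ x → x ≟ 0# ⊎-dec x ≟ 1#}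
      0# 1# (≢-sym 1≢0) (inj₁ refl) (inj₂ refl) (λ _ → id))))
    (ℕ.≤-trans (card-mono _) (ℕ.≤-reflexive card-field))

  -- If 1 + 1 = 0 then x ↦ x + 1 is an involution without fixed points, so q is even.
  2≢0 : OddPrimePower q → 2# ≢ 0#
  2≢0 (p , k , p-prime , p≢2 , _ , q≡p^k) 2≡0 = p≢2 (sym (prime-∣⇒≡ (2∣p^⇒2∣p k 2∣p^k)))
    where
    open Inverse enumeration
    idx : Carrier → ℕ
    idx x = Fin.toℕ (to x)
    idx-injective : ∀ {x y} → idx x ≡ idx y → x ≡ y
    idx-injective {x} {y} eq = trans (sym (strictlyInverseʳ x))
      (trans (cong from (Fin.toℕ-injective eq)) (strictlyInverseʳ y))
    -- In each pair x, x + 1 exactly one element has the smaller index in the enumeration, so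
    -- `rises?` selects one element of every pair and x ↦ x + 1 exchanges the selected half with its
    -- complement.
    rises? : Decidable (λ x → idx x ℕ.< idx (x + 1#))
    rises? x = idx x ℕ.<? idx (x + 1#)
    x+1+1≡x : ∀ x → x + 1# + 1# ≡ x
    x+1+1≡x x = trans (+-assoc x 1# 1#) (trans (cong (_+_ x) 2≡0) (+-identityʳ x))
    x+1≢x : ∀ x → x + 1# ≢ x
    x+1≢x x eq = 1≢0 (trans (solve 1 (λ x → con (+ 1) := x :+ con (+ 1) :- x) refl x)
      (trans (cong (_- x) eq) (-‿inverseʳ x)))
    falls : ∀ x → ¬ (idx x ℕ.< idx (x + 1#)) → idx (x + 1#) ℕ.< idx x
    falls x ≮ = ℕ.≤∧≢⇒< (ℕ.≮⇒≥ ≮) (x+1≢x x ∘ idx-injective)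
    q-even : q ≡ card rises? ℕ.+ card rises?
    q-even = trans (sym card-field) (trans (card-complement rises?) (cong (card rises? ℕ.+_)
      (card-bijection (_+ 1#) (_+ 1#)
        (λ x ≮ → subst (λ y → idx (x + 1#) ℕ.< idx y) (sym (x+1+1≡x x)) (falls x ≮))
        (λ x < ≮ → ℕ.<-asym < (subst (λ y → idx (x + 1#) ℕ.< idx y) (x+1+1≡x x) ≮))
        (λ x _ → x+1+1≡x x) (λ x _ → x+1+1≡x x))))
    2∣p^k : 2 ∣ p ℕ.^ k
    2∣p^k = divides (card rises?) (trans (sym q≡p^k) (trans q-even
      (trans (cong (card rises? ℕ.+_) (sym (ℕ.+-identityʳ _))) (ℕ.*-comm 2 (card rises?)))))
    2∣p^⇒2∣p : ∀ k → 2 ∣ p ℕ.^ k → 2 ∣ p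
    2∣p^⇒2∣p zero    2∣1 with ∣1⇒≡1 2∣1
    ... | ()
    2∣p^⇒2∣p (suc k) 2∣p*p^k with euclidsLemma p (p ℕ.^ k) (prime[2]) 2∣p*p^k
    ... | inj₁ 2∣p   = 2∣p
    ... | inj₂ 2∣p^k = 2∣p^⇒2∣p k 2∣p^k
    prime-∣⇒≡ : 2 ∣ p → 2 ≡ p
    prime-∣⇒≡ 2∣p with prime⇒irreducible p-prime 2∣p
    ... | inj₂ 2≡p = 2≡p

-- Vectors, linear functionals, slices and the polar form.

module Vectors {q : ℕ} (F : FiniteField q) where

  open FiniteField F
  open Geometry F
  open FieldProperties F
  open Counting

  ⊕-comm : ∀ {d} (x y : Point d) → x ⊕ y ≡ y ⊕ x
  ⊕-comm = Vec.zipWith-comm +-comm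

  ⊖-def : ∀ {d} (x y : Point d) → x ⊖ y ≡ x ⊕ (- 1#) · y
  ⊖-def []      []      = refl
  ⊖-def (a ∷ x) (b ∷ y) = cong₂ _∷_
    (solve 2 (λ a b → a :- b := a :+ :- con (+ 1) :* b) refl a b) (⊖-def x y)

  ⊕-⊖ : ∀ {d} (x y : Point d) → (x ⊕ y) ⊖ y ≡ x
  ⊕-⊖ []      []      = refl
  ⊕-⊖ (a ∷ x) (b ∷ y) = cong₂ _∷_ (solve 2 (λ a b → (a :+ b) :- b := a) refl a b) (⊕-⊖ x y)

  ⊖-⊕ : ∀ {d} (x y : Point d) → (x ⊖ y) ⊕ y ≡ x
  ⊖-⊕ []      []      = refl
  ⊖-⊕ (a ∷ x) (b ∷ y) = cong₂ _∷_ (solve 2 (λ a b → (a :- b) :+ b := a) refl a b) (⊖-⊕ x y)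

  ⊕-·-· : ∀ {d} (x e : Point d) a b → x ⊕ a · e ⊕ b · e ≡ x ⊕ (a + b) · e
  ⊕-·-· []      []      a b = refl
  ⊕-·-· (s ∷ x) (t ∷ e) a b = cong₂ _∷_
    (solve 4 (λ s t a b → s :+ a :* t :+ b :* t := s :+ (a :+ b) :* t) refl s t a b) (⊕-·-· x e a b)

  ⊕-0· : ∀ {d} (x e : Point d) → x ⊕ 0# · e ≡ x
  ⊕-0· []      []      = refl
  ⊕-0· (s ∷ x) (t ∷ e) = cong₂ _∷_
    (solve 2 (λ s t → s :+ con (+ 0) :* t := s) refl s t) (⊕-0· x e)

  ⊕-·-inverse : ∀ {d} (x e : Point d) a b → a + b ≡ 0# → x ⊕ a · e ⊕ b · e ≡ x
  ⊕-·-inverse x e a b a+b≡0 =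
    trans (⊕-·-· x e a b) (trans (cong (λ c → x ⊕ c · e) a+b≡0) (⊕-0· x e))

  ·-assoc : ∀ {d} a b (x : Point d) → a · b · x ≡ (a * b) · x
  ·-assoc a b []      = refl
  ·-assoc a b (s ∷ x) = cong₂ _∷_ (sym (*-assoc a b s)) (·-assoc a b x)

  1· : ∀ {d} (x : Point d) → 1# · x ≡ x
  1· []      = refl
  1· (s ∷ x) = cong₂ _∷_ (*-identityˡ s) (1· x)

  x⊕x≡2·x : ∀ {d} (x : Point d) → x ⊕ x ≡ 2# · x
  x⊕x≡2·x []      = refl
  x⊕x≡2·x (s ∷ x) = cong₂ _∷_ (solve 1 (λ s → s :+ s := con (+ 2) :* s) refl s) (x⊕x≡2·x x)

  ⊖≡𝟎⇒≡ : ∀ {d} (x y : Point d) → x ⊖ y ≡ 𝟎 → x ≡ y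
  ⊖≡𝟎⇒≡ []      []      _  = refl
  ⊖≡𝟎⇒≡ (a ∷ x) (b ∷ y) eq =
    cong₂ _∷_ (x-y≡0⇒x≡y (Vec.∷-injectiveˡ eq)) (⊖≡𝟎⇒≡ x y (Vec.∷-injectiveʳ eq))

  ⊕·-⊖-⊕· : ∀ {d} (c e : Point d) a b → (c ⊕ b · e) ⊖ (c ⊕ a · e) ≡ (b - a) · e
  ⊕·-⊖-⊕· []      []      a b = refl
  ⊕·-⊖-⊕· (s ∷ c) (t ∷ e) a b = cong₂ _∷_
    (solve 4 (λ s t a b → (s :+ b :* t) :- (s :+ a :* t) := (b :- a) :* t) refl s t a b)
    (⊕·-⊖-⊕· c e a b)

  ⊖-⊕· : ∀ {d} (x c e : Point d) u → x ⊖ (c ⊕ u · e) ≡ (x ⊖ c) ⊕ (- u) · e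
  ⊖-⊕· []      []      []      u = refl
  ⊖-⊕· (r ∷ x) (s ∷ c) (t ∷ e) u = cong₂ _∷_
    (solve 4 (λ r s t u → r :- (s :+ u :* t) := (r :- s) :+ (:- u) :* t) refl r s t u) (⊖-⊕· x c e u)

  record IsLinear {d} (ℓ : Point d → Carrier) : Set where
    field
      homo-⊕ : ∀ x y → ℓ (x ⊕ y) ≡ ℓ x + ℓ y
      homo-· : ∀ a x → ℓ (a · x) ≡ a * ℓ x

    homo-⊕· : ∀ x a e → ℓ (x ⊕ a · e) ≡ ℓ x + a * ℓ e
    homo-⊕· x a e = trans (homo-⊕ x (a · e)) (cong (_+_ (ℓ x)) (homo-· a e))

    homo-⊖ : ∀ x y → ℓ (x ⊖ y) ≡ ℓ x - ℓ y
    homo-⊖ x y = trans (cong ℓ (⊖-def x y)) (trans (homo-⊕· x (- 1#) y)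
      (solve 2 (λ a b → a :+ :- con (+ 1) :* b := a :- b) refl (ℓ x) (ℓ y)))

  dot-linear : ∀ {d} (a : Point d) → IsLinear (dot a)
  dot-linear a = record { homo-⊕ = dot-⊕ a ; homo-· = dot-· a }
    where
    dot-⊕ : ∀ {d} (a x y : Point d) → dot a (x ⊕ y) ≡ dot a x + dot a y
    dot-⊕ []      []      []      = sym (+-identityˡ 0#)
    dot-⊕ (a ∷ as) (x ∷ xs) (y ∷ ys) = trans (cong (_+_ (a * (x + y))) (dot-⊕ as xs ys))
      (solve 5 (λ a x y s t → a :* (x :+ y) :+ (s :+ t) := a :* x :+ s :+ (a :* y :+ t)) refl
        a x y (dot as xs) (dot as ys))
    dot-· : ∀ {d} (a : Point d) c x → dot a (c · x) ≡ c * dot a x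
    dot-· []       c []       = sym (zeroʳ c)
    dot-· (a ∷ as) c (x ∷ xs) = trans (cong (_+_ (a * (c * x))) (dot-· as c xs))
      (solve 4 (λ a c x s → a :* (c :* x) :+ c :* s := c :* (a :* x :+ s)) refl a c x (dot as xs))

  dot-nondegenerate : ∀ {d} (a : Point d) → (∀ x → dot a x ≡ 0#) → a ≡ 𝟎
  dot-nondegenerate []       _    = refl
  dot-nondegenerate (a ∷ as) all0 = cong₂ _∷_
    (trans (solve 1 (λ a → a := a :* con (+ 1) :+ con (+ 0)) refl a)
      (trans (cong (_+_ (a * 1#)) (sym (dot-𝟎 as))) (all0 (1# ∷ 𝟎))))
    (dot-nondegenerate as (λ x → trans (solve 2 (λ a s → s := a :* con (+ 0) :+ s) refl a (dot as x))
      (all0 (0# ∷ x))))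
    where
    dot-𝟎 : ∀ {d} (a : Point d) → dot a 𝟎 ≡ 0#
    dot-𝟎 []       = refl
    dot-𝟎 (a ∷ as) = trans (cong (_+_ (a * 0#)) (dot-𝟎 as))
      (solve 1 (λ a → a :* con (+ 0) :+ con (+ 0) := con (+ 0)) refl a)

  card-points : ∀ d → card {X = Point d} everything? ≡ q ℕ.^ d
  card-points zero    = card-one [] tt (λ { [] _ → refl })
  card-points (suc d) = trans
    (card-fibres-≡ {Q? = everything?} Vec.head (q ℕ.^ d) _ (λ a _ → trans
      (card-bijection Vec.tail (a ∷_) _ (λ _ _ → tt , refl) (λ { (_ ∷ _) (_ , refl) → refl }) (λ _ _ → refl))
      (card-points d)))
    (cong (ℕ._* q ℕ.^ d) card-field)

  module _ {d} {P : Point d → Set} {P? : Decidable P} {ℓ : Point d → Carrier} (ℓ-linear : IsLinear ℓ)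
           (e : Point d) (P-invariant : ∀ x u → P x → P (x ⊕ u · e)) where

    open IsLinear ℓ-linear

    -- Translation by (β - γ)/ℓ(e) times `e` preserves `P` and carries the slice ℓ = γ onto the
    -- slice ℓ = β, so all q slices have the same size.
    card-slice : ℓ e ≢ 0# → ∀ β → card P? ≡ q ℕ.* card (λ x → P? x ×-dec ℓ x ≟ β)
    card-slice ℓe≢0 β = trans
      (card-fibres-≡ {Q? = everything?} ℓ k _ (λ γ _ → card-bijection
        (λ x → x ⊕ ((β - γ) * ℓ e ⁻¹) · e) (λ x → x ⊕ ((γ - β) * ℓ e ⁻¹) · e)
        (λ x → shift γ β x) (λ x → shift β γ x) (λ x _ → back γ β x) (λ x _ → back β γ x)))
      (cong (ℕ._* k) card-field)
      where
      k = card (λ x → P? x ×-dec ℓ x ≟ β)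
      back : ∀ γ β x → x ⊕ ((β - γ) * ℓ e ⁻¹) · e ⊕ ((γ - β) * ℓ e ⁻¹) · e ≡ x
      back γ β x = ⊕-·-inverse x e _ _
        (solve 3 (λ β γ i → (β :- γ) :* i :+ (γ :- β) :* i := con (+ 0)) refl β γ (ℓ e ⁻¹))
      shift : ∀ γ β x → P x × ℓ x ≡ γ →
              P (x ⊕ ((β - γ) * ℓ e ⁻¹) · e) × ℓ (x ⊕ ((β - γ) * ℓ e ⁻¹) · e) ≡ β
      shift γ β x (Px , ℓx≡γ) = P-invariant x _ Px , (begin
        ℓ (x ⊕ ((β - γ) * ℓ e ⁻¹) · e)     ≡⟨ homo-⊕· x _ e ⟩
        ℓ x + (β - γ) * ℓ e ⁻¹ * ℓ e       ≡⟨ cong₂ _+_ ℓx≡γ (trans (*-assoc _ _ _) (trans (cong ((β - γ) *_) (*-inverseˡ ℓe≢0)) (*-identityʳ _))) ⟩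
        γ + (β - γ)                        ≡⟨ solve 2 (λ β γ → γ :+ (β :- γ) := β) refl β γ ⟩
        β                                  ∎)
        where open ≡-Reasoning

  module FormProperties (2≢0 : 2# ≢ 0#) {d} (Q : Point d → Carrier)
                        (isQuadraticForm : Form.IsQuadraticForm Q) where

    open Form Q
    open IsQuadraticForm isQuadraticForm

    Q-⊕ : ∀ x y → Q (x ⊕ y) ≡ Q x + Q y + 2# * ⟨ x , y ⟩
    Q-⊕ x y = begin
      Q (x ⊕ y)
        ≡⟨ solve 3 (λ s a b → s := a :+ b :+ con (+ 1) :* ((s :- a) :- b)) refl (Q (x ⊕ y)) (Q x) (Q y) ⟩
      Q x + Q y + 1# * polar x y
        ≡⟨ cong (λ i → Q x + Q y + i * polar x y) (*-inverseʳ 2≢0) ⟨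
      Q x + Q y + 2# * 2# ⁻¹ * polar x y
        ≡⟨ cong (_+_ (Q x + Q y)) (trans (*-assoc _ _ _) (cong (2# *_) (*-comm _ _))) ⟩
      Q x + Q y + 2# * ⟨ x , y ⟩ ∎
      where open ≡-Reasoning

    ⟨⟩-comm : ∀ x y → ⟨ x , y ⟩ ≡ ⟨ y , x ⟩
    ⟨⟩-comm x y = cong (_* 2# ⁻¹) (trans
      (cong (λ z → Q z - Q x - Q y) (⊕-comm x y))
      (solve 3 (λ s a b → (s :- a) :- b := (s :- b) :- a) refl (Q (y ⊕ x)) (Q x) (Q y)))

    ⟨⟩-linearˡ : ∀ y → IsLinear (λ x → ⟨ x , y ⟩)
    ⟨⟩-linearˡ y = record
      { homo-⊕ = λ x x′ → trans (cong (_* 2# ⁻¹) (polar-⊕ˡ x x′ y))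
          (solve 3 (λ a b i → (a :+ b) :* i := a :* i :+ b :* i) refl _ _ _)
      ; homo-· = λ a x → trans (cong (_* 2# ⁻¹) (polar-·ˡ a x y)) (*-assoc _ _ _)
      }

    ⟨⟩-linearʳ : ∀ x → IsLinear (λ y → ⟨ x , y ⟩)
    ⟨⟩-linearʳ x = record
      { homo-⊕ = λ y y′ → trans (⟨⟩-comm x (y ⊕ y′))
          (trans (L.homo-⊕ y y′) (cong₂ _+_ (⟨⟩-comm y x) (⟨⟩-comm y′ x)))
      ; homo-· = λ a y → trans (⟨⟩-comm x (a · y)) (trans (L.homo-· a y) (cong (a *_) (⟨⟩-comm y x)))
      }
      where module L = IsLinear (⟨⟩-linearˡ x)

    module ⟨⟩ˡ y = IsLinear (⟨⟩-linearˡ y)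
    module ⟨⟩ʳ x = IsLinear (⟨⟩-linearʳ x)

    Q-⊕· : ∀ x a y → Q (x ⊕ a · y) ≡ Q x + a * a * Q y + 2# * (a * ⟨ x , y ⟩)
    Q-⊕· x a y = trans (Q-⊕ x (a · y)) (cong₂ (λ s t → Q x + s + 2# * t) (homogeneous a y) (⟨⟩ʳ.homo-· x a y))

    ⟨x,x⟩≡Qx : ∀ x → ⟨ x , x ⟩ ≡ Q x
    ⟨x,x⟩≡Qx x = *-cancelˡ 2≢0 (begin
      2# * ⟨ x , x ⟩                              ≡⟨ solve 2 (λ a b → con (+ 2) :* b := (a :+ a :+ con (+ 2) :* b) :- (a :+ a)) refl (Q x) ⟨ x , x ⟩ ⟩
      (Q x + Q x + 2# * ⟨ x , x ⟩) - (Q x + Q x)  ≡⟨ cong (_- (Q x + Q x)) (Q-⊕ x x) ⟨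
      Q (x ⊕ x) - (Q x + Q x)                     ≡⟨ cong (λ z → Q z - (Q x + Q x)) (x⊕x≡2·x x) ⟩
      Q (2# · x) - (Q x + Q x)                    ≡⟨ cong (_- (Q x + Q x)) (homogeneous 2# x) ⟩
      2# * 2# * Q x - (Q x + Q x)                 ≡⟨ solve 1 (λ a → con (+ 2) :* con (+ 2) :* a :- (a :+ a) := con (+ 2) :* a) refl (Q x) ⟩
      2# * Q x                                    ∎)
      where open ≡-Reasoning

    isotropic-⊥ : ∀ {x y} → Q x ≡ 0# → Q y ≡ 0# → Q (x ⊕ y) ≡ 0# → ⟨ x , y ⟩ ≡ 0#
    isotropic-⊥ {x} {y} Qx≡0 Qy≡0 Qx⊕y≡0 = *≡0 2≢0 (begin
      2# * ⟨ x , y ⟩                       ≡⟨ solve 1 (λ a → a := con (+ 0) :+ con (+ 0) :+ a) refl _ ⟩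
      0# + 0# + 2# * ⟨ x , y ⟩             ≡⟨ cong₂ (λ a b → a + b + 2# * ⟨ x , y ⟩) Qx≡0 Qy≡0 ⟨
      Q x + Q y + 2# * ⟨ x , y ⟩           ≡⟨ Q-⊕ x y ⟨
      Q (x ⊕ y)                            ≡⟨ Qx⊕y≡0 ⟩
      0#                                   ∎)
      where open ≡-Reasoning

-- The expansion of (a - b)², with the cross term moved to the left so that it holds in ℕ.
dist²-expand : ∀ a b → dist a b ℕ.* dist a b ℕ.+ a ℕ.* (2 ℕ.* b) ≡ a ℕ.* a ℕ.+ b ℕ.* b
dist²-expand a b with ℕ.≤-total a b
... | inj₁ a≤b with c , refl ← ℕ.m≤n⇒∃[o]m+o≡n a≤b = trans
  (cong (λ k → k ℕ.* k ℕ.+ a ℕ.* (2 ℕ.* (a ℕ.+ c))) (ℕ.∣m-m+n∣≡n a c))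
  (solve 2 (λ a c → c :* c :+ a :* (con 2 :* (a :+ c)) := a :* a :+ (a :+ c) :* (a :+ c)) refl a c)
  where open ℕ.+-*-Solver
... | inj₂ b≤a with c , refl ← ℕ.m≤n⇒∃[o]m+o≡n b≤a = trans
  (cong (λ k → k ℕ.* k ℕ.+ (b ℕ.+ c) ℕ.* (2 ℕ.* b)) (trans (ℕ.∣-∣-comm (b ℕ.+ c) b) (ℕ.∣m-m+n∣≡n b c)))
  (solve 2 (λ b c → c :* c :+ (b :+ c) :* (con 2 :* b) := (b :+ c) :* (b :+ c) :+ b :* b) refl b c)
  where open ℕ.+-*-Solver

-- The hyperplane v^⊥ and the level sets of Q on it.

module IsotropicPairProperties {q : ℕ} (F : FiniteField q) (2≢0 : Geometry.2# F ≢ FiniteField.0# F)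
                               {m : ℕ} (I : IsotropicPair F (3 ℕ.+ m)) where

  open FiniteField F
  open Geometry F
  open FieldProperties F hiding (2≢0)
  open Vectors F
  open Counting
  open IsotropicPair I
  open FormProperties 2≢0 Q isQuadraticForm
  open IsQuadraticForm isQuadraticForm using (homogeneous)

  0<q : 0 ℕ.< q
  0<q = ℕ.<-trans (ℕ.s≤s ℕ.z≤n) 1<q

  ⟨v,v⟩≡0 : ⟨ v , v ⟩ ≡ 0#
  ⟨v,v⟩≡0 = trans (⟨x,x⟩≡Qx v) Qv≡0

  ⟨v,w⟩≡1 : ⟨ v , w ⟩ ≡ 1#
  ⟨v,w⟩≡1 = trans (⟨⟩-comm v w) ⟨w,v⟩≡1

  U? : Decidable (Mem (v ^⊥))
  U? = mem? (v ^⊥)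

  U-⊕· : ∀ {e} → e ∈ v ^⊥ → ∀ y u → y ∈ v ^⊥ → y ⊕ u · e ∈ v ^⊥
  U-⊕· {e} e∈U y u y∈U = trans (⟨⟩ˡ.homo-⊕· v y u e)
    (trans (cong₂ (λ a b → a + u * b) y∈U e∈U) (solve 1 (λ u → con (+ 0) :+ u :* con (+ 0) := con (+ 0)) refl u))

  U-· : ∀ a {y} → y ∈ v ^⊥ → a · y ∈ v ^⊥
  U-· a {y} y∈U = trans (⟨⟩ˡ.homo-· v a y) (trans (cong (a *_) y∈U) (zeroʳ a))

  U-projection : ∀ x → x ⊕ (- ⟨ x , v ⟩) · w ∈ v ^⊥
  U-projection x = trans (⟨⟩ˡ.homo-⊕· v x _ w) (trans (cong (λ b → ⟨ x , v ⟩ + (- ⟨ x , v ⟩) * b) ⟨w,v⟩≡1)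
    (solve 1 (λ a → a :+ (:- a) :* con (+ 1) := con (+ 0)) refl _))

  card-hyperplane : ∀ {P : Point (3 ℕ.+ m) → Set} {P? : Decidable P} z →
    (∀ x → P x → ⟨ x , v ⟩ ≡ z) → (∀ x → ⟨ x , v ⟩ ≡ z → P x) → card P? ≡ q ℕ.^ (2 ℕ.+ m)
  card-hyperplane {P? = P?} z to from = ℕ.*-cancelˡ-≡ _ _ q (begin
    q ℕ.* card P?                                            ≡⟨ cong (q ℕ.*_) (card-cong (λ x Px → tt , to x Px) (λ x (_ , eq) → from x eq)) ⟩
    q ℕ.* card (λ x → everything? x ×-dec ⟨ x , v ⟩ ≟ z)     ≡⟨ card-slice {P? = everything?} (⟨⟩-linearˡ v) w _ (λ eq → 1≢0 (trans (sym ⟨w,v⟩≡1) eq)) z ⟨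
    card {X = Point (3 ℕ.+ m)} everything?                                         ≡⟨ card-points (3 ℕ.+ m) ⟩
    q ℕ.^ (3 ℕ.+ m)                                          ∎)
    where open ≡-Reasoning

  card-U : card U? ≡ q ℕ.^ (2 ℕ.+ m)
  card-U = card-hyperplane 0# (λ _ → id) (λ _ → id)

  -- The line spanned by v is the radical of the form on `v ^⊥`: `U-⟨,⟩-axis` gives one inclusion
  -- and `axis-of-⊥U` the other.
  OnAxis : Point (3 ℕ.+ m) → Set
  OnAxis s = ∃ λ a → s ≡ a · v

  onAxis? : Decidable OnAxis
  onAxis? s = ∃? λ a → s ≟ a · v

  axis⇒U : ∀ {s} → OnAxis s → s ∈ v ^⊥
  axis⇒U (a , refl) = U-· a ⟨v,v⟩≡0

  U-⟨,⟩-axis : ∀ {y s} → y ∈ v ^⊥ → OnAxis s → ⟨ y , s ⟩ ≡ 0#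
  U-⟨,⟩-axis {y} y∈U (a , refl) = trans (⟨⟩ʳ.homo-· y a v) (trans (cong (a *_) y∈U) (zeroʳ a))

  Q-axis : ∀ {s} → OnAxis s → Q s ≡ 0#
  Q-axis (a , refl) = trans (homogeneous a v) (trans (cong (_*_ (a * a)) Qv≡0) (zeroʳ _))

  card-axis : card onAxis? ≡ q
  card-axis = trans (card-bijection {Q? = everything?} (λ s → ⟨ s , w ⟩) (_· v) _ (λ a _ → a , refl)
    (λ { _ (a , refl) → cong (_· v) (⟨a·v,w⟩≡a a) }) (λ a _ → ⟨a·v,w⟩≡a a)) card-field
    where
    ⟨a·v,w⟩≡a : ∀ a → ⟨ a · v , w ⟩ ≡ a
    ⟨a·v,w⟩≡a a = trans (⟨⟩ˡ.homo-· w a v) (trans (cong (a *_) ⟨v,w⟩≡1) (*-identityʳ a))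

  -- Pairing s - ⟨s,w⟩v with x is the same as pairing s with x - ⟨x,v⟩w, which lies in `v ^⊥`. Hence
  -- s - ⟨s,w⟩v is orthogonal to everything and nondegeneracy applies.
  axis-of-⊥U : ∀ s → (∀ p → p ∈ v ^⊥ → ⟨ p , s ⟩ ≡ 0#) → OnAxis s
  axis-of-⊥U s s⊥U = ⟨ s , w ⟩ , ⊖≡𝟎⇒≡ s (⟨ s , w ⟩ · v) (nondegenerate _ λ x → begin
    ⟨ s ⊖ ⟨ s , w ⟩ · v , x ⟩
      ≡⟨ trans (⟨⟩ˡ.homo-⊖ x s _) (cong (_-_ ⟨ s , x ⟩) (⟨⟩ˡ.homo-· x _ v)) ⟩
    ⟨ s , x ⟩ - ⟨ s , w ⟩ * ⟨ v , x ⟩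
      ≡⟨ cong₂ (λ a b → a - ⟨ s , w ⟩ * b) (⟨⟩-comm s x) (⟨⟩-comm v x) ⟩
    ⟨ x , s ⟩ - ⟨ s , w ⟩ * ⟨ x , v ⟩
      ≡⟨ solve 3 (λ a b c → a :- b :* c := a :+ (:- c) :* b) refl _ _ _ ⟩
    ⟨ x , s ⟩ + (- ⟨ x , v ⟩) * ⟨ s , w ⟩
      ≡⟨ cong (λ a → ⟨ x , s ⟩ + (- ⟨ x , v ⟩) * a) (⟨⟩-comm s w) ⟩
    ⟨ x , s ⟩ + (- ⟨ x , v ⟩) * ⟨ w , s ⟩
      ≡⟨ ⟨⟩ˡ.homo-⊕· s x _ w ⟨
    ⟨ x ⊕ (- ⟨ x , v ⟩) · w , s ⟩
      ≡⟨ s⊥U _ (U-projection x) ⟩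
    0# ∎)
    where
    open ≡-Reasoning

  card-U-slice : ∀ {ℓ} → IsLinear ℓ → ∀ {e} → e ∈ v ^⊥ → ℓ e ≢ 0# → ∀ β →
                 card (λ y → U? y ×-dec ℓ y ≟ β) ≡ q ℕ.^ (1 ℕ.+ m)
  card-U-slice ℓ-linear {e} e∈U ℓe≢0 β =
    ℕ.*-cancelˡ-≡ _ _ q (trans (sym (card-slice ℓ-linear e (U-⊕· e∈U) ℓe≢0 β)) card-U)

  -- Only vectors of the axis are orthogonal to all of `v ^⊥`, so off the axis the functional ⟨·,s⟩
  -- is nonzero on `v ^⊥` and slices it evenly.
  card-orthogonal-slice : ∀ s → ¬ OnAxis s → ∀ β →
                          card (λ y → U? y ×-dec ⟨ y , s ⟩ ≟ β) ≡ q ℕ.^ (1 ℕ.+ m)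
  card-orthogonal-slice s s∉axis β with ∃? (λ p → U? p ×-dec ¬? (⟨ p , s ⟩ ≟ 0#))
  ... | yes (e , e∈U , ⟨e,s⟩≢0) = card-U-slice (⟨⟩-linearˡ s) e∈U ⟨e,s⟩≢0 β
  ... | no ¬∃ = contradiction
    (axis-of-⊥U s (λ p p∈U → decidable-stable (⟨ p , s ⟩ ≟ 0#) (λ ≢0 → ¬∃ (p , p∈U , ≢0)))) s∉axis

  level? : ∀ r → Decidable (λ y → y ∈ v ^⊥ × Q y ≡ r)
  level? r y = U? y ×-dec Q y ≟ r

  level : Carrier → ℕ
  level r = card (level? r)

  level-scale : ∀ {a} → a ≢ 0# → ∀ r → level (a * a * r) ≡ level r
  level-scale {a} a≢0 r = card-bijection (a ⁻¹ ·_) (a ·_)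
    (λ y (y∈U , Qy≡) → U-· _ y∈U , (begin
      Q (a ⁻¹ · y)                       ≡⟨ homogeneous (a ⁻¹) y ⟩
      a ⁻¹ * a ⁻¹ * Q y                  ≡⟨ cong (a ⁻¹ * a ⁻¹ *_) Qy≡ ⟩
      a ⁻¹ * a ⁻¹ * (a * a * r)          ≡⟨ solve 3 (λ i a r → i :* i :* (a :* a :* r) := (i :* a) :* (i :* a) :* r) refl (a ⁻¹) a r ⟩
      (a ⁻¹ * a) * (a ⁻¹ * a) * r        ≡⟨ cong (λ k → k * k * r) (*-inverseˡ a≢0) ⟩
      1# * 1# * r                        ≡⟨ solve 1 (λ r → con (+ 1) :* con (+ 1) :* r := r) refl r ⟩
      r                                  ∎))
    (λ y (y∈U , Qy≡r) → U-· _ y∈U , trans (homogeneous a y) (cong (a * a *_) Qy≡r))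
    (λ y _ → trans (·-assoc a (a ⁻¹) y) (trans (cong (_· y) (*-inverseʳ a≢0)) (1· y)))
    (λ y _ → trans (·-assoc (a ⁻¹) a y) (trans (cong (_· y) (*-inverseˡ a≢0)) (1· y)))
    where open ≡-Reasoning

  -- The mean of `level` over the q values of Q, because `v ^⊥` has qM points.
  M : ℕ
  M = q ℕ.^ (1 ℕ.+ m)

  sum-level : sum level ≡ q ℕ.* M
  sum-level = trans (sym (card-fibres {P? = U?} Q)) card-U

  Q-translate-≡ : ∀ y s → Q (y ⊕ s) ≡ Q y → ⟨ y , s ⟩ ≡ 2# ⁻¹ * (- Q s)
  Q-translate-≡ y s eq = *-cancelˡ 2≢0 (begin
    2# * ⟨ y , s ⟩                                 ≡⟨ solve 3 (λ a b c → c := (a :+ b :+ c) :- a :- b) refl (Q y) (Q s) _ ⟩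
    (Q y + Q s + 2# * ⟨ y , s ⟩) - Q y - Q s       ≡⟨ cong (λ k → k - Q y - Q s) (Q-⊕ y s) ⟨
    Q (y ⊕ s) - Q y - Q s                          ≡⟨ cong (λ k → k - Q y - Q s) eq ⟩
    Q y - Q y - Q s                                ≡⟨ solve 2 (λ a b → a :- a :- b := con (+ 1) :* (:- b)) refl (Q y) (Q s) ⟩
    1# * (- Q s)                                   ≡⟨ cong (_* (- Q s)) (*-inverseʳ 2≢0) ⟨
    2# * 2# ⁻¹ * (- Q s)                           ≡⟨ *-assoc _ _ _ ⟩
    2# * (2# ⁻¹ * (- Q s))                         ∎)
    where open ≡-Reasoning

  -- Substituting y′ = y + s turns Q(y) = Q(y′) into a linear condition on y, for each s.
  sum-level² : sum (λ r → level r ℕ.* level r) ℕ.≤ q ℕ.* M ℕ.* M ℕ.+ q ℕ.* (q ℕ.* M)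
  sum-level² = begin
    sum (λ r → level r ℕ.* level r)
      ≡⟨ sum-fibres Q level ⟨
    sum (λ y → ⟦ U? y ⟧ ℕ.* level (Q y))
      ≡⟨ sum-cong (λ y → cong (⟦ U? y ⟧ ℕ.*_) (trans (translate y) card≡sum)) ⟩
    sum (λ y → ⟦ U? y ⟧ ℕ.* sum (λ s → ⟦ level? (Q y) (y ⊕ s) ⟧))
      ≡⟨ sum-cong (λ y → trans (ℕ.*-comm ⟦ U? y ⟧ _) (sym (sum-* _ ⟦ U? y ⟧))) ⟩
    sum (λ y → sum (λ s → ⟦ level? (Q y) (y ⊕ s) ⟧ ℕ.* ⟦ U? y ⟧))
      ≡⟨ sum-swap _ ⟩
    sum (λ s → sum (λ y → ⟦ level? (Q y) (y ⊕ s) ⟧ ℕ.* ⟦ U? y ⟧))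
      ≡⟨ sum-cong (λ s → trans (sum-cong (λ y → sym (⟦⟧-× (level? (Q y) (y ⊕ s)) (U? y)))) (sym card≡sum)) ⟩
    sum pairs
      ≤⟨ sum-mono bound ⟩
    sum (λ s → ⟦ U? s ⟧ ℕ.* M ℕ.+ ⟦ onAxis? s ⟧ ℕ.* (q ℕ.* M))
      ≡⟨ sum-+ _ _ ⟩
    sum (λ s → ⟦ U? s ⟧ ℕ.* M) ℕ.+ sum (λ s → ⟦ onAxis? s ⟧ ℕ.* (q ℕ.* M))
      ≡⟨ cong₂ ℕ._+_ (sum-indicator M) (sum-indicator (q ℕ.* M)) ⟩
    card U? ℕ.* M ℕ.+ card onAxis? ℕ.* (q ℕ.* M)
      ≡⟨ cong₂ (λ a b → a ℕ.* M ℕ.+ b ℕ.* (q ℕ.* M)) card-U card-axis ⟩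
    q ℕ.* M ℕ.* M ℕ.+ q ℕ.* (q ℕ.* M) ∎
    where
    open ℕ.≤-Reasoning
    y⊕s⊖y : ∀ y s → (y ⊕ s) ⊖ y ≡ s
    y⊕s⊖y y s = trans (cong (_⊖ y) (⊕-comm y s)) (⊕-⊖ s y)
    y⊕[y′⊖y] : ∀ y y′ → y ⊕ (y′ ⊖ y) ≡ y′
    y⊕[y′⊖y] y y′ = trans (⊕-comm y _) (⊖-⊕ y′ y)
    translate : ∀ y → level (Q y) ≡ card (λ s → level? (Q y) (y ⊕ s))
    translate y = card-bijection (_⊖ y) (y ⊕_)
      (λ y′ → subst (λ x → x ∈ v ^⊥ × Q x ≡ Q y) (sym (y⊕[y′⊖y] y y′))) (λ _ → id)
      (λ y′ _ → y⊕[y′⊖y] y y′) (λ s _ → y⊕s⊖y y s)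
    pairs : Point (3 ℕ.+ m) → ℕ
    pairs s = card (λ y → level? (Q y) (y ⊕ s) ×-dec U? y)
    s∈U : ∀ {y s} → y ⊕ s ∈ v ^⊥ → y ∈ v ^⊥ → s ∈ v ^⊥
    s∈U {y} {s} y⊕s∈U y∈U = trans (cong (λ x → ⟨ x , v ⟩) (sym (y⊕s⊖y y s)))
      (trans (⟨⟩ˡ.homo-⊖ v (y ⊕ s) y) (trans (cong₂ _-_ y⊕s∈U y∈U) (-‿inverseʳ 0#)))
    -- Off the axis the linear condition on y is nontrivial and has M solutions in `v ^⊥`. On the
    -- axis it can be vacuous; the trivial bound qM suffices there, as the axis has only q points.
    bound : ∀ s → pairs s ℕ.≤ ⟦ U? s ⟧ ℕ.* M ℕ.+ ⟦ onAxis? s ⟧ ℕ.* (q ℕ.* M)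
    bound s with U? s | onAxis? s
    ... | no s∉U  | _ =
      ℕ.≤-trans (ℕ.≤-reflexive (card-none λ y ((y⊕s∈U , _) , y∈U) → s∉U (s∈U y⊕s∈U y∈U))) ℕ.z≤n
    ... | yes s∈U | no s∉axis = begin
      pairs s                                              ≤⟨ card-mono (λ y ((_ , eq) , y∈U) → y∈U , Q-translate-≡ y s eq) ⟩
      card (λ y → U? y ×-dec ⟨ y , s ⟩ ≟ 2# ⁻¹ * (- Q s))  ≡⟨ card-orthogonal-slice s s∉axis _ ⟩
      M                                                    ≤⟨ ≤⟦⟧* s∈U M ⟩
      ⟦ yes s∈U ⟧ ℕ.* M                                    ≤⟨ ℕ.m≤m+n _ _ ⟩
      _                                                    ∎
    ... | yes _ | yes s∈axis = begin
      pairs s                                              ≤⟨ card-mono (λ y (_ , y∈U) → y∈U) ⟩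
      card U?                                              ≡⟨ card-U ⟩
      q ℕ.* M                                              ≤⟨ ≤⟦⟧* s∈axis (q ℕ.* M) ⟩
      ⟦ yes s∈axis ⟧ ℕ.* (q ℕ.* M)                         ≤⟨ ℕ.m≤n+m _ _ ⟩
      _                                                    ∎

  deviation² : Carrier → ℕ
  deviation² r = dist (level r) M ℕ.* dist (level r) M

  -- The variance is the second moment minus the square of the mean: the cross term 2qM² cancels
  -- both the main term of `sum-level²` and the sum of the M², leaving the contribution of the axis.
  sum-deviation² : sum deviation² ℕ.≤ q ℕ.* q ℕ.* M
  sum-deviation² = ℕ.+-cancelʳ-≤ (q ℕ.* M ℕ.* (2 ℕ.* M)) _ _ (begin
    sum deviation² ℕ.+ q ℕ.* M ℕ.* (2 ℕ.* M)
      ≡⟨ cong (λ k → sum deviation² ℕ.+ k ℕ.* (2 ℕ.* M)) sum-level ⟨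
    sum deviation² ℕ.+ sum level ℕ.* (2 ℕ.* M)
      ≡⟨ cong (sum deviation² ℕ.+_) (sum-* level (2 ℕ.* M)) ⟨
    sum deviation² ℕ.+ sum (λ r → level r ℕ.* (2 ℕ.* M))
      ≡⟨ sum-+ _ _ ⟨
    sum (λ r → deviation² r ℕ.+ level r ℕ.* (2 ℕ.* M))
      ≡⟨ sum-cong (λ r → dist²-expand (level r) M) ⟩
    sum (λ r → level r ℕ.* level r ℕ.+ M ℕ.* M)
      ≡⟨ sum-+ _ _ ⟩
    sum (λ r → level r ℕ.* level r) ℕ.+ sum (λ _ → M ℕ.* M)
      ≤⟨ ℕ.+-mono-≤ sum-level² (ℕ.≤-reflexive (trans
           (sum-on {P? = everything?} (M ℕ.* M) (λ _ _ → refl) (λ _ ¬⊤ → contradiction tt ¬⊤))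
           (cong (ℕ._* (M ℕ.* M)) card-field))) ⟩
    q ℕ.* M ℕ.* M ℕ.+ q ℕ.* (q ℕ.* M) ℕ.+ q ℕ.* (M ℕ.* M)
      ≡⟨ ℕSolver.solve 2 (λ q M → q :*ℕ M :*ℕ M :+ℕ q :*ℕ (q :*ℕ M) :+ℕ q :*ℕ (M :*ℕ M)
           :=ℕ q :*ℕ q :*ℕ M :+ℕ q :*ℕ M :*ℕ (ℕSolver.con 2 :*ℕ M)) refl q M ⟩
    q ℕ.* q ℕ.* M ℕ.+ q ℕ.* M ℕ.* (2 ℕ.* M) ∎)
    where
    open ℕ.≤-Reasoning
    module ℕSolver = ℕ.+-*-Solver
    open ℕSolver using () renaming (_:*_ to _:*ℕ_; _:+_ to _:+ℕ_; _:=_ to _:=ℕ_)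

  card-nonzero : suc (card {X = Carrier} (λ a → ¬? (a ≟ 0#))) ≡ q
  card-nonzero = trans (cong (ℕ._+ card {X = Carrier} (λ a → ¬? (a ≟ 0#))) (sym (card-one {P? = _≟ 0#} 0# refl (λ _ → id))))
    (trans (sym (card-complement (_≟ 0#))) card-field)

  square-roots : ∀ {R} → R ≢ 0# → ∀ r → card (λ a → ¬? (a ≟ 0#) ×-dec a * a * R ≟ r) ℕ.≤ 2
  square-roots {R} R≢0 r = ℕ.≤-trans (card-mono (λ a (_ , eq) → trans
    (solve 3 (λ R a r → R :* (a :* a) :+ con (+ 0) :* a :+ :- r := a :* a :* R :- r) refl R a r)
    (trans (cong (_- r) eq) (-‿inverseʳ r)))) (quadratic-roots R 0# (- r) R≢0)

  -- The level sets of the q − 1 values a²R have the same size, and each value occurs at most twice.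
  level-estimate : ∀ {R} → R ≢ 0# → deviation² R ℕ.≤ 4 ℕ.* q ℕ.* M
  level-estimate {R} R≢0 = cancel (card {X = Carrier} (λ a → ¬? (a ≟ 0#))) card-nonzero (begin
    card (λ a → ¬? (a ≟ 0#)) ℕ.* deviation² R
      ≡⟨ sum-indicator {P? = λ a → ¬? (a ≟ 0#)} (deviation² R) ⟨
    sum (λ a → ⟦ ¬? (a ≟ 0#) ⟧ ℕ.* deviation² R)
      ≡⟨ sum-cong scaled ⟩
    sum (λ a → ⟦ ¬? (a ≟ 0#) ⟧ ℕ.* deviation² (a * a * R))
      ≡⟨ sum-fibres (λ a → a * a * R) deviation² ⟩
    sum (λ r → card (λ a → ¬? (a ≟ 0#) ×-dec a * a * R ≟ r) ℕ.* deviation² r)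
      ≤⟨ sum-mono (λ r → ℕ.*-monoˡ-≤ (deviation² r) (square-roots R≢0 r)) ⟩
    sum (λ r → 2 ℕ.* deviation² r)
      ≡⟨ trans (sum-cong (λ r → ℕ.*-comm 2 (deviation² r))) (sum-* deviation² 2) ⟩
    sum deviation² ℕ.* 2
      ≤⟨ ℕ.*-monoˡ-≤ 2 sum-deviation² ⟩
    q ℕ.* q ℕ.* M ℕ.* 2 ∎)
    where
    open ℕ.≤-Reasoning
    scaled : ∀ a → ⟦ ¬? (a ≟ 0#) ⟧ ℕ.* deviation² R ≡ ⟦ ¬? (a ≟ 0#) ⟧ ℕ.* deviation² (a * a * R)
    scaled a with ¬? (a ≟ 0#)
    ... | yes a≢0 = cong (λ k → ⟦ yes a≢0 ⟧ ℕ.* (dist k M ℕ.* dist k M)) (sym (level-scale a≢0 R))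
    ... | no ¬a≢0 = trans (cong (ℕ._* _) (⟦⟧-no {p? = no ¬a≢0} ¬a≢0))
                          (sym (cong (ℕ._* _) (⟦⟧-no {p? = no ¬a≢0} ¬a≢0)))
    -- Here k = q - 1. As q ≤ 2k, the right side 2q²M is at most k · 4qM, and k cancels; this is the
    -- origin of the constant 4.
    cancel : ∀ k → suc k ≡ q → k ℕ.* deviation² R ℕ.≤ q ℕ.* q ℕ.* M ℕ.* 2 →
             deviation² R ℕ.≤ 4 ℕ.* q ℕ.* M
    cancel zero    1≡q   _  = contradiction 1<q (ℕ.≤⇒≯ (ℕ.≤-reflexive (sym 1≡q)))
    cancel k@(suc j) 1+k≡q le = ℕ.*-cancelˡ-≤ k (begin
      k ℕ.* deviation² R             ≤⟨ le ⟩
      q ℕ.* q ℕ.* M ℕ.* 2            ≤⟨ ℕ.*-monoˡ-≤ 2 (ℕ.*-monoˡ-≤ M (ℕ.*-monoˡ-≤ q q≤2k)) ⟩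
      (2 ℕ.* k) ℕ.* q ℕ.* M ℕ.* 2    ≡⟨ S.solve 3 (λ k q M → (S.con 2 S.:* k) S.:* q S.:* M S.:* S.con 2
                                          S.:= k S.:* (S.con 4 S.:* q S.:* M)) refl k q M ⟩
      k ℕ.* (4 ℕ.* q ℕ.* M)          ∎)
      where
      module S = ℕ.+-*-Solver
      q≤2k : q ℕ.≤ 2 ℕ.* k
      q≤2k = subst (ℕ._≤ 2 ℕ.* k) 1+k≡q
        (ℕ.≤-trans (ℕ.+-monoˡ-≤ k (ℕ.s≤s (ℕ.z≤n {j}))) (ℕ.≤-reflexive (cong (k ℕ.+_) (sym (ℕ.+-identityʳ k)))))

-- Natural numbers and their quotients in ℚ.

module Fractions where

  toℚᵘ-/ : ∀ a n → ℚ.toℚᵘ (+ a ℚ./ suc n) ℚᵘ.≃ ℚᵘ.mkℚᵘ (+ a) n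
  toℚᵘ-/ a n = ℚ.toℚᵘ-fromℚᵘ (ℚᵘ.mkℚᵘ (+ a) n)

  fromℕ-+ : ∀ a b → fromℕ (a ℕ.+ b) ≡ fromℕ a ℚ.+ fromℕ b
  fromℕ-+ a b = ℚ.toℚᵘ-injective (ℚᵘ.≃-trans (toℚᵘ-/ (a ℕ.+ b) 0)
    (ℚᵘ.≃-trans (ℚᵘ.*≡* (cong (ℤ._* + 1) (trans (ℤ.pos-+ a b)
        (sym (cong₂ ℤ._+_ (ℤ.*-identityʳ (+ a)) (ℤ.*-identityʳ (+ b)))))))
      (ℚᵘ.≃-sym (ℚᵘ.≃-trans (ℚ.toℚᵘ-homo-+ (fromℕ a) (fromℕ b))
        (ℚᵘ.+-cong (toℚᵘ-/ a 0) (toℚᵘ-/ b 0))))))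

  fromℕ-* : ∀ a b → fromℕ (a ℕ.* b) ≡ fromℕ a ℚ.* fromℕ b
  fromℕ-* a b = ℚ.toℚᵘ-injective (ℚᵘ.≃-trans (toℚᵘ-/ (a ℕ.* b) 0)
    (ℚᵘ.≃-trans (ℚᵘ.*≡* (cong (ℤ._* + 1) (ℤ.pos-* a b)))
      (ℚᵘ.≃-sym (ℚᵘ.≃-trans (ℚ.toℚᵘ-homo-* (fromℕ a) (fromℕ b))
        (ℚᵘ.*-cong (toℚᵘ-/ a 0) (toℚᵘ-/ b 0))))))

  /-*-cancel : ∀ a n .{{_ : NonZero n}} → (+ a ℚ./ n) ℚ.* fromℕ n ≡ fromℕ a
  /-*-cancel a (suc n) = ℚ.toℚᵘ-injective (ℚᵘ.≃-trans
    (ℚᵘ.≃-trans (ℚ.toℚᵘ-homo-* (+ a ℚ./ suc n) (fromℕ (suc n)))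
      (ℚᵘ.*-cong (toℚᵘ-/ a n) (toℚᵘ-/ (suc n) 0)))
    (ℚᵘ.≃-trans (ℚᵘ.*≡* (trans (ℤ.*-identityʳ _)
        (cong (λ k → + a ℤ.* + suc k) (sym (ℕ.*-identityʳ n)))))
      (ℚᵘ.≃-sym (toℚᵘ-/ a 0))))

  fromℕ-mono-≤ : ∀ {a b} → a ℕ.≤ b → fromℕ a ℚ.≤ fromℕ b
  fromℕ-mono-≤ {a} {b} a≤b = ℚ.toℚᵘ-cancel-≤
    (ℚᵘ.≤-respˡ-≃ (ℚᵘ.≃-sym (toℚᵘ-/ a 0)) (ℚᵘ.≤-respʳ-≃ {ℚᵘ.mkℚᵘ (+ a) 0} (ℚᵘ.≃-sym (toℚᵘ-/ b 0))
      (ℚᵘ.*≤* (ℤ.*-monoʳ-≤-nonNeg (+ 1) (ℤ.+≤+ a≤b)))))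

  fromℕ-positive : ∀ n .{{_ : NonZero n}} → ℚ.Positive (fromℕ n)
  fromℕ-positive (suc n) = ℚ.positive (ℚ.<-≤-trans (ℚ.positive⁻¹ 1ℚ) (fromℕ-mono-≤ (ℕ.s≤s (ℕ.z≤n {n}))))

  *-cancelʳ-fromℕ : ∀ n .{{_ : NonZero n}} {p q} → p ℚ.* fromℕ n ≡ q ℚ.* fromℕ n → p ≡ q
  *-cancelʳ-fromℕ n eq = ℚ.≤-antisym
    (ℚ.*-cancelʳ-≤-pos (fromℕ n) {{fromℕ-positive n}} (ℚ.≤-reflexive eq))
    (ℚ.*-cancelʳ-≤-pos (fromℕ n) {{fromℕ-positive n}} (ℚ.≤-reflexive (sym eq)))

  n/1-cancel : ∀ a n .{{_ : NonZero n}} → + (a ℕ.* n) ℚ./ n ≡ fromℕ a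
  n/1-cancel a n = *-cancelʳ-fromℕ n (trans (/-*-cancel (a ℕ.* n) n) (fromℕ-* a n))

  /-≤ : ∀ {a b c} m n .{{_ : NonZero m}} .{{_ : NonZero n}} → a ℕ.* n ℕ.≤ c ℕ.* b ℕ.* m →
        + a ℚ./ m ℚ.≤ fromℕ c ℚ.* (+ b ℚ./ n)
  /-≤ {a} {b} {c} m n le =
    ℚ.*-cancelʳ-≤-pos (fromℕ m) {{fromℕ-positive m}} (ℚ.*-cancelʳ-≤-pos (fromℕ n) {{fromℕ-positive n}}
      (begin
        + a ℚ./ m ℚ.* fromℕ m ℚ.* fromℕ n                 ≡⟨ cong (ℚ._* fromℕ n) (/-*-cancel a m) ⟩
        fromℕ a ℚ.* fromℕ n                               ≡⟨ fromℕ-* a n ⟨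
        fromℕ (a ℕ.* n)                                   ≤⟨ fromℕ-mono-≤ le ⟩
        fromℕ (c ℕ.* b ℕ.* m)                             ≡⟨ trans (fromℕ-* (c ℕ.* b) m) (cong (ℚ._* fromℕ m) (fromℕ-* c b)) ⟩
        fromℕ c ℚ.* fromℕ b ℚ.* fromℕ m                   ≡⟨ cong (λ k → fromℕ c ℚ.* k ℚ.* fromℕ m) (/-*-cancel b n) ⟨
        fromℕ c ℚ.* (+ b ℚ./ n ℚ.* fromℕ n) ℚ.* fromℕ m   ≡⟨ solve 4 (λ c f n m → c :* (f :* n) :* m := c :* f :* m :* n) refl
                                                               (fromℕ c) (+ b ℚ./ n) (fromℕ n) (fromℕ m) ⟩
        fromℕ c ℚ.* (+ b ℚ./ n) ℚ.* fromℕ m ℚ.* fromℕ n   ∎))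
    where
    open ℚ.≤-Reasoning
    open +-*-Solver

  fromℕ-∸1 : ∀ n → .{{_ : NonZero n}} → fromℕ (n ℕ.∸ 1) ≡ fromℕ n ℚ.- 1ℚ
  fromℕ-∸1 (suc n) = trans (solve 1 (λ x → x := con 1ℚ :+ x :- con 1ℚ) refl (fromℕ n))
    (cong (ℚ._- 1ℚ) (sym (fromℕ-+ 1 n)))
    where open +-*-Solver

∑-const : {X : Set} {{_ : Finite X}} (A : Subset X) {f : X → ℚ} {c : ℚ} → (∀ x → x ∈ A → f x ≡ c) →
          ∑ A f ≡ fromℕ ∣ A ∣ ℚ.* c
∑-const A {f} {c} f≡c = go elements
  where
  go : ∀ xs → List.foldr ℚ._+_ 0ℚ (List.map f (List.filter (mem? A) xs))
            ≡ fromℕ (List.length (List.filter (mem? A) xs)) ℚ.* c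
  go []       = sym (ℚ.*-zeroˡ c)
  go (x ∷ xs) with mem? A x
  ... | no _    = go xs
  ... | yes x∈A = trans (cong₂ ℚ._+_ (f≡c x x∈A) (go xs))
    (trans (solve 2 (λ c k → c :+ k :* c := (con 1ℚ :+ k) :* c) refl c (fromℕ k))
      (cong (ℚ._* c) (sym (Fractions.fromℕ-+ 1 k))))
    where
    open +-*-Solver
    k = List.length (List.filter (mem? A) xs)

-- Discrepancy of point sets of constant degree.

module Incidences {q : ℕ} (F : FiniteField q) {d} (Q : Geometry.Point F d → FiniteField.Carrier F) where

  open FiniteField F
  open Geometry F
  open Form Q
  open Counting
  open Fractions

  card-incidences : ∀ A 𝒯 k → (∀ p → p ∈ A → degree 𝒯 p ≡ k) → ∣ incidences A 𝒯 ∣ ≡ ∣ A ∣ ℕ.* k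
  card-incidences A 𝒯 k regular = trans (∣∣≡card (incidences A 𝒯)) (trans
    (card-fibres-≡ {Q? = mem? A} proj₁ k (λ _ → proj₁) (λ p p∈A → trans
      (card-bijection proj₂ (p ,_) (λ { _ ((_ , S∈𝒯 , p∈S) , refl) → S∈𝒯 , p∈S })
        (λ S (S∈𝒯 , p∈S) → (p∈A , S∈𝒯 , p∈S) , refl) (λ { _ (_ , refl) → refl }) (λ _ _ → refl))
      (trans (sym (∣∣≡card (spheresThrough 𝒯 p))) (regular p p∈A))))
    (cong (ℕ._* k) (sym (∣∣≡card A))))

  -- There are |A|k incidences, and |𝒯| = sq makes the expected number the integer |A|s. Every
  -- discrepancy of the block construction is an instance: k = q and s = 1, k = s = 1, or k = q + t
  -- - 1 and s = t.
  σ-regular : ∀ A 𝒯 s k → ∣ 𝒯 ∣ ≡ s ℕ.* q → (∀ p → p ∈ A → degree 𝒯 p ≡ k) →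
              σ A 𝒯 ≡ fromℕ ∣ A ∣ ℚ.* (fromℕ k ℚ.- fromℕ s)
  σ-regular A 𝒯 s k ∣𝒯∣≡sq regular = begin
    σ A 𝒯
      ≡⟨ cong₂ (λ i n → fromℕ i ℚ.- + n ℚ./ q) (card-incidences A 𝒯 k regular)
           (trans (cong (∣ A ∣ ℕ.*_) ∣𝒯∣≡sq) (sym (ℕ.*-assoc ∣ A ∣ s q))) ⟩
    fromℕ (∣ A ∣ ℕ.* k) ℚ.- + (∣ A ∣ ℕ.* s ℕ.* q) ℚ./ q
      ≡⟨ cong₂ ℚ._-_ (fromℕ-* ∣ A ∣ k) (trans (n/1-cancel (∣ A ∣ ℕ.* s) q) (fromℕ-* ∣ A ∣ s)) ⟩
    fromℕ ∣ A ∣ ℚ.* fromℕ k ℚ.- fromℕ ∣ A ∣ ℚ.* fromℕ s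
      ≡⟨ solve 3 (λ a k s → a :* k :- a :* s := a :* (k :- s)) refl (fromℕ ∣ A ∣) (fromℕ k) (fromℕ s) ⟩
    fromℕ ∣ A ∣ ℚ.* (fromℕ k ℚ.- fromℕ s) ∎
    where
    open ≡-Reasoning
    open +-*-Solver

-- The block construction: sizes, degrees, intersections, radical hyperplanes.

module BlockProperties {q : ℕ} (F : FiniteField q) (2≢0 : Geometry.2# F ≢ FiniteField.0# F)
                       {m : ℕ} (B : BlockConstruction F (3 ℕ.+ m)) where

  open FiniteField F
  open Geometry F
  open FieldProperties F hiding (2≢0)
  open Vectors F
  open Counting
  open Fractions
  open BlockConstruction B
  open FormProperties 2≢0 Q isQuadraticForm
  open IsotropicPairProperties F 2≢0 isotropicPair
  open Incidences F Q

  R≢0 : R ≢ 0#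
  R≢0 = proj₁ R-admissible

  instance
    N-nonZero : NonZero N
    N-nonZero = ∣∣-nonZero X (proj₂ R-admissible)

  N≡level : N ≡ level R
  N≡level = ∣∣≡card X

  ⟨centre,v⟩ : ∀ z → ⟨ centre z , v ⟩ ≡ z
  ⟨centre,v⟩ z = trans (⟨⟩ˡ.homo-· v z w) (trans (cong (z *_) ⟨w,v⟩≡1) (*-identityʳ z))

  ⟨⊖centre,v⟩ : ∀ x z → ⟨ x ⊖ centre z , v ⟩ ≡ ⟨ x , v ⟩ - z
  ⟨⊖centre,v⟩ x z = trans (⟨⟩ˡ.homo-⊖ v x (centre z)) (cong (_-_ ⟨ x , v ⟩) (⟨centre,v⟩ z))

  c⊕y⊖c : ∀ {d} (c y : Point d) → (c ⊕ y) ⊖ c ≡ y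
  c⊕y⊖c c y = trans (cong (_⊖ c) (⊕-comm c y)) (⊕-⊖ y c)

  c⊕[x⊖c] : ∀ {d} (c x : Point d) → c ⊕ (x ⊖ c) ≡ x
  c⊕[x⊖c] c x = trans (⊕-comm c (x ⊖ c)) (⊖-⊕ x c)

  A⇒X : ∀ {z x} → x ∈ A z → x ⊖ centre z ∈ X
  A⇒X {z} (y , y∈X , refl) = subst (_∈ X) (sym (c⊕y⊖c (centre z) y)) y∈X

  X⇒A : ∀ {z x} → x ⊖ centre z ∈ X → x ∈ A z
  X⇒A {z} {x} x⊖c∈X = x ⊖ centre z , x⊖c∈X , sym (c⊕[x⊖c] (centre z) x)

  -- The invariant that separates the blocks: they are the fibres of x ↦ ⟨x,v⟩ on `P`, which gives
  -- disjointness and lets counts over `P` be taken block by block. The centres of the spheres are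
  -- sorted in the same way.
  A⇒⟨,v⟩ : ∀ {z x} → x ∈ A z → ⟨ x , v ⟩ ≡ z
  A⇒⟨,v⟩ {z} {x} x∈A = x-y≡0⇒x≡y (trans (sym (⟨⊖centre,v⟩ x z)) (proj₁ (A⇒X x∈A)))

  card-A : ∀ z → card (mem? (A z)) ≡ N
  card-A z = trans (card-bijection (_⊖ centre z) (_⊕_ (centre z)) (λ _ → A⇒X) (λ y y∈X → y , y∈X , refl)
    (λ x _ → c⊕[x⊖c] (centre z) x) (λ y _ → c⊕y⊖c (centre z) y)) (sym (∣∣≡card X))

  ∣A∣≡N : ∀ z → ∣ A z ∣ ≡ N
  ∣A∣≡N z = trans (∣∣≡card (A z)) (card-A z)

  ∣P∣≡tN : ∣ P ∣ ≡ t ℕ.* N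
  ∣P∣≡tN = trans (∣∣≡card P) (trans
    (card-fibres-≡ {Q? = mem? Z} (λ x → ⟨ x , v ⟩) N
      (λ x (z , z∈Z , x∈A) → subst (_∈ Z) (sym (A⇒⟨,v⟩ x∈A)) z∈Z)
      (λ z z∈Z → trans (card-cong
        (λ x ((z′ , _ , x∈A) , eq) → subst (λ z → x ∈ A z) (trans (sym (A⇒⟨,v⟩ x∈A)) eq) x∈A)
        (λ x x∈A → (z , z∈Z , x∈A) , A⇒⟨,v⟩ x∈A)) (card-A z)))
    (cong (ℕ._* N) (sym (∣∣≡card Z))))

  ⟨c⊕u·v,v⟩ : ∀ z u → ⟨ centre z ⊕ u · v , v ⟩ ≡ z
  ⟨c⊕u·v,v⟩ z u = trans (⟨⟩ˡ.homo-⊕· v (centre z) u v) (trans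
    (cong₂ (λ a b → a + u * b) (⟨centre,v⟩ z) ⟨v,v⟩≡0)
    (solve 2 (λ z u → z :+ u :* con (+ 0) := z) refl z u))

  𝒮ᶻ⇒⟨,v⟩ : ∀ {z S} → S ∈ 𝒮ᶻ z → ⟨ centreOf S , v ⟩ ≡ z
  𝒮ᶻ⇒⟨,v⟩ {z} (u , refl) = ⟨c⊕u·v,v⟩ z u

  -- Recovers the parameter u of `sphere z u`, because ⟨v,w⟩ = 1; hence distinct u give distinct
  -- spheres.
  offset : Carrier → Sphere (3 ℕ.+ m) → Carrier
  offset z S = ⟨ centreOf S ⊖ centre z , w ⟩

  offset-sphere : ∀ z u → offset z (sphere z u) ≡ u
  offset-sphere z u = trans (cong (λ x → ⟨ x , w ⟩) (c⊕y⊖c (centre z) (u · v)))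
    (trans (⟨⟩ˡ.homo-· w u v) (trans (cong (u *_) ⟨v,w⟩≡1) (*-identityʳ u)))

  card-pencil : ∀ z {P : Sphere (3 ℕ.+ m) → Set} {P? : Decidable P} {Q : Carrier → Set} {Q? : Decidable Q} →
    (∀ S → P S → S ∈ 𝒮ᶻ z) → (∀ u → P (sphere z u) → Q u) → (∀ u → Q u → P (sphere z u)) → card P? ≡ card Q?
  card-pencil z {P} {Q = Q} P⇒𝒮ᶻ P⇒Q Q⇒P = card-bijection (offset z) (sphere z) to Q⇒P back
    (λ u _ → offset-sphere z u)
    where
    to : ∀ S → P S → Q (offset z S)
    to S PS with u , refl ← P⇒𝒮ᶻ S PS = subst Q (sym (offset-sphere z u)) (P⇒Q u PS)
    back : ∀ S → P S → sphere z (offset z S) ≡ S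
    back S PS with u , refl ← P⇒𝒮ᶻ S PS = cong (sphere z) (offset-sphere z u)

  card-𝒮ᶻ : ∀ z → card (mem? (𝒮ᶻ z)) ≡ q
  card-𝒮ᶻ z = trans (card-pencil z {Q? = everything?} (λ _ → id) _ (λ u _ → u , refl)) card-field

  ∣𝒮ᶻ∣≡q : ∀ z → ∣ 𝒮ᶻ z ∣ ≡ q
  ∣𝒮ᶻ∣≡q z = trans (∣∣≡card (𝒮ᶻ z)) (card-𝒮ᶻ z)

  𝒮-fibre : ∀ {S z} → S ∈ 𝒮 → ⟨ centreOf S , v ⟩ ≡ z → z ∈ Z × S ∈ 𝒮ᶻ z
  𝒮-fibre {S} (z′ , z′∈Z , S∈𝒮ᶻ) eq with refl ← trans (sym (𝒮ᶻ⇒⟨,v⟩ S∈𝒮ᶻ)) eq = z′∈Z , S∈𝒮ᶻ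

  ∣𝒮∣≡tq : ∣ 𝒮 ∣ ≡ t ℕ.* q
  ∣𝒮∣≡tq = trans (∣∣≡card 𝒮) (trans
    (card-fibres-≡ {Q? = mem? Z} (λ S → ⟨ centreOf S , v ⟩) q
      (λ S S∈𝒮 → proj₁ (𝒮-fibre S∈𝒮 refl))
      (λ z z∈Z → trans (card-cong
        (λ S (S∈𝒮 , eq) → proj₂ (𝒮-fibre S∈𝒮 eq))
        (λ S S∈𝒮ᶻ → (z , z∈Z , S∈𝒮ᶻ) , 𝒮ᶻ⇒⟨,v⟩ S∈𝒮ᶻ)) (card-𝒮ᶻ z)))
    (cong (ℕ._* q) (sym (∣∣≡card Z))))

  Q-sphere : ∀ x z u → Q (x ⊖ centreOf (sphere z u)) ≡ Q (x ⊖ centre z) - 2# * (u * (⟨ x , v ⟩ - z))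
  Q-sphere x z u = begin
    Q (x ⊖ (centre z ⊕ u · v))
      ≡⟨ cong Q (⊖-⊕· x (centre z) v u) ⟩
    Q ((x ⊖ centre z) ⊕ (- u) · v)
      ≡⟨ Q-⊕· (x ⊖ centre z) (- u) v ⟩
    Q (x ⊖ centre z) + (- u) * (- u) * Q v + 2# * ((- u) * ⟨ x ⊖ centre z , v ⟩)
      ≡⟨ cong₂ (λ a b → Q (x ⊖ centre z) + (- u) * (- u) * a + 2# * ((- u) * b)) Qv≡0 (⟨⊖centre,v⟩ x z) ⟩
    Q (x ⊖ centre z) + (- u) * (- u) * 0# + 2# * ((- u) * (⟨ x , v ⟩ - z))
      ≡⟨ solve 3 (λ a u b → a :+ (:- u) :* (:- u) :* con (+ 0) :+ con (+ 2) :* ((:- u) :* b)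
           := a :- con (+ 2) :* (u :* b)) refl (Q (x ⊖ centre z)) u (⟨ x , v ⟩ - z) ⟩
    Q (x ⊖ centre z) - 2# * (u * (⟨ x , v ⟩ - z)) ∎
    where open ≡-Reasoning

  A⇒∈sphere : ∀ {z x} → x ∈ A z → ∀ u → x ∈ points (sphere z u)
  A⇒∈sphere {z} {x} x∈A u = trans (Q-sphere x z u) (trans
    (cong₂ (λ a b → a - 2# * (u * (b - z))) (proj₂ (A⇒X x∈A)) (A⇒⟨,v⟩ x∈A))
    (solve 3 (λ r u z → r :- con (+ 2) :* (u :* (z :- z)) := r) refl R u z))

  degree-𝒮ᶻ-≡ : ∀ z x → x ∈ A z → degree (𝒮ᶻ z) x ≡ q
  degree-𝒮ᶻ-≡ z x x∈A = trans (∣∣≡card (spheresThrough (𝒮ᶻ z) x)) (trans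
    (card-pencil z {Q? = everything?} (λ _ → proj₁) _ (λ u _ → (u , refl) , A⇒∈sphere x∈A u)) card-field)

  degree-𝒮ᶻ-≢ : ∀ {b z} → b ≢ z → ∀ x → x ∈ A b → degree (𝒮ᶻ z) x ≡ 1
  degree-𝒮ᶻ-≢ {b} {z} b≢z x x∈A = trans (∣∣≡card (spheresThrough (𝒮ᶻ z) x)) (trans
    (card-pencil z {Q? = λ u → mem? (points (sphere z u)) x} (λ _ → proj₁) (λ _ → proj₂) (λ u x∈S → (u , refl) , x∈S))
    (card-one u₀ (trans (Q-sphere x z u₀) (trans (cong (λ k → Q (x ⊖ centre z) - 2# * (u₀ * k)) ⟨x,v⟩-z≡)
        (trans (cong (_-_ (Q (x ⊖ centre z))) lemma) (solve 2 (λ a r → a :- (a :- r) := r) refl _ R))))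
      (λ u x∈S → *-cancelˡ 2δ≢0 (trans (trans (solve 3 (λ u q r → r :* u := q :- (q :- r :* u)) refl u (Q (x ⊖ centre z)) (2# * δ))
         (cong (_-_ (Q (x ⊖ centre z))) (trans (trans (solve 4 (λ q t δ u → q :- t :* δ :* u := q :- t :* (u :* δ)) refl _ 2# δ u)
           (trans (cong (λ k → Q (x ⊖ centre z) - 2# * (u * k)) (sym ⟨x,v⟩-z≡)) (sym (Q-sphere x z u)))) x∈S)))
         (sym (trans (sym (*-assoc (2# * δ) _ _)) (trans (cong (_* (Q (x ⊖ centre z) - R)) (*-inverseʳ 2δ≢0)) (*-identityˡ _))))))))
    where
    δ = b - z
    2δ≢0 : 2# * δ ≢ 0#
    2δ≢0 = *-≢0 2≢0 (x≢y⇒x-y≢0 b≢z)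
    -- The unique solution u of the affine equation Q(x - c_z) - 2uδ = R, which expresses membership
    -- in `sphere z u`.
    u₀ = (2# * δ) ⁻¹ * (Q (x ⊖ centre z) - R)
    ⟨x,v⟩-z≡ : ⟨ x , v ⟩ - z ≡ δ
    ⟨x,v⟩-z≡ = cong (_- z) (A⇒⟨,v⟩ x∈A)
    lemma : 2# * (u₀ * δ) ≡ Q (x ⊖ centre z) - R
    lemma = trans (solve 4 (λ t δ i k → t :* (i :* k :* δ) := t :* δ :* i :* k) refl 2# δ ((2# * δ) ⁻¹) _)
      (trans (cong (_* (Q (x ⊖ centre z) - R)) (*-inverseʳ 2δ≢0)) (*-identityˡ _))

  degree-𝒮 : ∀ x → x ∈ P → degree 𝒮 x ≡ q ℕ.+ t ℕ.∸ 1
  degree-𝒮 x (b , b∈Z , x∈A) = begin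
    degree 𝒮 x
      ≡⟨ ∣∣≡card (spheresThrough 𝒮 x) ⟩
    card (mem? (spheresThrough 𝒮 x))
      ≡⟨ card-fibres (λ S → ⟨ centreOf S , v ⟩) ⟩
    sum (λ z → card (λ S → mem? (spheresThrough 𝒮 x) S ×-dec ⟨ centreOf S , v ⟩ ≟ z))
      ≡⟨ sum-cong fibre ⟩
    sum (λ z → ⟦ mem? Z z ⟧ ℕ.* 1 ℕ.+ ⟦ z ≟ b ⟧ ℕ.* (q ℕ.∸ 1))
      ≡⟨ sum-+ _ _ ⟩
    sum (λ z → ⟦ mem? Z z ⟧ ℕ.* 1) ℕ.+ sum (λ z → ⟦ z ≟ b ⟧ ℕ.* (q ℕ.∸ 1))
      ≡⟨ cong₂ ℕ._+_ (trans (sum-indicator 1) (trans (ℕ.*-identityʳ _) (sym (∣∣≡card Z))))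
           (trans (sum-indicator (q ℕ.∸ 1)) (trans (cong (ℕ._* (q ℕ.∸ 1)) (card-one b refl (λ _ → id))) (ℕ.*-identityˡ _))) ⟩
    t ℕ.+ (q ℕ.∸ 1)
      ≡⟨ ℕ.+-∸-assoc t 0<q ⟨
    t ℕ.+ q ℕ.∸ 1
      ≡⟨ cong (ℕ._∸ 1) (ℕ.+-comm t q) ⟩
    q ℕ.+ t ℕ.∸ 1 ∎
    where
    open ≡-Reasoning
    restrict : ∀ {z} → z ∈ Z → card (λ S → mem? (spheresThrough 𝒮 x) S ×-dec ⟨ centreOf S , v ⟩ ≟ z) ≡ degree (𝒮ᶻ z) x
    restrict {z} z∈Z = trans (card-cong
      (λ S ((S∈𝒮 , x∈S) , eq) → proj₂ (𝒮-fibre S∈𝒮 eq) , x∈S)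
      (λ S (S∈𝒮ᶻ , x∈S) → ((z , z∈Z , S∈𝒮ᶻ) , x∈S) , 𝒮ᶻ⇒⟨,v⟩ S∈𝒮ᶻ)) (sym (∣∣≡card (spheresThrough (𝒮ᶻ z) x)))
    -- Each z in Z contributes one sphere, and the block b of x another q - 1, so that the total is
    -- t + (q - 1).
    fibre : ∀ z → card (λ S → mem? (spheresThrough 𝒮 x) S ×-dec ⟨ centreOf S , v ⟩ ≟ z)
                ≡ ⟦ mem? Z z ⟧ ℕ.* 1 ℕ.+ ⟦ z ≟ b ⟧ ℕ.* (q ℕ.∸ 1)
    fibre z with mem? Z z | z ≟ b
    ... | yes z∈Z | yes refl = trans (restrict z∈Z) (trans (degree-𝒮ᶻ-≡ b x x∈A)
      (trans (sym (ℕ.m+[n∸m]≡n 0<q)) (sym (cong₂ ℕ._+_ (cong (ℕ._* 1) (⟦⟧-yes {p? = yes z∈Z} z∈Z))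
        (trans (cong (ℕ._* (q ℕ.∸ 1)) (⟦⟧-yes {p? = yes refl} refl)) (ℕ.*-identityˡ _))))))
    ... | yes z∈Z | no z≢b = trans (restrict z∈Z) (trans (degree-𝒮ᶻ-≢ (≢-sym z≢b) x x∈A)
      (sym (cong₂ (λ i j → i ℕ.* 1 ℕ.+ j ℕ.* (q ℕ.∸ 1)) (⟦⟧-yes {p? = yes z∈Z} z∈Z) (⟦⟧-no {p? = no z≢b} z≢b))))
    ... | no z∉Z | yes refl = contradiction b∈Z z∉Z
    ... | no z∉Z | no z≢b = trans (card-none (λ S ((S∈𝒮 , _) , eq) → z∉Z (proj₁ (𝒮-fibre S∈𝒮 eq))))
      (sym (cong₂ (λ i j → i ℕ.* 1 ℕ.+ j ℕ.* (q ℕ.∸ 1)) (⟦⟧-no {p? = no z∉Z} z∉Z) (⟦⟧-no {p? = no z≢b} z≢b)))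

  ∣𝒮ᶻ∣≡1*q : ∀ z → ∣ 𝒮ᶻ z ∣ ≡ 1 ℕ.* q
  ∣𝒮ᶻ∣≡1*q z = trans (∣𝒮ᶻ∣≡q z) (sym (ℕ.*-identityˡ q))

  σ-A-𝒮ᶻ-≡ : ∀ z → σ (A z) (𝒮ᶻ z) ≡ (fromℕ q ℚ.- 1ℚ) ℚ.* fromℕ N
  σ-A-𝒮ᶻ-≡ z = trans (σ-regular (A z) (𝒮ᶻ z) 1 q (∣𝒮ᶻ∣≡1*q z) (degree-𝒮ᶻ-≡ z))
    (trans (cong (λ n → fromℕ n ℚ.* (fromℕ q ℚ.- 1ℚ)) (∣A∣≡N z)) (ℚ.*-comm (fromℕ N) _))

  σ-A-𝒮ᶻ-≢ : ∀ {b z} → b ≢ z → σ (A b) (𝒮ᶻ z) ≡ 0ℚ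
  σ-A-𝒮ᶻ-≢ {b} {z} b≢z = trans (σ-regular (A b) (𝒮ᶻ z) 1 1 (∣𝒮ᶻ∣≡1*q z) (degree-𝒮ᶻ-≢ b≢z))
    (ℚ.*-zeroʳ (fromℕ ∣ A b ∣))

  σ-P-𝒮 : σ P 𝒮 ≡ fromℕ t ℚ.* (fromℕ q ℚ.- 1ℚ) ℚ.* fromℕ N
  σ-P-𝒮 = begin
    σ P 𝒮
      ≡⟨ σ-regular P 𝒮 t (q ℕ.+ t ℕ.∸ 1) ∣𝒮∣≡tq degree-𝒮 ⟩
    fromℕ ∣ P ∣ ℚ.* (fromℕ (q ℕ.+ t ℕ.∸ 1) ℚ.- fromℕ t)
      ≡⟨ cong₂ (λ n k → n ℚ.* (k ℚ.- fromℕ t)) (trans (cong fromℕ ∣P∣≡tN) (fromℕ-* t N))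
           (trans (fromℕ-∸1 (q ℕ.+ t) {{ℕ.>-nonZero (ℕ.≤-trans 0<q (ℕ.m≤m+n q t))}}) (cong (ℚ._- 1ℚ) (fromℕ-+ q t))) ⟩
    fromℕ t ℚ.* fromℕ N ℚ.* ((fromℕ q ℚ.+ fromℕ t ℚ.- 1ℚ) ℚ.- fromℕ t)
      ≡⟨ ℚSolver.solve 3 (λ t N q → t :*q N :*q ((q :+q t :-q ℚSolver.con 1ℚ) :-q t) :=q t :*q (q :-q ℚSolver.con 1ℚ) :*q N) refl
           (fromℕ t) (fromℕ N) (fromℕ q) ⟩
    fromℕ t ℚ.* (fromℕ q ℚ.- 1ℚ) ℚ.* fromℕ N ∎
    where
    open ≡-Reasoning
    module ℚSolver = +-*-Solver
    open ℚSolver using () renaming (_:*_ to _:*q_; _:+_ to _:+q_; _:-_ to _:-q_; _:=_ to _:=q_)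

  σ-P-𝒮-∑ : σ P 𝒮 ≡ ∑ Z (λ z → σ (A z) (𝒮ᶻ z))
  σ-P-𝒮-∑ = trans σ-P-𝒮 (trans (ℚ.*-assoc (fromℕ t) _ _) (sym (∑-const Z (λ z _ → σ-A-𝒮ᶻ-≡ z))))

  2-≢0 : ∀ {u u′} → u ≢ u′ → 2# * (u′ - u) ≢ 0#
  2-≢0 u≢u′ = *-≢0 2≢0 (x≢y⇒x-y≢0 (≢-sym u≢u′))

  sphere-∩ : ∀ z u u′ → u ≢ u′ → points (sphere z u) ∩ points (sphere z u′) ≐ A z
  sphere-∩ z u u′ u≢u′ = (λ {x} → to x) , λ x∈A → A⇒∈sphere x∈A u , A⇒∈sphere x∈A u′
    where
    to : ∀ x → x ∈ points (sphere z u) ∩ points (sphere z u′) → x ∈ A z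
    to x (x∈S , x∈S′) = X⇒A (trans (⟨⊖centre,v⟩ x z) δ≡0 , (begin
      Q (x ⊖ centre z)                                  ≡⟨ solve 2 (λ a u → a := a :- con (+ 2) :* (u :* con (+ 0))) refl _ u ⟩
      Q (x ⊖ centre z) - 2# * (u * 0#)                  ≡⟨ cong (λ k → Q (x ⊖ centre z) - 2# * (u * k)) δ≡0 ⟨
      Q (x ⊖ centre z) - 2# * (u * (⟨ x , v ⟩ - z))     ≡⟨ Q-sphere x z u ⟨
      Q (x ⊖ centreOf (sphere z u))                     ≡⟨ x∈S ⟩
      R                                                 ∎))
      where
      open ≡-Reasoning
      -- The difference of the two sphere equations is 2(u′ - u)(⟨x,v⟩ - z) = 0. Once the last
      -- factor vanishes, either equation says Q(x - c_z) = R.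
      δ≡0 : ⟨ x , v ⟩ - z ≡ 0#
      δ≡0 = *≡0 (2-≢0 u≢u′) (begin
        2# * (u′ - u) * (⟨ x , v ⟩ - z)
          ≡⟨ solve 4 (λ a u u′ k → con (+ 2) :* (u′ :- u) :* k := (a :- con (+ 2) :* (u :* k)) :- (a :- con (+ 2) :* (u′ :* k))) refl
               (Q (x ⊖ centre z)) u u′ (⟨ x , v ⟩ - z) ⟩
        (Q (x ⊖ centre z) - 2# * (u * (⟨ x , v ⟩ - z))) - (Q (x ⊖ centre z) - 2# * (u′ * (⟨ x , v ⟩ - z)))
          ≡⟨ cong₂ _-_ (trans (sym (Q-sphere x z u)) x∈S) (trans (sym (Q-sphere x z u′)) x∈S′) ⟩
        R - R
          ≡⟨ -‿inverseʳ R ⟩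
        0# ∎)

  centre-difference : ∀ z u u′ → centreOf (sphere z u′) ⊖ centreOf (sphere z u) ≡ (u′ - u) · v
  centre-difference z u u′ = ⊕·-⊖-⊕· (centre z) v u u′

  Q-centre : ∀ z u → Q (centreOf (sphere z u)) ≡ Q (centre z) + 2# * (u * z)
  Q-centre z u = trans (Q-⊕· (centre z) u v) (trans
    (cong₂ (λ a b → Q (centre z) + u * u * a + 2# * (u * b)) Qv≡0 (⟨centre,v⟩ z))
    (solve 3 (λ a u k → a :+ u :* u :* con (+ 0) :+ k := a :+ k) refl (Q (centre z)) u _))

  -- The radii cancel and both sides carry the factor 2(u′ - u): the left because the centres differ
  -- by (u′ - u)v, the right because Q(v) = 0 leaves Q of the centre affine in u.
  radical : ∀ z u u′ → u ≢ u′ → radicalHyperplane (sphere z u) (sphere z u′) ≐ H z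
  radical z u u′ u≢u′ =
    (λ {x} eq → *-cancelˡ (2-≢0 u≢u′) (trans (sym (lhs x)) (trans eq rhs))) ,
    (λ {x} ⟨x,v⟩≡z → trans (lhs x) (trans (cong (2# * (u′ - u) *_) ⟨x,v⟩≡z) (sym rhs)))
    where
    lhs : ∀ x → 2# * ⟨ centreOf (sphere z u′) ⊖ centreOf (sphere z u) , x ⟩ ≡ 2# * (u′ - u) * ⟨ x , v ⟩
    lhs x = trans (cong (λ c → 2# * ⟨ c , x ⟩) (centre-difference z u u′))
      (trans (cong (2# *_) (trans (⟨⟩ˡ.homo-· x _ v) (cong ((u′ - u) *_) (⟨⟩-comm v x)))) (sym (*-assoc 2# _ _)))
    rhs : (R - R) - Q (centreOf (sphere z u)) + Q (centreOf (sphere z u′)) ≡ 2# * (u′ - u) * z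
    rhs = trans (cong₂ (λ a b → (R - R) - a + b) (Q-centre z u) (Q-centre z u′))
      (solve 5 (λ r a u u′ z → (r :- r) :- (a :+ con (+ 2) :* (u :* z)) :+ (a :+ con (+ 2) :* (u′ :* z))
        := con (+ 2) :* (u′ :- u) :* z) refl R (Q (centre z)) u u′ z)

-- Affine sections of a level set in v^⊥.

module Sections {q : ℕ} (F : FiniteField q) (2≢0 : Geometry.2# F ≢ FiniteField.0# F)
                {m : ℕ} (I : IsotropicPair F (3 ℕ.+ m)) where

  open FiniteField F
  open Geometry F
  open FieldProperties F hiding (2≢0)
  open Vectors F
  open Counting
  open IsotropicPair I
  open FormProperties 2≢0 Q isQuadraticForm
  open IsotropicPairProperties F 2≢0 I

  -- The vector `f` certifies that ℓ is nonzero on `v ^⊥`, so the affine space of the section has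
  -- q^(1+m) points. The target 2q^m is two points for each of its q^m parallel lines.
  module _ {ℓ : Point (3 ℕ.+ m) → Carrier} (ℓ-linear : IsLinear ℓ)
           {f : Point (3 ℕ.+ m)} (f∈U : f ∈ v ^⊥) (ℓf≢0 : ℓ f ≢ 0#) (R β : Carrier) where

    open IsLinear ℓ-linear

    OnSection OnDirection : Point (3 ℕ.+ m) → Set
    OnSection   y = y ∈ v ^⊥ × ℓ y ≡ β
    OnDirection y = y ∈ v ^⊥ × ℓ y ≡ 0#

    onSection? : Decidable OnSection
    onSection? y = U? y ×-dec ℓ y ≟ β

    onDirection? : Decidable OnDirection
    onDirection? y = U? y ×-dec ℓ y ≟ 0#

    section? : Decidable (λ y → OnSection y × Q y ≡ R)
    section? y = onSection? y ×-dec Q y ≟ R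

    section-⊕· : ∀ {e} → OnDirection e → ∀ y u → OnSection y → OnSection (y ⊕ u · e)
    section-⊕· {e} (e∈U , ℓe≡0) y u (y∈U , ℓy≡β) = U-⊕· e∈U y u y∈U ,
      trans (homo-⊕· y u e) (trans (cong₂ (λ a b → a + u * b) ℓy≡β ℓe≡0)
        (solve 2 (λ β u → β :+ u :* con (+ 0) := β) refl β u))

    -- Every line in direction e contains at most two points of the section.
    card-section-lines : ∀ {e} → OnDirection e →
      (∀ y → OnSection y → card (λ u → Q (y ⊕ u · e) ≟ R) ℕ.≤ 2) → card section? ℕ.≤ 2 ℕ.* q ℕ.^ m
    -- Pairs (u, y) with y + ue in the section are counted in two ways: each u yields the whole
    -- section by translation, each y at most two values of u. This avoids choosing a representative
    -- on every line.
    card-section-lines {e} e∈W₀ two = ℕ.*-cancelˡ-≤ q (begin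
      q ℕ.* card section?
        ≡⟨ trans (cong (ℕ._* card section?) (sym card-field))
             (sym (sum-on {P? = everything?} (card section?) (λ _ _ → refl) (λ _ ¬⊤ → contradiction tt ¬⊤))) ⟩
      sum (λ u → card section?)
        ≡⟨ sum-cong (λ u → trans (translate u) card≡sum) ⟩
      sum (λ u → sum (λ y → ⟦ section? (y ⊕ u · e) ⟧))
        ≡⟨ sum-swap _ ⟩
      sum (λ y → sum (λ u → ⟦ section? (y ⊕ u · e) ⟧))
        ≡⟨ sum-cong (λ y → sym card≡sum) ⟩
      sum (λ y → card (λ u → section? (y ⊕ u · e)))
        ≤⟨ sum-on-≤ {P? = onSection?} 2
             (λ y y∈W → ℕ.≤-trans (card-mono (λ _ → proj₂)) (two y y∈W))
             (λ y y∉W → card-none (λ u (y+ue∈W , _) → y∉W (subst OnSection (⊕-·-inverse y e u (- u) (-‿inverseʳ u))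
               (section-⊕· e∈W₀ _ (- u) y+ue∈W)))) ⟩
      card onSection? ℕ.* 2
        ≡⟨ cong (ℕ._* 2) (card-U-slice ℓ-linear f∈U ℓf≢0 β) ⟩
      q ℕ.^ (1 ℕ.+ m) ℕ.* 2
        ≡⟨ trans (ℕ.*-assoc q _ 2) (cong (q ℕ.*_) (ℕ.*-comm (q ℕ.^ m) 2)) ⟩
      q ℕ.* (2 ℕ.* q ℕ.^ m) ∎)
      where
      open ℕ.≤-Reasoning
      translate : ∀ u → card section? ≡ card (λ y → section? (y ⊕ u · e))
      translate u = card-bijection (λ y → y ⊕ (- u) · e) (λ y → y ⊕ u · e)
        (λ y → subst (λ x → OnSection x × Q x ≡ R) (sym (back y))) (λ _ → id)
        (λ y _ → back y) (λ y _ → ⊕-·-inverse y e u (- u) (-‿inverseʳ u))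
        where
        back : ∀ y → y ⊕ (- u) · e ⊕ u · e ≡ y
        back y = ⊕-·-inverse y e (- u) u (trans (+-comm _ u) (-‿inverseʳ u))

    card-section-anisotropic : ∀ {e} → OnDirection e → Q e ≢ 0# → card section? ℕ.≤ 2 ℕ.* q ℕ.^ m
    card-section-anisotropic {e} e∈W₀ Qe≢0 = card-section-lines e∈W₀ λ y _ → ℕ.≤-trans
      (card-mono (λ u eq → trans
        (solve 5 (λ a b c r u → a :* (u :* u) :+ con (+ 2) :* b :* u :+ (c :- r) := (c :+ u :* u :* a :+ con (+ 2) :* (u :* b)) :- r)
          refl (Q e) ⟨ y , e ⟩ (Q y) R u)
        (trans (cong (_- R) (trans (sym (Q-⊕· y u e)) eq)) (-‿inverseʳ R))))
      (quadratic-roots (Q e) (2# * ⟨ y , e ⟩) (Q y - R) Qe≢0)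

    module _ (isotropic : ∀ e → OnDirection e → Q e ≡ 0#) where

      direction-⊥ : ∀ {x y} → OnDirection x → OnDirection y → ⟨ x , y ⟩ ≡ 0#
      direction-⊥ {x} {y} x∈W₀@(x∈U , ℓx≡0) y∈W₀@(y∈U , ℓy≡0) =
        isotropic-⊥ (isotropic x x∈W₀) (isotropic y y∈W₀) (isotropic (x ⊕ y)
          (trans (⟨⟩ˡ.homo-⊕ v x y) (0+0 x∈U y∈U) , trans (homo-⊕ x y) (0+0 ℓx≡0 ℓy≡0)))
        where
        0+0 : ∀ {a b} → a ≡ 0# → b ≡ 0# → a + b ≡ 0#
        0+0 refl refl = +-identityˡ 0#

      -- The difference y - y′ is a direction, and directions are mutually orthogonal here. So the
      -- slope 2⟨y,e⟩ of Q along e is the same on all lines, and one nonzero value serves for all of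
      -- them.
      ⟨⟩-constant : ∀ {y y′ e} → OnSection y → OnSection y′ → OnDirection e → ⟨ y , e ⟩ ≡ ⟨ y′ , e ⟩
      ⟨⟩-constant {y} {y′} {e} (y∈U , ℓy≡β) (y′∈U , ℓy′≡β) e∈W₀ = x-y≡0⇒x≡y (trans (sym (⟨⟩ˡ.homo-⊖ e y y′))
        (direction-⊥ (trans (⟨⟩ˡ.homo-⊖ v y y′) (0-0 y∈U y′∈U) , trans (homo-⊖ y y′) (0-0 ℓy≡β ℓy′≡β)) e∈W₀))
        where
        0-0 : ∀ {a b c} → a ≡ c → b ≡ c → a - b ≡ 0#
        0-0 {c = c} refl refl = -‿inverseʳ c

      card-section-affine : ∀ {e y₀} → OnDirection e → OnSection y₀ → ⟨ y₀ , e ⟩ ≢ 0# →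
                            card section? ℕ.≤ 2 ℕ.* q ℕ.^ m
      card-section-affine {e} {y₀} e∈W₀ y₀∈W ⟨y₀,e⟩≢0 = card-section-lines e∈W₀ λ y y∈W →
        ℕ.≤-trans (card-≤1 (λ u u′ eq eq′ → *-cancelˡ (*-≢0 2≢0 ⟨y₀,e⟩≢0)
          (trans (root y∈W eq) (sym (root y∈W eq′))))) (ℕ.n≤1+n 1)
        where
        open ≡-Reasoning
        root : ∀ {y u} → OnSection y → Q (y ⊕ u · e) ≡ R → 2# * ⟨ y₀ , e ⟩ * u ≡ R - Q y
        root {y} {u} y∈W eq = begin
          2# * ⟨ y₀ , e ⟩ * u                                     ≡⟨ cong (λ k → 2# * k * u) (⟨⟩-constant y₀∈W y∈W e∈W₀) ⟩
          2# * ⟨ y , e ⟩ * u                                      ≡⟨ solve 3 (λ k u c → con (+ 2) :* k :* u :=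
                                                                       (c :+ u :* u :* con (+ 0) :+ con (+ 2) :* (u :* k)) :- c) refl ⟨ y , e ⟩ u (Q y) ⟩
          (Q y + u * u * 0# + 2# * (u * ⟨ y , e ⟩)) - Q y         ≡⟨ cong (λ a → (Q y + u * u * a + 2# * (u * ⟨ y , e ⟩)) - Q y) (isotropic e e∈W₀) ⟨
          (Q y + u * u * Q e + 2# * (u * ⟨ y , e ⟩)) - Q y        ≡⟨ cong (_- Q y) (Q-⊕· y u e) ⟨
          Q (y ⊕ u · e) - Q y                                     ≡⟨ cong (_- Q y) eq ⟩
          R - Q y                                                 ∎

      -- Otherwise the directions of the section are orthogonal to all of v^⊥, hence multiples of v.
      direction-onAxis : R ≢ 0# → ∀ {y₀} → OnSection y₀ → Q y₀ ≡ R →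
                         (∀ e → OnDirection e → ⟨ y₀ , e ⟩ ≡ 0#) → ∀ e → OnDirection e → OnAxis e
      direction-onAxis R≢0 {y₀} (y₀∈U , ℓy₀≡β) Qy₀≡R y₀⊥ e e∈W₀ = axis-of-⊥U e λ p p∈U → begin
        ⟨ p , e ⟩                                              ≡⟨ solve 2 (λ a k → a := (a :+ k :* con (+ 0))) refl ⟨ p , e ⟩ (- k p) ⟩
        ⟨ p , e ⟩ + (- k p) * 0#                               ≡⟨ cong (λ a → ⟨ p , e ⟩ + (- k p) * a) (y₀⊥ e e∈W₀) ⟨
        ⟨ p , e ⟩ + (- k p) * ⟨ y₀ , e ⟩                       ≡⟨ ⟨⟩ˡ.homo-⊕· e p (- k p) y₀ ⟨
        ⟨ p ⊕ (- k p) · y₀ , e ⟩                               ≡⟨ direction-⊥ (U-⊕· y₀∈U p (- k p) p∈U , projected p) e∈W₀ ⟩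
        0#                                                     ∎
        where
        open ≡-Reasoning
        -- For β = 0 the point y₀ would itself be a direction, forcing R = Q(y₀) = 0. With β ≠ 0 a
        -- multiple of y₀ can be subtracted from any p in `v ^⊥` to reach a direction; y₀ and all
        -- directions are orthogonal to e, hence so is p.
        β≢0 : β ≢ 0#
        β≢0 β≡0 = R≢0 (trans (sym Qy₀≡R) (isotropic y₀ (y₀∈U , trans ℓy₀≡β β≡0)))
        k : Point (3 ℕ.+ m) → Carrier
        k p = ℓ p * β ⁻¹
        projected : ∀ p → ℓ (p ⊕ (- k p) · y₀) ≡ 0#
        projected p = begin
          ℓ (p ⊕ (- k p) · y₀)                  ≡⟨ homo-⊕· p (- k p) y₀ ⟩
          ℓ p + (- k p) * ℓ y₀                  ≡⟨ cong (λ b → ℓ p + (- k p) * b) ℓy₀≡β ⟩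
          ℓ p + (- (ℓ p * β ⁻¹)) * β            ≡⟨ solve 3 (λ a i b → a :+ (:- (a :* i)) :* b := a :- a :* (i :* b)) refl (ℓ p) (β ⁻¹) β ⟩
          ℓ p - ℓ p * (β ⁻¹ * β)                ≡⟨ cong (λ c → ℓ p - ℓ p * c) (*-inverseˡ β≢0) ⟩
          ℓ p - ℓ p * 1#                        ≡⟨ solve 1 (λ a → a :- a :* con (+ 1) := con (+ 0)) refl (ℓ p) ⟩
          0#                                    ∎

    anisotropic⊎isotropic : (∃ λ e → OnDirection e × Q e ≢ 0#) ⊎ (∀ e → OnDirection e → Q e ≡ 0#)
    anisotropic⊎isotropic with ∃? (λ e → onDirection? e ×-dec ¬? (Q e ≟ 0#))
    ... | yes found = inj₁ found
    ... | no ¬found = inj₂ λ e e∈W₀ → decidable-stable (Q e ≟ 0#) (λ Qe≢0 → ¬found (e , e∈W₀ , Qe≢0))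

    card-section : R ≢ 0# → 1 ℕ.≤ m → card section? ℕ.≤ 2 ℕ.* q ℕ.^ m
    card-section R≢0 1≤m with anisotropic⊎isotropic
    ... | inj₁ (e , e∈W₀ , Qe≢0) = card-section-anisotropic e∈W₀ Qe≢0
    ... | inj₂ isotropic with ∃? section?
    ...   | no ¬∃ = ℕ.≤-trans (ℕ.≤-reflexive (card-none (λ y y∈S → ¬∃ (y , y∈S)))) ℕ.z≤n
    ...   | yes (y₀ , y₀∈W , Qy₀≡R) with ∃? (λ e → onDirection? e ×-dec ¬? (⟨ y₀ , e ⟩ ≟ 0#))
    ...     | yes (e , e∈W₀ , ⟨y₀,e⟩≢0) = card-section-affine isotropic e∈W₀ y₀∈W ⟨y₀,e⟩≢0
    ...     | no ¬∃ = contradiction q^[1+m]≤q (ℕ.<⇒≱ (subst (ℕ._< q ℕ.^ (1 ℕ.+ m)) (ℕ.^-identityʳ q)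
                        (ℕ.^-monoʳ-< q 1<q (ℕ.s≤s 1≤m))))
      where
      y₀⊥ : ∀ e → OnDirection e → ⟨ y₀ , e ⟩ ≡ 0#
      y₀⊥ e e∈W₀ = decidable-stable (⟨ y₀ , e ⟩ ≟ 0#) (λ ≢0 → ¬∃ (e , e∈W₀ , ≢0))
      -- The direction space has q^(1+m) points and would lie in the axis, which has q. This is
      -- where m ≥ 1 is used.
      q^[1+m]≤q : q ℕ.^ (1 ℕ.+ m) ℕ.≤ q
      q^[1+m]≤q = begin
        q ℕ.^ (1 ℕ.+ m)       ≡⟨ card-U-slice ℓ-linear f∈U ℓf≢0 0# ⟨
        card onDirection?     ≤⟨ card-mono (direction-onAxis isotropic R≢0 y₀∈W Qy₀≡R y₀⊥) ⟩
        card onAxis?          ≡⟨ card-axis ⟩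
        q                     ∎
        where open ℕ.≤-Reasoning

-- Hyperplane sections of the whole point set.

module HyperplaneSections {q : ℕ} (F : FiniteField q) (2≢0 : Geometry.2# F ≢ FiniteField.0# F)
                          {m : ℕ} (B : BlockConstruction F (3 ℕ.+ m)) where

  open FiniteField F
  open Geometry F
  open FieldProperties F hiding (2≢0)
  open Vectors F
  open Counting
  open BlockConstruction B
  open FormProperties 2≢0 Q isQuadraticForm
  open IsotropicPairProperties F 2≢0 isotropicPair
  open BlockProperties F 2≢0 B
  open Sections F 2≢0 isotropicPair

  card-A-∩-hyperplane : 1 ℕ.≤ m → ∀ a {f} → f ∈ v ^⊥ → dot a f ≢ 0# → ∀ b z →
    card (λ x → mem? (A z) x ×-dec dot a x ≟ b) ℕ.≤ 2 ℕ.* q ℕ.^ m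
  card-A-∩-hyperplane 1≤m a f∈U af≢0 b z = ℕ.≤-trans
    (card-injection (_⊖ centre z)
      (λ x (x∈A , ax≡b) → let y∈U , Qy≡R = A⇒X x∈A in
        (y∈U , trans (IsLinear.homo-⊖ (dot-linear a) x (centre z)) (cong (_- dot a (centre z)) ax≡b)) , Qy≡R)
      (λ x x′ _ _ eq → trans (sym (⊖-⊕ x (centre z))) (trans (cong (_⊕ centre z) eq) (⊖-⊕ x′ (centre z)))))
    (card-section (dot-linear a) f∈U af≢0 R (b - dot a (centre z)) R≢0 1≤m)

  -- If the functional a is nonzero on `v ^⊥`, each of the t blocks contributes at most 2q^m.
  -- Otherwise a is ⟨·,v⟩ times the nonzero constant a(w); it is then constant on every block, with
  -- different values on different blocks, so the hyperplane meets at most the block z = b/a(w).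
  card-P-∩-hyperplane : 1 ℕ.≤ m → ∀ a b → a ≢ 𝟎 → ∣ P ∩ hyperplane a b ∣ ℕ.≤ N ℕ.⊔ 2 ℕ.* t ℕ.* q ℕ.^ m
  card-P-∩-hyperplane 1≤m a b a≢𝟎 with ∃? (λ f → U? f ×-dec ¬? (dot a f ≟ 0#))
  ... | yes (f , f∈U , af≢0) = begin
    ∣ P ∩ hyperplane a b ∣
      ≡⟨ ∣∣≡card (P ∩ hyperplane a b) ⟩
    card (mem? (P ∩ hyperplane a b))
      ≤⟨ card-fibres-≤ {Q? = mem? Z} (λ x → ⟨ x , v ⟩) (2 ℕ.* q ℕ.^ m)
           (λ x ((z , z∈Z , x∈A) , _) → subst (_∈ Z) (sym (A⇒⟨,v⟩ x∈A)) z∈Z)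
           (λ z _ → ℕ.≤-trans (card-mono (λ x (((z′ , _ , x∈A) , ax≡b) , eq) →
               subst (λ z → x ∈ A z) (trans (sym (A⇒⟨,v⟩ x∈A)) eq) x∈A , ax≡b))
             (card-A-∩-hyperplane 1≤m a f∈U af≢0 b z)) ⟩
    card (mem? Z) ℕ.* (2 ℕ.* q ℕ.^ m)
      ≡⟨ cong (ℕ._* (2 ℕ.* q ℕ.^ m)) (∣∣≡card Z) ⟨
    t ℕ.* (2 ℕ.* q ℕ.^ m)
      ≡⟨ trans (sym (ℕ.*-assoc t 2 _)) (cong (ℕ._* q ℕ.^ m) (ℕ.*-comm t 2)) ⟩
    2 ℕ.* t ℕ.* q ℕ.^ m
      ≤⟨ ℕ.m≤n⊔m N _ ⟩
    N ℕ.⊔ 2 ℕ.* t ℕ.* q ℕ.^ m ∎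
    where open ℕ.≤-Reasoning
  ... | no ¬∃ = begin
    ∣ P ∩ hyperplane a b ∣                        ≡⟨ ∣∣≡card (P ∩ hyperplane a b) ⟩
    card (mem? (P ∩ hyperplane a b))              ≤⟨ card-mono one-block ⟩
    card (mem? (A (b * dot a w ⁻¹)))              ≡⟨ card-A _ ⟩
    N                                             ≤⟨ ℕ.m≤m⊔n N _ ⟩
    N ℕ.⊔ 2 ℕ.* t ℕ.* q ℕ.^ m                     ∎
    where
    open ℕ.≤-Reasoning
    open IsLinear (dot-linear a)
    dot-U : ∀ p → p ∈ v ^⊥ → dot a p ≡ 0#
    dot-U p p∈U = decidable-stable (dot a p ≟ 0#) (λ ≢0 → ¬∃ (p , p∈U , ≢0))
    dot-⟨,v⟩ : ∀ x → dot a x ≡ ⟨ x , v ⟩ * dot a w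
    dot-⟨,v⟩ x = trans (solve 3 (λ d k a → d := (d :+ (:- k) :* a) :+ k :* a) refl (dot a x) ⟨ x , v ⟩ (dot a w))
      (trans (cong (_+ ⟨ x , v ⟩ * dot a w) (trans (sym (homo-⊕· x _ w)) (dot-U _ (U-projection x)))) (+-identityˡ _))
    aw≢0 : dot a w ≢ 0#
    aw≢0 aw≡0 = a≢𝟎 (dot-nondegenerate a (λ x → trans (dot-⟨,v⟩ x) (trans (cong (_*_ ⟨ x , v ⟩) aw≡0) (zeroʳ _))))
    one-block : ∀ x → x ∈ P ∩ hyperplane a b → x ∈ A (b * dot a w ⁻¹)
    one-block x ((z , _ , x∈A) , ax≡b) = subst (λ z → x ∈ A z) (trans (sym (A⇒⟨,v⟩ x∈A)) (*-cancelˡ aw≢0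
      (trans (*-comm _ _) (trans (sym (dot-⟨,v⟩ x)) (trans ax≡b (sym
        (trans (solve 3 (λ w b i → w :* (b :* i) := b :* (w :* i)) refl (dot a w) b _)
          (trans (cong (b *_) (*-inverseʳ aw≢0)) (*-identityʳ b))))))))) x∈A

-- The exact count in dimension three.

module Ternary {q : ℕ} (F : FiniteField q) (2≢0 : Geometry.2# F ≢ FiniteField.0# F)
               (I : IsotropicPair F 3) where

  open FiniteField F
  open Geometry F
  open FieldProperties F hiding (2≢0)
  open Vectors F
  open Counting
  open IsotropicPair I
  open FormProperties 2≢0 Q isQuadraticForm
  open IsotropicPairProperties F 2≢0 I

  -- If Q vanished on `v ^⊥`, polarisation would make `v ^⊥` orthogonal to itself and place its q²
  -- points on the axis, which has q.
  anisotropic : ∃ λ y → y ∈ v ^⊥ × Q y ≢ 0#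
  anisotropic with ∃? (λ y → U? y ×-dec ¬? (Q y ≟ 0#))
  ... | yes found = found
  ... | no ¬∃ = contradiction q²≤q (ℕ.<⇒≱ (subst (ℕ._< q ℕ.^ 2) (ℕ.^-identityʳ q) (ℕ.^-monoʳ-< q 1<q {1} {2} ℕ.≤-refl)))
    where
    isotropic : ∀ y → y ∈ v ^⊥ → Q y ≡ 0#
    isotropic y y∈U = decidable-stable (Q y ≟ 0#) (λ ≢0 → ¬∃ (y , y∈U , ≢0))
    ⟨⟩≡0 : ∀ x y → x ∈ v ^⊥ → y ∈ v ^⊥ → ⟨ x , y ⟩ ≡ 0#
    ⟨⟩≡0 x y x∈U y∈U = isotropic-⊥ (isotropic x x∈U) (isotropic y y∈U)
      (isotropic (x ⊕ y) (trans (⟨⟩ˡ.homo-⊕ v x y) (trans (cong₂ _+_ x∈U y∈U) (+-identityˡ 0#))))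
    q²≤q : q ℕ.^ 2 ℕ.≤ q
    q²≤q = begin
      q ℕ.^ 2          ≡⟨ card-U ⟨
      card U?          ≤⟨ card-mono (λ s s∈U → axis-of-⊥U s (λ p p∈U → ⟨⟩≡0 p s p∈U s∈U)) ⟩
      card onAxis?     ≡⟨ card-axis ⟩
      q                ∎
      where open ℕ.≤-Reasoning

  module _ {y} (y∈U : y ∈ v ^⊥) (Qy≢0 : Q y ≢ 0#) where

    ⟨y,y⟩≢0 : ⟨ y , y ⟩ ≢ 0#
    ⟨y,y⟩≢0 eq = Qy≢0 (trans (sym (⟨x,x⟩≡Qx y)) eq)

    card-U-slice-y : ∀ β → card (λ x → U? x ×-dec ⟨ x , y ⟩ ≟ β) ≡ q
    card-U-slice-y β = trans (card-U-slice (⟨⟩-linearˡ y) y∈U ⟨y,y⟩≢0 β) (ℕ.^-identityʳ q)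

    -- The axis lies in the orthogonal complement of y in `v ^⊥`, and both have q points.
    y^⊥⊆axis : ∀ p → p ∈ v ^⊥ × ⟨ p , y ⟩ ≡ 0# → OnAxis p
    y^⊥⊆axis = card-⊆-≡ (λ p p∈axis → axis⇒U p∈axis , trans (⟨⟩-comm p y) (U-⟨,⟩-axis y∈U p∈axis))
      (ℕ.≤-reflexive (trans (card-U-slice-y 0#) (sym card-axis)))

    -- Every x in v^⊥ is y⟨x,y⟩/Q(y) plus a multiple of v.
    Q-on-U : ∀ x → x ∈ v ^⊥ → Q x * Q y ≡ ⟨ x , y ⟩ * ⟨ x , y ⟩
    Q-on-U x x∈U = x-y≡0⇒x≡y (begin
      Q x * Q y - c * c
        ≡⟨ solve 3 (λ a r c → a :* r :- c :* c := r :* (a :+ con (+ 0)) :- c :* c :* con (+ 1)) refl (Q x) (Q y) c ⟩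
      Q y * (Q x + 0#) - c * c * 1#
        ≡⟨ cong₂ (λ a b → Q y * (Q x + a) - c * c * b) (sym (zeroʳ (k * c))) (sym (*-inverseʳ Qy≢0)) ⟩
      Q y * (Q x + k * c * 0#) - c * c * (Q y * Q y ⁻¹)
        ≡⟨ cong (λ a → Q y * (Q x + k * c * a) - c * c * (Q y * Q y ⁻¹)) (trans (cong (_- 1#) (*-inverseʳ Qy≢0)) (-‿inverseʳ 1#)) ⟨
      Q y * (Q x + k * c * (Q y * Q y ⁻¹ - 1#)) - c * c * (Q y * Q y ⁻¹)
        ≡⟨ solve 4 (λ a r c i → r :* (a :+ c :* i :* c :* (r :* i :- con (+ 1))) :- c :* c :* (r :* i)
             := r :* (a :+ (:- (c :* i)) :* (:- (c :* i)) :* r :+ con (+ 2) :* ((:- (c :* i)) :* c))) refl (Q x) (Q y) c (Q y ⁻¹) ⟩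
      Q y * (Q x + (- k) * (- k) * Q y + 2# * ((- k) * c))
        ≡⟨ cong (Q y *_) (Q-⊕· x (- k) y) ⟨
      Q y * Q (x ⊕ (- k) · y)
        ≡⟨ cong (Q y *_) (Q-axis (y^⊥⊆axis _ (U-⊕· y∈U x (- k) x∈U , projected))) ⟩
      Q y * 0#
        ≡⟨ zeroʳ (Q y) ⟩
      0# ∎)
      where
      open ≡-Reasoning
      c = ⟨ x , y ⟩
      k = c * Q y ⁻¹
      projected : ⟨ x ⊕ (- k) · y , y ⟩ ≡ 0#
      projected = begin
        ⟨ x ⊕ (- k) · y , y ⟩               ≡⟨ ⟨⟩ˡ.homo-⊕· y x (- k) y ⟩
        c + (- (c * Q y ⁻¹)) * ⟨ y , y ⟩    ≡⟨ cong (λ r → c + (- (c * Q y ⁻¹)) * r) (⟨x,x⟩≡Qx y) ⟩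
        c + (- (c * Q y ⁻¹)) * Q y          ≡⟨ solve 3 (λ c i r → c :+ (:- (c :* i)) :* r := c :- c :* (i :* r)) refl c (Q y ⁻¹) (Q y) ⟩
        c - c * (Q y ⁻¹ * Q y)              ≡⟨ cong (λ r → c - c * r) (*-inverseˡ Qy≢0) ⟩
        c - c * 1#                          ≡⟨ solve 1 (λ c → c :- c :* con (+ 1) := con (+ 0)) refl c ⟩
        0#                                  ∎

    -- By `Q-on-U`, Q(x) = Q(y) means ⟨x,y⟩² = Q(y)², that is ⟨x,y⟩ = ±Q(y). The two signs differ in
    -- odd characteristic, and each gives a slice of q points.
    level-ternary : level (Q y) ≡ 2 ℕ.* q
    level-ternary = trans
      (card-fibres-≡ {Q? = λ c → (c ≟ Q y) ⊎-dec (c ≟ - Q y)} (λ x → ⟨ x , y ⟩) q to fibre)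
      (cong (ℕ._* q) (card-pair (Q y) (- Q y) R≢-R (inj₁ refl) (inj₂ refl) (λ _ → id)))
      where
      open ≡-Reasoning
      R≢-R : Q y ≢ - Q y
      R≢-R eq = *-≢0 2≢0 Qy≢0 (trans (solve 1 (λ r → con (+ 2) :* r := r :+ r) refl (Q y))
        (trans (cong (_+_ (Q y)) eq) (-‿inverseʳ (Q y))))
      to : ∀ x → x ∈ v ^⊥ × Q x ≡ Q y → ⟨ x , y ⟩ ≡ Q y ⊎ ⟨ x , y ⟩ ≡ - Q y
      to x (x∈U , Qx≡Qy) with ⟨ x , y ⟩ ≟ Q y
      ... | yes eq = inj₁ eq
      ... | no neq = inj₂ (x-y≡0⇒x≡y (*≡0 (x≢y⇒x-y≢0 neq) (begin
        (⟨ x , y ⟩ - Q y) * (⟨ x , y ⟩ - - Q y)       ≡⟨ solve 2 (λ c r → (c :- r) :* (c :- :- r) := c :* c :- r :* r) refl ⟨ x , y ⟩ (Q y) ⟩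
        ⟨ x , y ⟩ * ⟨ x , y ⟩ - Q y * Q y             ≡⟨ cong (_- (Q y * Q y)) (Q-on-U x x∈U) ⟨
        Q x * Q y - Q y * Q y                         ≡⟨ cong (λ a → a * Q y - Q y * Q y) Qx≡Qy ⟩
        Q y * Q y - Q y * Q y                         ≡⟨ -‿inverseʳ _ ⟩
        0#                                            ∎)))
      square : ∀ {c} → c ≡ Q y ⊎ c ≡ - Q y → c * c ≡ Q y * Q y
      square (inj₁ refl) = refl
      square (inj₂ refl) = solve 1 (λ r → (:- r) :* (:- r) := r :* r) refl (Q y)
      fibre : ∀ c → c ≡ Q y ⊎ c ≡ - Q y → card (λ x → level? (Q y) x ×-dec ⟨ x , y ⟩ ≟ c) ≡ q
      fibre c c≡±R = trans (card-cong (λ x ((x∈U , _) , eq) → x∈U , eq)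
        (λ x (x∈U , eq) → (x∈U , *-cancelˡ Qy≢0 (trans (*-comm _ _)
          (trans (Q-on-U x x∈U) (trans (cong₂ _*_ eq eq) (square c≡±R))))) , eq)) (card-U-slice-y c)

-- Limits of sequences, square roots and the exact parameter.

module Reals where

  open RealLemmas
  open SqrtLemmas
  open Fractions
  open +-*-Solver

  0≤fromℕ : ∀ n → 0ℚ ℚ.≤ fromℕ n
  0≤fromℕ n = fromℕ-mono-≤ {0} {n} ℕ.z≤n

  ½*-≤ : ∀ {ε} → 0ℚ ℚ.< ε → ½ ℚ.* ε ℚ.≤ ε
  ½*-≤ {ε} ε>0 = subst₂ ℚ._≤_ (ℚ.+-identityˡ (½ ℚ.* ε)) (halves ε)
    (ℚ.+-monoˡ-≤ (½ ℚ.* ε) (ℚ.<⇒≤ (half⁺ ε>0)))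

  ∣-∣≤ : ∀ p q r → 0ℚ ℚ.≤ r → p ℚ.≤ q → q ℚ.≤ p ℚ.+ r → ℚ.∣ p ℚ.- q ∣ ℚ.≤ r
  ∣-∣≤ p q r 0≤r p≤q q≤p+r = abs-≤
    (≤-+⇒-≤ p q r (ℚ.≤-trans p≤q (subst (ℚ._≤ q ℚ.+ r) (ℚ.+-identityʳ q) (ℚ.+-monoʳ-≤ q 0≤r))))
    (subst (ℚ._≤ r) (solve 2 (λ p q → q :- p := :- (p :- q)) refl p q) (≤-+⇒-≤ q p r q≤p+r))

  infix 4 _≃_
  infixl 7 _⊗_

  _⊗_ : (ℕ → ℚ) → (ℕ → ℚ) → ℕ → ℚ
  (f ⊗ g) n = f n ℚ.* g n

  const : ℚ → ℕ → ℚ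
  const p _ = p

  -- The relation _≈_ on reals as a relation on their sequences; conversion checking of
  -- products of reals would compare the proofs that they are Cauchy.
  record _≃_ (f g : ℕ → ℚ) : Set where
    constructor ⌊_⌋
    field ⌈_⌉ : ∀ ε → 0ℚ ℚ.< ε → ∃ λ N → ∀ n → N ℕ.≤ n → ℚ.∣ f n ℚ.- g n ∣ ℚ.≤ ε

  open _≃_ public

  eventually : ∀ {f g} N → (∀ n → N ℕ.≤ n → f n ≡ g n) → f ≃ g
  eventually {f} {g} N eq = ⌊ (λ ε ε>0 → N , λ n n≥ → subst (ℚ._≤ ε)
    (cong ℚ.∣_∣ (sym (trans (cong (ℚ._- g n) (eq n n≥)) (ℚ.+-inverseʳ (g n))))) (ℚ.<⇒≤ ε>0)) ⌋

  pointwise : ∀ {f g} → (∀ n → f n ≡ g n) → f ≃ g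
  pointwise eq = eventually 0 (λ n _ → eq n)

  ≃-sym : ∀ {f g} → f ≃ g → g ≃ f
  ≃-sym {f} {g} ⌊ f≃g ⌋ = ⌊ (λ ε ε>0 → let N , h = f≃g ε ε>0 in
    N , λ n n≥ → subst (ℚ._≤ ε) (∣-∣-sym (f n) (g n)) (h n n≥)) ⌋

  ∣-∣-triangle : ∀ p q r → ℚ.∣ p ℚ.- r ∣ ℚ.≤ ℚ.∣ p ℚ.- q ∣ ℚ.+ ℚ.∣ q ℚ.- r ∣
  ∣-∣-triangle p q r = subst (λ z → ℚ.∣ z ∣ ℚ.≤ ℚ.∣ p ℚ.- q ∣ ℚ.+ ℚ.∣ q ℚ.- r ∣)
    (solve 3 (λ p q r → (p :- q) :+ (q :- r) := p :- r) refl p q r)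
    (ℚ.∣p+q∣≤∣p∣+∣q∣ (p ℚ.- q) (q ℚ.- r))

  ≃-trans : ∀ {f g h} → f ≃ g → g ≃ h → f ≃ h
  ≃-trans {f} {g} {h} ⌊ f≃g ⌋ ⌊ g≃h ⌋ = ⌊ (λ ε ε>0 →
    let M , α = f≃g (½ ℚ.* ε) (half⁺ ε>0)
        N , β = g≃h (½ ℚ.* ε) (half⁺ ε>0)
    in M ℕ.⊔ N , λ n n≥ → ℚ.≤-trans (∣-∣-triangle (f n) (g n) (h n))
      (subst (_ ℚ.≤_) (halves ε) (ℚ.+-mono-≤ (α n (ℕ.m⊔n≤o⇒m≤o M N n≥)) (β n (ℕ.m⊔n≤o⇒n≤o M N n≥))))) ⌋

  ≃-setoid : Setoid _ _
  ≃-setoid = record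
    { Carrier = ℕ → ℚ ; _≈_ = _≃_
    ; isEquivalence = record { refl = pointwise (λ _ → refl) ; sym = ≃-sym ; trans = ≃-trans }
    }

  open import Relation.Binary.Reasoning.Setoid ≃-setoid

  -- The factor has to be a real and not just a sequence: Cauchy sequences are bounded, so
  -- multiplication by one keeps small differences small.
  ⊗-congʳ : ∀ {f g} (c : ℝ) → f ≃ g → f ⊗ seq c ≃ g ⊗ seq c
  ⊗-congʳ {f} {g} c ⌊ f≃g ⌋ = ⌊ product ⌋
    where
    product : ∀ ε → 0ℚ ℚ.< ε → ∃ λ N → ∀ n → N ℕ.≤ n → ℚ.∣ f n ℚ.* seq c n ℚ.- g n ℚ.* seq c n ∣ ℚ.≤ ε
    product ε ε>0
      with B , M , B>0 , c≤B ← bounded c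
      with η , η>0 , Bη≡ ← share ε>0 B>0
      with N , α ← f≃g η η>0
      = M ℕ.⊔ N , λ n n≥ → subst₂ ℚ._≤_
          (sym (trans (cong ℚ.∣_∣ (solve 3 (λ f g c → f :* c :- g :* c := c :* (f :- g)) refl (f n) (g n) (seq c n)))
            (ℚ.∣p*q∣≡∣p∣*∣q∣ (seq c n) (f n ℚ.- g n))))
          refl
          (ℚ.≤-trans (*-mono (ℚ.0≤∣p∣ (seq c n)) (ℚ.<⇒≤ η>0) (c≤B n (ℕ.m⊔n≤o⇒m≤o M N n≥)) (α n (ℕ.m⊔n≤o⇒n≤o M N n≥)))
            (subst (ℚ._≤ ε) (sym Bη≡) (½*-≤ ε>0)))

  ⊗-const : ∀ {f} (x : ℝ) {p r} → f ≃ const p → seq x ≃ const r → f ⊗ seq x ≃ const (p ℚ.* r)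
  ⊗-const {f} x {p} {r} f≃p x≃r = begin
    f ⊗ seq x                ≈⟨ ⊗-congʳ x f≃p ⟩
    const p ⊗ seq x          ≈⟨ pointwise (λ n → ℚ.*-comm p (seq x n)) ⟩
    seq x ⊗ const p          ≈⟨ ⊗-congʳ (fromℚ p) x≃r ⟩
    const r ⊗ const p        ≈⟨ pointwise (λ n → ℚ.*-comm r p) ⟩
    const (p ℚ.* r)          ∎

  lower-bound : ∀ x → ((δ , N , _) : 0ʳ <ʳ x) → ∀ n → N ℕ.≤ n → δ ℚ.≤ seq x n
  lower-bound x (δ , N , _ , h) n n≥ = subst (ℚ._≤ seq x n) (ℚ.+-identityˡ δ) (h n n≥)

  +ʳ⁺ : ∀ x y → 0ʳ <ʳ x → 0ʳ <ʳ y → 0ʳ <ʳ x +ʳ y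
  +ʳ⁺ x y x>0@(δ , M , δ>0 , _) y>0@(η , N , η>0 , _) = δ , M ℕ.⊔ N , δ>0 , λ n n≥ →
    subst (ℚ._≤ seq x n ℚ.+ seq y n) (ℚ.+-comm δ 0ℚ)
      (ℚ.+-mono-≤ {δ} {seq x n} {0ℚ} {seq y n} (lower-bound x x>0 n (ℕ.m⊔n≤o⇒m≤o M N n≥))
        (ℚ.≤-trans (ℚ.<⇒≤ η>0) (lower-bound y y>0 n (ℕ.m⊔n≤o⇒n≤o M N n≥))))

  -- Before the index supplied by `x>0` the cut-off may have replaced terms of x, so the equation is
  -- only claimed from there on.
  *-inverse : ∀ x (x>0 : 0ʳ <ʳ x) → ∀ n → proj₁ (proj₂ x>0) ℕ.≤ n → seq x n ℚ.* seq (x ⁻¹⟨ x>0 ⟩) n ≡ 1ℚ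
  *-inverse x x>0@(δ , N , δ>0 , _) n n≥ =
    trans (cong (ℚ._* inv (δ ℚ.⊔ seq x n) (ℚ.<-≤-trans δ>0 (ℚ.p≤p⊔q δ (seq x n))))
        (sym (ℚ.p≤q⇒p⊔q≡q (lower-bound x x>0 n n≥))))
      (*-inv (δ ℚ.⊔ seq x n) (ℚ.<-≤-trans δ>0 (ℚ.p≤p⊔q δ (seq x n))))

  cancel-inverse : ∀ f c (c>0 : 0ʳ <ʳ c) → f ⊗ seq c ⊗ seq (c ⁻¹⟨ c>0 ⟩) ≃ f
  cancel-inverse f c c>0 = eventually (proj₁ (proj₂ c>0)) λ n n≥ →
    trans (ℚ.*-assoc (f n) (seq c n) (seq (c ⁻¹⟨ c>0 ⟩) n))
      (trans (cong (f n ℚ.*_) (*-inverse c c>0 n n≥)) (ℚ.*-identityʳ (f n)))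

  ⊗-cancelʳ : ∀ {f g} c → 0ʳ <ʳ c → f ⊗ seq c ≃ g ⊗ seq c → f ≃ g
  ⊗-cancelʳ {f} {g} c c>0 fc≃gc = begin
    f                                    ≈⟨ cancel-inverse f c c>0 ⟨
    f ⊗ seq c ⊗ seq (c ⁻¹⟨ c>0 ⟩)        ≈⟨ ⊗-congʳ (c ⁻¹⟨ c>0 ⟩) fc≃gc ⟩
    g ⊗ seq c ⊗ seq (c ⁻¹⟨ c>0 ⟩)        ≈⟨ cancel-inverse g c c>0 ⟩
    g                                    ∎

  -- The difference of the squares is (x - y)(x + y), and the positive factor x + y can be
  -- cancelled.
  √-unique : ∀ x y → 0ʳ <ʳ x → 0ʳ <ʳ y → seq x ⊗ seq x ≃ seq y ⊗ seq y → seq x ≃ seq y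
  √-unique x y x>0 y>0 ⌊ x²≃y² ⌋ = ⊗-cancelʳ (x +ʳ y) (+ʳ⁺ x y x>0 y>0) ⌊ (λ ε ε>0 →
    let N , h = x²≃y² ε ε>0 in N , λ n n≥ → subst (λ z → ℚ.∣ z ∣ ℚ.≤ ε)
      (solve 2 (λ x y → x :* x :- y :* y := x :* (x :+ y) :- y :* (x :+ y)) refl (seq x n) (seq y n)) (h n n≥)) ⌋

  module _ (n k : ℕ) where

    private
      a b : ℕ
      a = isqrt (n ℕ.* (suc k ℕ.* suc k))
      b = suc k

      a≤nb : a ℕ.≤ n ℕ.* b
      a≤nb = ≤-of-squares a (n ℕ.* b) (ℕ.≤-trans (isqrt-lower (n ℕ.* (b ℕ.* b)))
        (ℕ.≤-trans (ℕ.*-monoˡ-≤ (b ℕ.* b) (n≤n*n n)) (ℕ.≤-reflexive (sym (square-swap n b)))))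
        where
        n≤n*n : ∀ n → n ℕ.≤ n ℕ.* n
        n≤n*n zero    = ℕ.z≤n
        n≤n*n (suc n) = ℕ.m≤m*n (suc n) (suc n)

      -- From nb² < (a + 1)² follows nb² ≤ a² + 2a. The crude bound a ≤ nb then gives, after
      -- division by b², the error 2n/b, which tends to 0.
      nb²≤a²+2nb : n ℕ.* (b ℕ.* b) ℕ.≤ a ℕ.* a ℕ.+ 2 ℕ.* n ℕ.* b
      nb²≤a²+2nb = ℕ.≤-trans (ℕ.≤-pred (ℕ.≤-trans (isqrt-upper (n ℕ.* (b ℕ.* b)))
          (ℕ.≤-reflexive (S.solve 1 (λ a → (S.con 1 S.:+ a) S.:* (S.con 1 S.:+ a) S.:= S.con 1 S.:+ (a S.:* a S.:+ S.con 2 S.:* a)) refl a))))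
        (ℕ.+-monoʳ-≤ (a ℕ.* a) (ℕ.≤-trans (ℕ.*-monoʳ-≤ 2 a≤nb) (ℕ.≤-reflexive (sym (ℕ.*-assoc 2 n b)))))
        where module S = ℕ.+-*-Solver

      scale : ∀ {p q} → p ℚ.* fromℕ b ℚ.* fromℕ b ℚ.≤ q ℚ.* fromℕ b ℚ.* fromℕ b → p ℚ.≤ q
      scale le = ℚ.*-cancelʳ-≤-pos (fromℕ b) {{fromℕ-positive b}} (ℚ.*-cancelʳ-≤-pos (fromℕ b) {{fromℕ-positive b}} le)

      r : ℚ
      r = seq (√ n) k

      rb≡a : r ℚ.* fromℕ b ≡ fromℕ a
      rb≡a = /-*-cancel a b

      r²b²≡a² : r ℚ.* r ℚ.* fromℕ b ℚ.* fromℕ b ≡ fromℕ (a ℕ.* a)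
      r²b²≡a² = trans (solve 2 (λ r b → r :* r :* b :* b := (r :* b) :* (r :* b)) refl r (fromℕ b))
        (trans (cong₂ ℚ._*_ rb≡a rb≡a) (sym (fromℕ-* a a)))

      nb²≡ : fromℕ n ℚ.* fromℕ b ℚ.* fromℕ b ≡ fromℕ (n ℕ.* (b ℕ.* b))
      nb²≡ = trans (ℚ.*-assoc (fromℕ n) (fromℕ b) (fromℕ b))
        (sym (trans (fromℕ-* n (b ℕ.* b)) (cong (fromℕ n ℚ.*_) (fromℕ-* b b))))

    √-lower : r ℚ.* r ℚ.≤ fromℕ n
    √-lower = scale (subst₂ ℚ._≤_ (sym r²b²≡a²) (sym nb²≡) (fromℕ-mono-≤ (isqrt-lower (n ℕ.* (b ℕ.* b)))))

    √-upper : fromℕ n ℚ.≤ r ℚ.* r ℚ.+ fromℕ (2 ℕ.* n) ℚ.* (+ 1 ℚ./ b)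
    √-upper = scale (subst₂ ℚ._≤_ (sym nb²≡) (sym (trans
      (solve 4 (λ r b m i → (r :* r :+ m :* i) :* b :* b := r :* r :* b :* b :+ m :* b :* (i :* b)) refl
        r (fromℕ b) (fromℕ (2 ℕ.* n)) (+ 1 ℚ./ b))
      (trans (cong₂ ℚ._+_ r²b²≡a² (trans (cong₂ ℚ._*_ (sym (fromℕ-* (2 ℕ.* n) b)) (/-*-cancel 1 b)) (ℚ.*-identityʳ _)))
        (sym (fromℕ-+ (a ℕ.* a) (2 ℕ.* n ℕ.* b))))))
      (fromℕ-mono-≤ nb²≤a²+2nb))

  √-square : ∀ n → seq (√ n) ⊗ seq (√ n) ≃ const (fromℕ n)
  √-square n = ⌊ square ⌋
    where
    square : ∀ ε → 0ℚ ℚ.< ε → ∃ λ N → ∀ k → N ℕ.≤ k → ℚ.∣ seq (√ n) k ℚ.* seq (√ n) k ℚ.- fromℕ n ∣ ℚ.≤ ε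
    square ε ε>0 with η , η>0 , Bη≡ ← share ε>0 (ℚ.positive⁻¹ (fromℕ (suc (2 ℕ.* n))) {{fromℕ-positive (suc (2 ℕ.* n))}})
      = ℚ.↧ₙ η , λ k k≥ → ∣-∣≤ (seq (√ n) k ℚ.* seq (√ n) k) (fromℕ n) ε (ℚ.<⇒≤ ε>0) (√-lower n k)
        (ℚ.≤-trans (√-upper n k) (ℚ.+-monoʳ-≤ (seq (√ n) k ℚ.* seq (√ n) k) (small k k≥)))
      where
      small : ∀ k → ℚ.↧ₙ η ℕ.≤ k → fromℕ (2 ℕ.* n) ℚ.* (+ 1 ℚ./ suc k) ℚ.≤ ε
      small k k≥ = ℚ.≤-trans (*-mono (0≤fromℕ (2 ℕ.* n)) (ℚ.<⇒≤ η>0)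
          (fromℕ-mono-≤ (ℕ.n≤1+n (2 ℕ.* n))) (1/suc-≤ η η>0 k k≥))
        (subst (ℚ._≤ ε) (sym Bη≡) (½*-≤ ε>0))

  √-* : ∀ a b .{{_ : NonZero a}} .{{_ : NonZero b}} .{{_ : NonZero (a ℕ.* b)}} →
        seq (√ (a ℕ.* b)) ≃ seq (√ a) ⊗ seq (√ b)
  √-* a b = √-unique (√ (a ℕ.* b)) (√ a *ʳ √ b) (√⁺ (a ℕ.* b)) (*ʳ⁺ {√ a} {√ b} (√⁺ a) (√⁺ b)) (begin
    seq (√ (a ℕ.* b)) ⊗ seq (√ (a ℕ.* b))
      ≈⟨ √-square (a ℕ.* b) ⟩
    const (fromℕ (a ℕ.* b))
      ≡⟨ cong const (fromℕ-* a b) ⟩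
    const (fromℕ a ℚ.* fromℕ b)
      ≈⟨ ⊗-const (√ b *ʳ √ b) (√-square a) (√-square b) ⟨
    (seq (√ a) ⊗ seq (√ a)) ⊗ (seq (√ b) ⊗ seq (√ b))
      ≈⟨ pointwise (λ n → solve 2 (λ x y → (x :* x) :* (y :* y) := (x :* y) :* (x :* y)) refl (seq (√ a) n) (seq (√ b) n)) ⟩
    (seq (√ a) ⊗ seq (√ b)) ⊗ (seq (√ a) ⊗ seq (√ b)) ∎)

  √-square-root : ∀ a .{{_ : NonZero a}} .{{_ : NonZero (a ℕ.* a)}} → seq (√ (a ℕ.* a)) ≃ const (fromℕ a)
  √-square-root a = ≃-trans (√-* a a) (√-square a)

  √^-square : ∀ q k → seq (√ q ^ʳ k) ⊗ seq (√ q ^ʳ k) ≃ const (fromℕ (q ℕ.^ k))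
  √^-square q zero    = pointwise (λ _ → ℚ.*-identityˡ 1ℚ)
  √^-square q (suc k) = begin
    (seq (√ q) ⊗ seq (√ q ^ʳ k)) ⊗ (seq (√ q) ⊗ seq (√ q ^ʳ k))
      ≈⟨ pointwise (λ n → solve 2 (λ x y → (x :* y) :* (x :* y) := (x :* x) :* (y :* y)) refl (seq (√ q) n) (seq (√ q ^ʳ k) n)) ⟩
    (seq (√ q) ⊗ seq (√ q)) ⊗ (seq (√ q ^ʳ k) ⊗ seq (√ q ^ʳ k))
      ≈⟨ ⊗-const (√ q ^ʳ k *ʳ √ q ^ʳ k) (√-square q) (√^-square q k) ⟩
    const (fromℕ q ℚ.* fromℕ (q ℕ.^ k))
      ≡⟨ cong const (fromℕ-* q (q ℕ.^ k)) ⟨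
    const (fromℕ (q ℕ.* q ℕ.^ k)) ∎

  0≤√ : ∀ n k → 0ℚ ℚ.≤ seq (√ n) k
  0≤√ n k = ℚ.*-cancelʳ-≤-pos (fromℕ (suc k)) {{fromℕ-positive (suc k)}} (subst₂ ℚ._≤_ (sym (ℚ.*-zeroˡ (fromℕ (suc k))))
    (sym (/-*-cancel (isqrt (n ℕ.* (suc k ℕ.* suc k))) (suc k))) (0≤fromℕ (isqrt (n ℕ.* (suc k ℕ.* suc k)))))

  0≤* : ∀ {p r} → 0ℚ ℚ.≤ p → 0ℚ ℚ.≤ r → 0ℚ ℚ.≤ p ℚ.* r
  0≤* {p} {r} 0≤p 0≤r = subst (ℚ._≤ p ℚ.* r) (ℚ.*-zeroˡ 0ℚ) (*-mono {0ℚ} {p} {0ℚ} {r} ℚ.≤-refl 0≤r 0≤p 0≤r)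

  0≤⁻¹ : ∀ x (x>0 : 0ʳ <ʳ x) n → 0ℚ ℚ.≤ seq (x ⁻¹⟨ x>0 ⟩) n
  0≤⁻¹ x (δ , _ , δ>0 , _) n = ℚ.<⇒≤ (inv⁺ (δ ℚ.⊔ seq x n) (ℚ.<-≤-trans δ>0 (ℚ.p≤p⊔q δ (seq x n))))

  module ParameterValue (q N t m : ℕ) {{_ : NonZero q}} {{_ : NonZero N}} {{_ : NonZero t}} where

    e : ℚ
    e = 1ℚ ℚ.- + 1 ℚ./ q

    -- With d = 3 + m, `c` is q^((d-2)/2), `i` its inverse and `value` the claimed closed form of K.
    c i value : ℝ
    c     = √ q ^ʳ (1 ℕ.+ m)
    i     = c ⁻¹⟨ √^⁺ q (1 ℕ.+ m) ⟩
    value = fromℚ e *ʳ (√ N /ʳ (√ q) ^ʳ (1 ℕ.+ m) ⟨ √^⁺ q (1 ℕ.+ m) ⟩)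

    ci≡1 : ∀ n → proj₁ (proj₂ (√^⁺ q (1 ℕ.+ m))) ℕ.≤ n → seq c n ℚ.* seq i n ≡ 1ℚ
    ci≡1 = *-inverse c (√^⁺ q (1 ℕ.+ m))

    -- The product |P||𝒮|; regrouped as t²·Nq it has the square root t√N√q.
    norm : ℕ
    norm = t ℕ.* N ℕ.* (t ℕ.* q)

    instance
      tt≢0 : NonZero (t ℕ.* t)
      tt≢0 = ℕ.m*n≢0 t t
      Nq≢0 : NonZero (N ℕ.* q)
      Nq≢0 = ℕ.m*n≢0 N q
      ttNq≢0 : NonZero (t ℕ.* t ℕ.* (N ℕ.* q))
      ttNq≢0 = ℕ.m*n≢0 (t ℕ.* t) (N ℕ.* q)

    norm≡ : norm ≡ t ℕ.* t ℕ.* (N ℕ.* q)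
    norm≡ = S.solve 3 (λ t N q → t S.:* N S.:* (t S.:* q) S.:= t S.:* t S.:* (N S.:* q)) refl t N q
      where module S = ℕ.+-*-Solver

    instance
      norm≢0 : NonZero norm
      norm≢0 = subst NonZero (sym norm≡) ttNq≢0

    √norm : seq (√ norm) ≃ seq (√ N) ⊗ seq (√ q) ⊗ const (fromℕ t)
    √norm = begin
      seq (√ norm)                                    ≡⟨ cong (λ k → seq (√ k)) norm≡ ⟩
      seq (√ (t ℕ.* t ℕ.* (N ℕ.* q)))                 ≈⟨ √-* (t ℕ.* t) (N ℕ.* q) ⟩
      seq (√ (t ℕ.* t)) ⊗ seq (√ (N ℕ.* q))           ≈⟨ ⊗-congʳ (√ (N ℕ.* q)) (√-square-root t) ⟩
      const (fromℕ t) ⊗ seq (√ (N ℕ.* q))             ≈⟨ pointwise (λ n → ℚ.*-comm (fromℕ t) (seq (√ (N ℕ.* q)) n)) ⟩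
      seq (√ (N ℕ.* q)) ⊗ const (fromℕ t)             ≈⟨ ⊗-congʳ (fromℚ (fromℕ t)) (√-* N q) ⟩
      seq (√ N) ⊗ seq (√ q) ⊗ const (fromℕ t)         ∎

    e*q : e ℚ.* fromℕ q ≡ fromℕ q ℚ.- 1ℚ
    e*q = trans (solve 2 (λ f q → (con 1ℚ :- f) :* q := q :- f :* q) refl (+ 1 ℚ./ q) (fromℕ q))
      (cong (ℚ._-_ (fromℕ q)) (/-*-cancel 1 q))

    -- Since q^((d-1)/2) = √q · c, the factor c cancels `i` and the roots of N and q occur in pairs,
    -- leaving N·q·t·e with e·q = q - 1.
    value-exact : seq (value *ʳ √ q ^ʳ (2 ℕ.+ m)) ⊗ seq (√ norm) ≃ const (fromℕ t ℚ.* (fromℕ q ℚ.- 1ℚ) ℚ.* fromℕ N)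
    value-exact = begin
      seq (value *ʳ √ q ^ʳ (2 ℕ.+ m)) ⊗ seq (√ norm)
        ≈⟨ pointwise (λ n → ℚ.*-comm (seq (value *ʳ √ q ^ʳ (2 ℕ.+ m)) n) (seq (√ norm) n)) ⟩
      seq (√ norm) ⊗ seq (value *ʳ √ q ^ʳ (2 ℕ.+ m))
        ≈⟨ ⊗-congʳ (value *ʳ √ q ^ʳ (2 ℕ.+ m)) √norm ⟩
      seq (√ N) ⊗ seq (√ q) ⊗ const (fromℕ t) ⊗ seq (value *ʳ √ q ^ʳ (2 ℕ.+ m))
        ≈⟨ eventually (proj₁ (proj₂ (√^⁺ q (1 ℕ.+ m)))) (λ n n≥ → trans
             (solve 6 (λ rN rq t e i c → rN :* rq :* t :* ((e :* (rN :* i)) :* (rq :* c))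
               := ((rN :* rN) :* (rq :* rq)) :* (t :* e) :* (c :* i)) refl
               (seq (√ N) n) (seq (√ q) n) (fromℕ t) e (seq i n) (seq c n))
             (trans (cong (((seq (√ N) n ℚ.* seq (√ N) n) ℚ.* (seq (√ q) n ℚ.* seq (√ q) n)) ℚ.* (fromℕ t ℚ.* e) ℚ.*_) (ci≡1 n n≥))
               (ℚ.*-identityʳ _))) ⟩
      (seq (√ N) ⊗ seq (√ N)) ⊗ (seq (√ q) ⊗ seq (√ q)) ⊗ const (fromℕ t ℚ.* e)
        ≈⟨ ⊗-const (fromℚ (fromℕ t ℚ.* e)) (⊗-const (√ q *ʳ √ q) (√-square N) (√-square q)) (pointwise (λ _ → refl)) ⟩
      const (fromℕ N ℚ.* fromℕ q ℚ.* (fromℕ t ℚ.* e))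
        ≡⟨ cong const (trans (solve 4 (λ N q t e → N :* q :* (t :* e) := t :* (e :* q) :* N) refl (fromℕ N) (fromℕ q) (fromℕ t) e)
             (cong (λ k → fromℕ t ℚ.* k ℚ.* fromℕ N) e*q)) ⟩
      const (fromℕ t ℚ.* (fromℕ q ℚ.- 1ℚ) ℚ.* fromℕ N) ∎

    -- Both q^((d-1)/2) and √(|P||𝒮|) are positive, hence cancellable, so the defining equation
    -- determines K.
    exact⇔value : ∀ {s a b} → s ≡ fromℕ t ℚ.* (fromℕ q ℚ.- 1ℚ) ℚ.* fromℕ N → a ≡ t ℕ.* N → b ≡ t ℕ.* q →
      ∀ K → (fromℚ s ≈ K *ʳ (√ q) ^ʳ (2 ℕ.+ m) *ʳ √ (a ℕ.* b)) ⇔ K ≈ value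
    exact⇔value {s} refl refl refl K = mk⇔
      (λ exact → ⌈ ⊗-cancelʳ {seq K} {seq value} (√ q ^ʳ (2 ℕ.+ m)) (√^⁺ q (2 ℕ.+ m)) (⊗-cancelʳ (√ norm) (√⁺ norm)
        (≃-trans {g = const s} (≃-sym {const s} ⌊ exact ⌋) (≃-sym value-exact))) ⌉)
      (λ K≈value → ⌈ ≃-sym {seq K ⊗ seq (√ q ^ʳ (2 ℕ.+ m)) ⊗ seq (√ norm)} {const s} (≃-trans
        (⊗-congʳ (√ norm) (⊗-congʳ {seq K} {seq value} (√ q ^ʳ (2 ℕ.+ m)) ⌊ K≈value ⌋)) value-exact) ⌉)

    M : ℕ
    M = q ℕ.^ (1 ℕ.+ m)

    instance
      M≢0 : NonZero M
      M≢0 = ℕ.m^n≢0 q (1 ℕ.+ m)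

    -- The square of `value`. It is rational because c² = M, so its distance from 1 can be estimated
    -- in ℚ.
    κ : ℚ
    κ = e ℚ.* e ℚ.* (+ N ℚ./ M)

    value² : seq value ⊗ seq value ≃ const κ
    value² = ⊗-cancelʳ (c *ʳ c) (*ʳ⁺ {c} {c} (√^⁺ q (1 ℕ.+ m)) (√^⁺ q (1 ℕ.+ m))) (begin
      seq value ⊗ seq value ⊗ (seq c ⊗ seq c)
        ≈⟨ eventually (proj₁ (proj₂ (√^⁺ q (1 ℕ.+ m)))) (λ n n≥ → trans
             (solve 4 (λ rN e i c → (e :* (rN :* i)) :* (e :* (rN :* i)) :* (c :* c)
               := (rN :* rN) :* (e :* e) :* ((c :* i) :* (c :* i))) refl (seq (√ N) n) e (seq i n) (seq c n))
             (trans (cong (λ k → (seq (√ N) n ℚ.* seq (√ N) n) ℚ.* (e ℚ.* e) ℚ.* (k ℚ.* k)) (ci≡1 n n≥))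
               (ℚ.*-identityʳ _))) ⟩
      seq (√ N) ⊗ seq (√ N) ⊗ const (e ℚ.* e)
        ≈⟨ ⊗-const (fromℚ (e ℚ.* e)) (√-square N) (pointwise (λ _ → refl)) ⟩
      const (fromℕ N ℚ.* (e ℚ.* e))
        ≡⟨ cong const (trans (ℚ.*-comm (fromℕ N) (e ℚ.* e)) (trans (cong (e ℚ.* e ℚ.*_) (sym (/-*-cancel N M)))
             (sym (ℚ.*-assoc (e ℚ.* e) (+ N ℚ./ M) (fromℕ M))))) ⟩
      const (κ ℚ.* fromℕ M)
        ≈⟨ ⊗-const (c *ʳ c) (pointwise {const κ} (λ _ → refl)) (√^-square q (1 ℕ.+ m)) ⟨
      const κ ⊗ (seq c ⊗ seq c) ∎)

    0≤e : 0ℚ ℚ.≤ e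
    0≤e = ℚ.*-cancelʳ-≤-pos (fromℕ q) {{fromℕ-positive q}} (subst₂ ℚ._≤_ (sym (ℚ.*-zeroˡ (fromℕ q)))
      (trans (fromℕ-∸1 q) (sym e*q)) (0≤fromℕ (q ℕ.∸ 1)))

    0≤value : ∀ n → 0ℚ ℚ.≤ seq value n
    0≤value n = 0≤* {e} {seq (√ N *ʳ i) n} 0≤e (0≤* {seq (√ N) n} {seq i n} (0≤√ N n) (0≤⁻¹ c (√^⁺ q (1 ℕ.+ m)) n))

    1-e≤ : ∀ {f} → + 1 ℚ./ q ℚ.≤ f → 1ℚ ℚ.≤ e ℚ.+ f
    1-e≤ {f} le = subst (ℚ._≤ e ℚ.+ f) (solve 1 (λ g → (con 1ℚ :- g) :+ g := con 1ℚ) refl (+ 1 ℚ./ q)) (ℚ.+-monoʳ-≤ e le)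

    e≤1 : e ℚ.≤ 1ℚ
    e≤1 = subst (e ℚ.≤_) (solve 1 (λ g → (con 1ℚ :- g) :+ g := con 1ℚ) refl (+ 1 ℚ./ q))
      (subst (ℚ._≤ e ℚ.+ + 1 ℚ./ q) (ℚ.+-identityʳ e) (ℚ.+-monoʳ-≤ e (ℚ.*-cancelʳ-≤-pos (fromℕ q) {{fromℕ-positive q}}
        (subst₂ ℚ._≤_ (sym (ℚ.*-zeroˡ (fromℕ q))) (sym (/-*-cancel 1 q)) (0≤fromℕ 1)))))

    -- With r = N/M, κ - 1 = e²(r - 1) + (e² - 1). As 0 ≤ e ≤ 1, the first term is at most f, and 1
    -- - e² = (1 - e)(1 + e) is at most 2f.
    κ-near-1 : ∀ {f} → ℚ.∣ + N ℚ./ M ℚ.- 1ℚ ∣ ℚ.≤ f → + 1 ℚ./ q ℚ.≤ f → ℚ.∣ κ ℚ.- 1ℚ ∣ ℚ.≤ f ℚ.+ (f ℚ.+ f)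
    κ-near-1 {f} r-near-1 g≤f = ℚ.≤-trans (ℚ.≤-reflexive (cong ℚ.∣_∣
        (solve 2 (λ e r → e :* e :* r :- con 1ℚ := e :* e :* (r :- con 1ℚ) :+ (e :* e :- con 1ℚ)) refl e r)))
      (ℚ.≤-trans (ℚ.∣p+q∣≤∣p∣+∣q∣ (e ℚ.* e ℚ.* (r ℚ.- 1ℚ)) (e ℚ.* e ℚ.- 1ℚ)) (ℚ.+-mono-≤ first second))
      where
      r = + N ℚ./ M
      0≤f = ℚ.≤-trans (ℚ.0≤∣p∣ (r ℚ.- 1ℚ)) r-near-1
      0≤e² = 0≤* 0≤e 0≤e
      e²≤1 : e ℚ.* e ℚ.≤ 1ℚ
      e²≤1 = ℚ.≤-trans (*-mono 0≤e (ℚ.<⇒≤ (ℚ.positive⁻¹ 1ℚ)) e≤1 e≤1) (ℚ.≤-reflexive (ℚ.*-identityˡ 1ℚ))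
      0≤1-e : 0ℚ ℚ.≤ 1ℚ ℚ.- e
      0≤1-e = subst (ℚ._≤ 1ℚ ℚ.- e) (ℚ.+-inverseʳ e) (ℚ.+-monoˡ-≤ (ℚ.- e) e≤1)
      1-e≤f : 1ℚ ℚ.- e ℚ.≤ f
      1-e≤f = ≤-+⇒-≤ 1ℚ e f (1-e≤ g≤f)
      first : ℚ.∣ e ℚ.* e ℚ.* (r ℚ.- 1ℚ) ∣ ℚ.≤ f
      first = subst₂ ℚ._≤_
        (sym (trans (ℚ.∣p*q∣≡∣p∣*∣q∣ (e ℚ.* e) (r ℚ.- 1ℚ)) (cong (ℚ._* ℚ.∣ r ℚ.- 1ℚ ∣) (ℚ.0≤p⇒∣p∣≡p 0≤e²))))
        (ℚ.*-identityˡ f) (*-mono 0≤e² 0≤f e²≤1 r-near-1)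
      second : ℚ.∣ e ℚ.* e ℚ.- 1ℚ ∣ ℚ.≤ f ℚ.+ f
      second = ∣-∣≤ (e ℚ.* e) 1ℚ (f ℚ.+ f) (subst (ℚ._≤ f ℚ.+ f) (ℚ.+-identityˡ 0ℚ) (ℚ.+-mono-≤ 0≤f 0≤f)) e²≤1
        (subst₂ ℚ._≤_ (solve 1 (λ e → e :* e :+ (con 1ℚ :- e) :* (con 1ℚ :+ e) := con 1ℚ) refl e)
          (solve 2 (λ e f → e :* e :+ f :* (con 1ℚ :+ con 1ℚ) := e :* e :+ (f :+ f)) refl e f)
          (ℚ.+-monoʳ-≤ (e ℚ.* e) (*-mono 0≤1-e (ℚ.+-mono-≤ (0≤fromℕ 1) (0≤fromℕ 1)) 1-e≤f (ℚ.+-monoʳ-≤ 1ℚ e≤1))))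

  -- The factor 1 + p of p² - 1 is at least 1.
  ∣-1∣≤∣²-1∣ : ∀ p → 0ℚ ℚ.≤ p → ℚ.∣ p ℚ.- 1ℚ ∣ ℚ.≤ ℚ.∣ p ℚ.* p ℚ.- 1ℚ ∣
  ∣-1∣≤∣²-1∣ p 0≤p = subst₂ ℚ._≤_ (ℚ.*-identityʳ ℚ.∣ p ℚ.- 1ℚ ∣)
    (trans (cong (ℚ.∣ p ℚ.- 1ℚ ∣ ℚ.*_) (sym (ℚ.0≤p⇒∣p∣≡p (ℚ.≤-trans (0≤fromℕ 1) 1≤1+p))))
      (trans (sym (ℚ.∣p*q∣≡∣p∣*∣q∣ (p ℚ.- 1ℚ) (1ℚ ℚ.+ p)))
        (cong ℚ.∣_∣ (solve 1 (λ p → (p :- con 1ℚ) :* (con 1ℚ :+ p) := p :* p :- con 1ℚ) refl p))))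
    (*-mono (ℚ.0≤∣p∣ (p ℚ.- 1ℚ)) (ℚ.≤-trans (0≤fromℕ 1) 1≤1+p) ℚ.≤-refl 1≤1+p)
    where
    1≤1+p : 1ℚ ℚ.≤ 1ℚ ℚ.+ p
    1≤1+p = subst (ℚ._≤ 1ℚ ℚ.+ p) (ℚ.+-identityʳ 1ℚ) (ℚ.+-monoʳ-≤ 1ℚ 0≤p)

  -- Each of three approximations costs η: K by L, L² by κ, and κ by 1. The last two bound L² - 1
  -- and hence L - 1.
  near-1 : ∀ K L {κ η} → K ≈ L → (∀ n → 0ℚ ℚ.≤ seq L n) → seq L ⊗ seq L ≃ const κ →
           0ℚ ℚ.< η → ℚ.∣ κ ℚ.- 1ℚ ∣ ℚ.≤ η → ∃ λ N → ∀ n → N ℕ.≤ n → ℚ.∣ seq K n ℚ.- 1ℚ ∣ ℚ.≤ η ℚ.+ (η ℚ.+ η)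
  near-1 K L {κ} {η} K≈L 0≤L ⌊ L²≃κ ⌋ η>0 κ-near-1
    with M , f ← K≈L η η>0 | N , g ← L²≃κ η η>0
    = M ℕ.⊔ N , λ n n≥ → ℚ.≤-trans (∣-∣-triangle (seq K n) (seq L n) 1ℚ) (ℚ.+-mono-≤ (f n (ℕ.m⊔n≤o⇒m≤o M N n≥))
        (ℚ.≤-trans (∣-1∣≤∣²-1∣ (seq L n) (0≤L n))
          (ℚ.≤-trans (∣-∣-triangle (seq L n ℚ.* seq L n) κ 1ℚ) (ℚ.+-mono-≤ (g n (ℕ.m⊔n≤o⇒n≤o M N n≥)) κ-near-1))))

  fromℕ-dist : ∀ a b → ℚ.∣ fromℕ a ℚ.- fromℕ b ∣ ≡ fromℕ (dist a b)
  fromℕ-dist a b with ℕ.≤-total a b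
  ... | inj₁ a≤b = trans (∣-∣-sym (fromℕ a) (fromℕ b)) (go a b a≤b)
    where
    go : ∀ a b → a ℕ.≤ b → ℚ.∣ fromℕ b ℚ.- fromℕ a ∣ ≡ fromℕ (dist a b)
    go a b a≤b with c , refl ← ℕ.m≤n⇒∃[o]m+o≡n a≤b = trans
      (cong ℚ.∣_∣ (trans (cong (ℚ._- fromℕ a) (fromℕ-+ a c)) (solve 2 (λ a c → (a :+ c) :- a := c) refl (fromℕ a) (fromℕ c))))
      (trans (ℚ.0≤p⇒∣p∣≡p (0≤fromℕ c)) (cong fromℕ (sym (ℕ.∣m-m+n∣≡n a c))))
  ... | inj₂ b≤a with c , refl ← ℕ.m≤n⇒∃[o]m+o≡n b≤a = trans
      (cong ℚ.∣_∣ (trans (cong (ℚ._- fromℕ b) (fromℕ-+ b c)) (solve 2 (λ a c → (a :+ c) :- a := c) refl (fromℕ b) (fromℕ c))))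
      (trans (ℚ.0≤p⇒∣p∣≡p (0≤fromℕ c)) (cong fromℕ (sym (trans (ℕ.∣-∣-comm (b ℕ.+ c) b) (ℕ.∣m-m+n∣≡n b c)))))

  ratio-near-1 : ∀ N M k .{{_ : NonZero M}} → dist N M ℕ.* suc k ℕ.≤ M → ℚ.∣ + N ℚ./ M ℚ.- 1ℚ ∣ ℚ.≤ + 1 ℚ./ suc k
  ratio-near-1 N M k le = ℚ.*-cancelʳ-≤-pos (fromℕ (suc k)) {{fromℕ-positive (suc k)}}
    (ℚ.*-cancelʳ-≤-pos (fromℕ M) {{fromℕ-positive M}} (subst₂ ℚ._≤_
      (sym (trans (solve 3 (λ a k m → a :* k :* m := a :* m :* k) refl ℚ.∣ r ℚ.- 1ℚ ∣ (fromℕ (suc k)) (fromℕ M))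
        (trans (cong (ℚ._* fromℕ (suc k)) scaled) (sym (fromℕ-* (dist N M) (suc k))))))
      (sym (trans (cong (ℚ._* fromℕ M) (/-*-cancel 1 (suc k))) (ℚ.*-identityˡ (fromℕ M))))
      (fromℕ-mono-≤ le)))
    where
    r = + N ℚ./ M
    scaled : ℚ.∣ r ℚ.- 1ℚ ∣ ℚ.* fromℕ M ≡ fromℕ (dist N M)
    scaled = trans (cong (ℚ.∣ r ℚ.- 1ℚ ∣ ℚ.*_) (sym (ℚ.0≤p⇒∣p∣≡p (0≤fromℕ M))))
      (trans (sym (ℚ.∣p*q∣≡∣p∣*∣q∣ (r ℚ.- 1ℚ) (fromℕ M))) (trans (cong ℚ.∣_∣
        (trans (solve 2 (λ r m → (r :- con 1ℚ) :* m := r :* m :- m) refl r (fromℕ M)) (cong (ℚ._- fromℕ M) (/-*-cancel N M))))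
        (fromℕ-dist N M)))

-- Quantitative estimates and assembly of the theorem.

open import Data.Nat.Base using (_+_; _*_; _∸_; _^_; _⊔_; _≤_)

-- (Dk)² ≤ 4qM · k² ≤ q²M ≤ M². The last step needs q² ≤ M, so the exponent of M must be at least 2,
-- that is d ≥ 4.
≤-from-squared-estimate : ∀ {q D k m} → D * D ≤ 4 * q * q ^ (1 + suc m) → 4 * (k * k) ≤ q →
                          D * k ≤ q ^ (1 + suc m)
≤-from-squared-estimate {q} {D} {k} {m} D²≤4qM 4k²≤q = SqrtLemmas.≤-of-squares (D * k) M (begin
  (D * k) * (D * k)          ≡⟨ SqrtLemmas.square-swap D k ⟩
  (D * D) * (k * k)          ≤⟨ ℕ.*-monoˡ-≤ (k * k) D²≤4qM ⟩
  4 * q * M * (k * k)        ≡⟨ solve 3 (λ q M l → con 4 :* q :* M :* l := q :* (con 4 :* l) :* M) refl q M (k * k) ⟩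
  q * (4 * (k * k)) * M      ≤⟨ ℕ.*-monoˡ-≤ M (ℕ.*-monoʳ-≤ q 4k²≤q) ⟩
  q * q * M                  ≤⟨ ℕ.*-monoˡ-≤ M q²≤M ⟩
  M * M                      ∎)
  where
  open ℕ.≤-Reasoning
  open ℕ.+-*-Solver
  M = q ^ (1 + suc m)
  q²≤M : q * q ≤ M
  q²≤M with q ℕ.≟ 0
  ... | yes refl = ℕ.z≤n
  ... | no q≢0 = ℕ.*-monoʳ-≤ q (ℕ.m≤m*n q (q ^ m) {{ℕ.m^n≢0 q m {{ℕ.≢-nonZero q≢0}}}})

-- Division by p = tN turns N into 1/t, and 2tq^(1+m) into 2q^(1+m)/N, which is at most 4/q since
-- q^(2+m) ≤ 2N. This is the origin of the constant 4.
fraction-≤-max : ∀ h p t N q m .{{_ : NonZero p}} .{{_ : NonZero t}} .{{_ : NonZero q}} →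
  h ≤ N ⊔ 2 * t * q ^ suc m → p ≡ t * N → q ^ (2 + m) ≤ 2 * N →
  + h ℚ./ p ℚ.≤ fromℕ 4 ℚ.* (+ 1 ℚ./ t ℚ.⊔ + 1 ℚ./ q)
fraction-≤-max h p t N q m h≤ p≡tN M≤2N with ℕ.⊔-sel N (2 * t * q ^ suc m)
... | inj₁ eq = ℚ.≤-trans (Fractions./-≤ {h} {1} {4} p t (begin
    h * t              ≤⟨ ℕ.*-monoˡ-≤ t (subst (h ≤_) eq h≤) ⟩
    N * t              ≡⟨ trans (ℕ.*-comm N t) (sym p≡tN) ⟩
    p                  ≤⟨ ℕ.m≤n*m p 4 ⟩
    4 * 1 * p          ∎)) (ℚ.*-monoˡ-≤-nonNeg (fromℕ 4) (ℚ.p≤p⊔q (+ 1 ℚ./ t) (+ 1 ℚ./ q)))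
  where open ℕ.≤-Reasoning
... | inj₂ eq = ℚ.≤-trans (Fractions./-≤ {h} {1} {4} p q (begin
    h * q                        ≤⟨ ℕ.*-monoˡ-≤ q (subst (h ≤_) eq h≤) ⟩
    2 * t * q ^ suc m * q        ≡⟨ solve 3 (λ t k q → con 2 :* t :* k :* q := con 2 :* t :* (q :* k)) refl t (q ^ suc m) q ⟩
    2 * t * q ^ (2 + m)          ≤⟨ ℕ.*-monoʳ-≤ (2 * t) M≤2N ⟩
    2 * t * (2 * N)              ≡⟨ solve 2 (λ t n → con 2 :* t :* (con 2 :* n) := con 4 :* con 1 :* (t :* n)) refl t N ⟩
    4 * 1 * (t * N)              ≡⟨ cong (4 * 1 *_) p≡tN ⟨
    4 * 1 * p                    ∎)) (ℚ.*-monoˡ-≤-nonNeg (fromℕ 4) (ℚ.p≤q⊔p (+ 1 ℚ./ t) (+ 1 ℚ./ q)))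
  where
  open ℕ.≤-Reasoning
  open ℕ.+-*-Solver

module Estimates {q} (F : FiniteField q) (2≢0 : Geometry.2# F ≢ FiniteField.0# F) where

  open FiniteField F using (finite; q-nonZero)
  open Geometry F
  open Reals
  open RealLemmas
  open Fractions

  module _ {m} (B : BlockConstruction F (3 + m)) where

    open BlockConstruction B
    open BlockProperties F 2≢0 B

    open ParameterValue q N t m public using (value; value²; 0≤value; κ; κ-near-1)

    exact : ∀ K → IsExactParameter P 𝒮 K ⇔ K ≈ value
    exact = ParameterValue.exact⇔value q N t m σ-P-𝒮 ∣P∣≡tN ∣𝒮∣≡tq

  module _ {m} (B : BlockConstruction F (4 + m)) where

    open BlockConstruction B
    open BlockProperties F 2≢0 B

    M : ℕ
    M = q ^ (2 + m)

    N-near-M : ∀ k → 4 * (k * k) ≤ q → dist N M * k ≤ M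
    N-near-M k = ≤-from-squared-estimate {q} {dist N M} {k} {m} (subst (λ n → dist n M * dist n M ≤ 4 * q * M)
      (sym N≡level) (IsotropicPairProperties.level-estimate F 2≢0 isotropicPair R≢0))

    -- The choice k = 2 in `N-near-M` requires 4 · 2² = 16 ≤ q and yields |N - M| ≤ M/2.
    M≤2N : 16 ≤ q → M ≤ 2 * N
    M≤2N 16≤q = ℕ.+-cancelʳ-≤ M M (2 * N) (begin
      M + M                        ≡⟨ cong (_+_ M) (ℕ.+-identityʳ M) ⟨
      2 * M                        ≤⟨ ℕ.*-monoʳ-≤ 2 (ℕ.m≤n+∣n-m∣ M N) ⟩
      2 * (N + dist N M)           ≡⟨ solve 2 (λ n d → con 2 :* (n :+ d) := con 2 :* n :+ d :* con 2) refl N (dist N M) ⟩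
      2 * N + dist N M * 2         ≤⟨ ℕ.+-monoʳ-≤ (2 * N) (N-near-M 2 16≤q) ⟩
      2 * N + M                    ∎)
      where
      open ℕ.≤-Reasoning
      open ℕ.+-*-Solver

    -- Put η = δ/4. A positive rational is at least the reciprocal of its denominator, so 1/k ≤ η;
    -- then 1/q and |N/M - 1| are at most η and κ is within 3η ≤ δ of 1. The remaining two δ are
    -- lost in `near-1`.
    parameter-near-1 : ∀ {δ} → 0ℚ ℚ.< δ → let k = suc (ℚ.↧ₙ (½ ℚ.* (½ ℚ.* δ))) in 4 * (k * k) ≤ q →
      ∀ K → IsExactParameter P 𝒮 K → ∃ λ n₀ → ∀ n → n₀ ≤ n → ℚ.∣ seq K n ℚ.- 1ℚ ∣ ℚ.≤ δ ℚ.+ (δ ℚ.+ δ)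
    parameter-near-1 {δ} δ>0 4k²≤q K K-exact = near-1 K (value B) (Equivalence.to (exact B K) K-exact) (0≤value B) (value² B) δ>0
      (ℚ.≤-trans (κ-near-1 B (ratio-near-1 N M (ℚ.↧ₙ η) {{M-nonZero}} (N-near-M k 4k²≤q)) 1/q≤1/k)
        (ℚ.≤-trans (ℚ.+-mono-≤ 1/k≤η (ℚ.+-mono-≤ 1/k≤η 1/k≤η)) 3η≤δ))
      where
      open +-*-Solver
      η = ½ ℚ.* (½ ℚ.* δ)
      η>0 = half⁺ (half⁺ δ>0)
      k = suc (ℚ.↧ₙ η)
      instance
        M-nonZero : NonZero M
        M-nonZero = ℕ.m^n≢0 q (2 + m)
      1/k≤η : + 1 ℚ./ k ℚ.≤ η
      1/k≤η = SqrtLemmas.1/suc-≤ η η>0 (ℚ.↧ₙ η) ℕ.≤-refl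
      k≤q : k ≤ q
      k≤q = ℕ.≤-trans (ℕ.m≤m*n k k) (ℕ.≤-trans (ℕ.m≤n*m (k * k) 4) 4k²≤q)
      1/q≤1/k : + 1 ℚ./ q ℚ.≤ + 1 ℚ./ k
      1/q≤1/k = subst (+ 1 ℚ./ q ℚ.≤_) (ℚ.*-identityˡ (+ 1 ℚ./ k)) (/-≤ {1} {1} {1} q k (begin
        1 * k        ≡⟨ ℕ.*-identityˡ k ⟩
        k            ≤⟨ k≤q ⟩
        q            ≡⟨ ℕ.*-identityˡ q ⟨
        1 * 1 * q    ∎))
        where open ℕ.≤-Reasoning
      3η≤δ : η ℚ.+ (η ℚ.+ η) ℚ.≤ δ
      3η≤δ = subst₂ ℚ._≤_ (ℚ.+-identityˡ _)
        (solve 1 (λ δ → let η = con ½ :* (con ½ :* δ) in η :+ (η :+ (η :+ η)) := δ) refl δ)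
        (ℚ.+-monoˡ-≤ (η ℚ.+ (η ℚ.+ η)) (ℚ.<⇒≤ η>0))

    density-≤ : 16 ≤ q → maxHyperplaneDensity P {{P-nonZero}} ℚ.≤ fromℕ 4 ℚ.* (+ 1 ℚ./ t ℚ.⊔ + 1 ℚ./ q)
    density-≤ 16≤q = max≤v⁺
      -- The default value 0 of the maximum has to satisfy the bound as well.
      (subst₂ ℚ._≤_ (ℚ.*-zeroʳ (fromℕ 4)) refl (ℚ.*-monoˡ-≤-nonNeg (fromℕ 4)
        (ℚ.≤-trans 0≤1/t (ℚ.p≤p⊔q (+ 1 ℚ./ t) (+ 1 ℚ./ q)))))
      (All.map⁺ (All.map
        (λ {(a , b)} a≢𝟎 → fraction-≤-max ∣ P ∩ hyperplane a b ∣ ∣ P ∣ t N q m {{P-nonZero}}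
          (HyperplaneSections.card-P-∩-hyperplane F 2≢0 B (ℕ.s≤s ℕ.z≤n) a b a≢𝟎) ∣P∣≡tN (M≤2N 16≤q))
        (All.all-filter (mem? (hyperplaneParameters (4 + m))) elements)))
      where
      0≤1/t : 0ℚ ℚ.≤ + 1 ℚ./ t
      0≤1/t = ℚ.*-cancelʳ-≤-pos (fromℕ t) {{fromℕ-positive t}}
        (subst₂ ℚ._≤_ (sym (ℚ.*-zeroˡ (fromℕ t))) (sym (/-*-cancel 1 t)) (0≤fromℕ 1))

  ternary-parameter : (B : BlockConstruction F 3) → let open BlockConstruction B in
    N ≡ 2 * q → ∀ K → IsExactParameter P 𝒮 K → K ≈ fromℚ (1ℚ ℚ.- + 1 ℚ./ q) *ʳ √ 2
  ternary-parameter B N≡2q K K-exact = ⌈ ≃-trans {seq K} {seq (value B)} {seq (fromℚ e *ʳ √ 2)}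
    ⌊ Equivalence.to (exact B K) K-exact ⌋ (begin
    seq (value B)
      ≈⟨ pointwise (λ n → solve 3 (λ e r i → e :* (r :* i) := r :* (e :* i)) refl e (seq (√ N) n) (seq i n)) ⟩
    seq (√ N) ⊗ seq (fromℚ e *ʳ i)
      ≡⟨ cong (λ k → seq (√ k) ⊗ seq (fromℚ e *ʳ i)) N≡2q ⟩
    seq (√ (2 * q)) ⊗ seq (fromℚ e *ʳ i)
      ≈⟨ ⊗-congʳ (fromℚ e *ʳ i) (√-* 2 q) ⟩
    seq (√ 2) ⊗ seq (√ q) ⊗ seq (fromℚ e *ʳ i)
      -- The factor 1 is the empty power that ends `√ q ^ʳ 1`; with it the term has the shape of
      -- `c`.
      ≈⟨ pointwise (λ n → solve 4 (λ s r e i → s :* r :* (e :* i) := e :* s :* (r :* con 1ℚ) :* i) refl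
           (seq (√ 2) n) (seq (√ q) n) e (seq i n)) ⟩
    seq (fromℚ e *ʳ √ 2) ⊗ seq c ⊗ seq i
      ≈⟨ cancel-inverse (seq (fromℚ e *ʳ √ 2)) c (√^⁺ q 1) ⟩
    seq (fromℚ e *ʳ √ 2) ∎) ⌉
    where
    open BlockConstruction B using (N; t-nonZero)
    open BlockProperties F 2≢0 B using (N-nonZero)
    open import Relation.Binary.Reasoning.Setoid ≃-setoid
    open +-*-Solver
    e = 1ℚ ℚ.- + 1 ℚ./ q
    c = √ q ^ʳ 1
    i = c ⁻¹⟨ √^⁺ q 1 ⟩
    instance
      2q≢0 : NonZero (2 * q)
      2q≢0 = ℕ.m*n≢0 2 q
theorem4p1 :
  (∀ {q} (F : FiniteField q) → OddPrimePower q →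
   ∀ {d} → 3 ≤ d → (B : BlockConstruction F d) →
   let open FiniteField F using (0#)
       open FiniteField F using (q-nonZero)
       open FiniteField F using (finite)
       open Geometry F
       open BlockConstruction B
   in
     -- (1)
     (∣ P ∣ ≡ t * N × ∣ 𝒮 ∣ ≡ t * q)
     -- (2)
   × (∀ b z → b ∈ Z → z ∈ Z →
        (b ≡ z → σ (A b) (𝒮ᶻ z) ≡ (fromℕ q ℚ.- 1ℚ) ℚ.* fromℕ N)
      × (b ≢ z → σ (A b) (𝒮ᶻ z) ≡ 0ℚ))
   × σ P 𝒮 ≡ fromℕ t ℚ.* (fromℕ q ℚ.- 1ℚ) ℚ.* fromℕ N
   × σ P 𝒮 ≡ ∑ Z (λ z → σ (A z) (𝒮ᶻ z))
   × (∀ K → IsExactParameter P 𝒮 K ⇔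
        K ≈ fromℚ (1ℚ ℚ.- + 1 ℚ./ q) *ʳ (√ N /ʳ (√ q) ^ʳ (d ∸ 2) ⟨ √^⁺ q (d ∸ 2) ⟩))
     -- (3)
   × (∀ x → x ∈ P → degree 𝒮 x ≡ q + t ∸ 1)
     -- (4)
   × (∀ z → z ∈ Z → ∀ u u′ → u ≢ u′ →
        points (sphere z u) ∩ points (sphere z u′) ≐ A z
      × (∃ λ k → k ≢ 0# × centreOf (sphere z u′) ⊖ centreOf (sphere z u) ≡ k · v)
      × radicalHyperplane (sphere z u) (sphere z u′) ≐ H z)
     -- (5), first part
   × (4 ≤ d → ∀ a b → a ≢ 𝟎 → ∣ P ∩ hyperplane a b ∣ ≤ N ⊔ 2 * t * q ^ (d ∸ 3)))

  -- (2), K → 1 as q → ∞ for fixed d ≥ 4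
  × (∀ d → 4 ≤ d → ∀ ε → 0ʳ <ʳ ε → ∃ λ q₀ →
     ∀ {q} (F : FiniteField q) → OddPrimePower q → q₀ ≤ q →
     (B : BlockConstruction F d) →
     let open BlockConstruction B in
     ∀ K → IsExactParameter P 𝒮 K → ∣ K -ʳ 1ʳ ∣ʳ <ʳ ε)

  -- (2), d = 3
  × (∀ {q} (F : FiniteField q) → OddPrimePower q → (I : IsotropicPair F 3) →
     let open FiniteField F using (Carrier)
         open FiniteField F using (q-nonZero)
         open IsotropicPair I using (Admissible)
     in
     ∃ λ R → Σ (Admissible R) λ R-admissible →
     (Z : Subset Carrier) (Z-nonempty : Nonempty Z) →
     let open BlockConstruction (block I R R-admissible Z Z-nonempty) using (P)
         open BlockConstruction (block I R R-admissible Z Z-nonempty) using (𝒮)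
         open IsotropicPair I using (IsExactParameter)
     in
     ∀ K → IsExactParameter P 𝒮 K → K ≈ fromℚ (1ℚ ℚ.- + 1 ℚ./ q) *ʳ √ 2)

  -- (5), second part
  × (∀ d → 4 ≤ d → ∃ λ C → 0ℚ ℚ.< C × ∃ λ q₀ →
     ∀ {q} (F : FiniteField q) → OddPrimePower q → q₀ ≤ q →
     (B : BlockConstruction F d) →
     let open FiniteField F using (q-nonZero)
         open BlockConstruction B
     in
     maxHyperplaneDensity P ℚ.≤ C ℚ.* (+ 1 ℚ./ t ℚ.⊔ + 1 ℚ./ q))
theorem4p1 =
    (λ { F odd-q (ℕ.s≤s (ℕ.s≤s (ℕ.s≤s ℕ.z≤n))) B →
       let 2≢0 = FieldProperties.2≢0 F odd-q
           open BlockProperties F 2≢0 B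
       in
         (∣P∣≡tN , ∣𝒮∣≡tq)
       , (λ b z _ _ → (λ { refl → σ-A-𝒮ᶻ-≡ b }) , σ-A-𝒮ᶻ-≢)
       , σ-P-𝒮
       , σ-P-𝒮-∑
       , Estimates.exact F 2≢0 B
       , degree-𝒮
       , (λ z _ u u′ u≢u′ →
            sphere-∩ z u u′ u≢u′
          , (_ , FieldProperties.x≢y⇒x-y≢0 F (≢-sym u≢u′) , centre-difference z u u′)
          , radical z u u′ u≢u′)
       , (λ { (ℕ.s≤s (ℕ.s≤s (ℕ.s≤s 1≤m))) → HyperplaneSections.card-P-∩-hyperplane F 2≢0 B 1≤m }) })
  , (λ { _ (ℕ.s≤s (ℕ.s≤s (ℕ.s≤s (ℕ.s≤s ℕ.z≤n)))) ε (δ , n₀ , δ>0 , δ≤ε) →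
       -- The strict inequality on reals requires a fixed margin: of δ = 4η, three parts bound |K -
       -- 1| and the fourth is that margin.
       let η   = ½ ℚ.* (½ ℚ.* δ)
           η>0 = RealLemmas.half⁺ (RealLemmas.half⁺ δ>0)
           k   = suc (ℚ.↧ₙ (½ ℚ.* (½ ℚ.* η)))
       in 4 * (k * k) , λ F odd-q q₀≤q B K K-exact →
         let n₁ , near = Estimates.parameter-near-1 F (FieldProperties.2≢0 F odd-q) B η>0 q₀≤q K K-exact
         in η , n₀ ⊔ n₁ , η>0 , λ n n≥ → ℚ.≤-trans (ℚ.+-monoˡ-≤ η (near n (ℕ.m⊔n≤o⇒n≤o n₀ n₁ n≥)))
              (subst (ℚ._≤ seq ε n) (4η≡δ δ) (δ≤ε n (ℕ.m⊔n≤o⇒m≤o n₀ n₁ n≥))) })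
  , (λ F odd-q I →
       let 2≢0 = FieldProperties.2≢0 F odd-q
           open Ternary F 2≢0 I
           y , y∈U , Qy≢0 = anisotropic
       in IsotropicPair.Q I y , (Qy≢0 , y , y∈U , refl) , λ Z Z-nonempty →
         let B = block I (IsotropicPair.Q I y) (Qy≢0 , y , y∈U , refl) Z Z-nonempty
         in Estimates.ternary-parameter F 2≢0 B
              (trans (BlockProperties.N≡level F 2≢0 B) (level-ternary y∈U Qy≢0)))
  , (λ { _ (ℕ.s≤s (ℕ.s≤s (ℕ.s≤s (ℕ.s≤s ℕ.z≤n)))) → fromℕ 4 , ℚ.positive⁻¹ (fromℕ 4) , 16 ,
         λ F odd-q 16≤q B → Estimates.density-≤ F (FieldProperties.2≢0 F odd-q) B 16≤q })
  where
  4η≡δ : ∀ δ → let η = ½ ℚ.* (½ ℚ.* δ) in 0ℚ ℚ.+ δ ≡ η ℚ.+ (η ℚ.+ η) ℚ.+ η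
  4η≡δ = solve 1 (λ δ → let η = con ½ :* (con ½ :* δ) in con 0ℚ :+ δ := η :+ (η :+ η) :+ η) refl
    where open +-*-Solver
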